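{- Let $m>1$ and $\pi\in S_m$. For $n\ge m$, let $X_\pi$ be the random variable on $S_n$ (uniform distribution) with $X_\pi(\tau)$ the number of occurrences of $\pi$ in $\tau$. Then, as $n\to\infty$, $$V\!ar(X_\pi)=c(\pi) n^{2m-1}+O(n^{2m-2}),$$ where $$c(\pi)=\frac{1}{((2m-1)!)^2}\left(\mathrm{Tr}(A_mP_{\pi}A_mP_{\pi}^{ -1})-\binom{2m-1}{m-1}^2\right)>0,$$ and $$\mathrm{Tr}(A_mP_{\pi}A_mP_{\pi}^{ -1})=\sum_{i,j=1}^{m}[i,j]_m\,[\pi(i),\pi(j)]_m.$$ Consequently the standard deviation satisfies $\sigma(X_\pi)=\sqrt{c(\pi)}\, n^{m-\frac{1}{2}}+O(n^{m-1})$.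
   Context: An occurrence of $\pi\in S_m$ in $\tau\in S_n$ is a set of $m$ positions of $\tau$ such that the subsequence of $\tau$ at those positions is order-isomorphic to $\pi$. $P_\pi=[\delta(\pi(i),j)]_{m\times m}$ is the permutation matrix of $\pi$ ($\delta$ the Kronecker delta). For integers $1\le i,j\le m$, $[i,j]_m=\binom{i-1+j-1}{i-1}\binom{m-i+m-j}{m-i}$, and $A_m$ is the $m\times m$ matrix with $(A_m)_{ij}=[i,j]_m$. -}

module Defs where

open import Data.Nat as ℕ using (ℕ; zero; suc; _∸_; _!)
open import Data.Nat.Properties using (_!*_!≢0)
open import Data.Nat.Combinatorics using (_C_)
open import Data.Fin as Fin using (Fin; toℕ)
open import Data.Fin.Properties using (all?; _≟_; _<?_)
open import Data.Fin.Permutation using (Permutation′; _⟨$⟩ʳ_; flip)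
open import Data.Vec as Vec using (Vec; []; _∷_; lookup)
open import Data.List as List using (List; []; _∷_; map; concatMap; filter; length; allFin)
open import Data.Nat.ListAction using (sum)
open import Data.Integer as ℤ using (ℤ; +_)
open import Data.Rational as ℚ using (ℚ)
open import Data.Product using (_×_)
open import Relation.Binary.PropositionalEquality using (_≡_)
open import Relation.Nullary.Decidable using (Dec; yes; no; _×-dec_; _→-dec_)

Σ[_] : ∀ m → (Fin m → ℕ) → ℕ
Σ[ m ] f = sum (map f (allFin m))

Matrix : ℕ → Set
Matrix m = Fin m → Fin m → ℕ

_⊗_ : ∀ {m} → Matrix m → Matrix m → Matrix m
_⊗_ {m} A B i j = Σ[ m ] (λ k → A i k ℕ.* B k j)

Tr : ∀ {m} → Matrix m → ℕ
Tr {m} A = Σ[ m ] (λ i → A i i)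

δ : ∀ {m} → Fin m → Fin m → ℕ
δ i j with i ≟ j
... | yes _ = 1
... | no _  = 0

P : ∀ {m} → Permutation′ m → Matrix m
P π i j = δ (π ⟨$⟩ʳ i) j

-- [i,j]_m with 1-based i,j; here i,j : Fin m are 0-based,
-- so i-1 = toℕ i and m-i = m-1-toℕ i.
⟦_,_⟧ : ∀ {m} → Fin m → Fin m → ℕ
⟦_,_⟧ {m} i j =
  ((toℕ i ℕ.+ toℕ j) C toℕ i) ℕ.*
  (((m ∸ 1 ∸ toℕ i) ℕ.+ (m ∸ 1 ∸ toℕ j)) C (m ∸ 1 ∸ toℕ i))

A : ∀ m → Matrix m
A m i j = ⟦ i , j ⟧

trace : ∀ {m} → Permutation′ m → ℕ
trace {m} π = Tr (((A m ⊗ P π) ⊗ A m) ⊗ P (flip π))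

-- S_n: all bijections Fin n → Fin n, as vectors (τ(0),…,τ(n-1)).

vecs : ∀ {X : Set} → List X → ∀ k → List (Vec X k)
vecs xs zero    = [] ∷ []
vecs xs (suc k) = concatMap (λ x → map (x ∷_) (vecs xs k)) xs

Injective : ∀ {n k} → Vec (Fin n) k → Set
Injective v = ∀ i j → lookup v i ≡ lookup v j → i ≡ j

injective? : ∀ {n k} (v : Vec (Fin n) k) → Dec (Injective v)
injective? v = all? λ i → all? λ j → (lookup v i ≟ lookup v j) →-dec (i ≟ j)

-- every element of S_n appears exactly once in this list
S : ∀ n → List (Vec (Fin n) n)
S n = filter injective? (vecs (allFin n) n)

-- Occurrences of π ∈ S_m in τ ∈ S_n: strictly increasing position
-- vectors p (i.e. m-element sets of positions) such that τ∘p is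
-- order-isomorphic to π.

Increasing : ∀ {n m} → Vec (Fin n) m → Set
Increasing p = ∀ a b → a Fin.< b → lookup p a Fin.< lookup p b

OrderIso : ∀ {n m} → Permutation′ m → Vec (Fin n) n → Vec (Fin n) m → Set
OrderIso π τ p = ∀ a b →
  ((lookup τ (lookup p a) Fin.< lookup τ (lookup p b)) → (π ⟨$⟩ʳ a Fin.< π ⟨$⟩ʳ b)) ×
  ((π ⟨$⟩ʳ a Fin.< π ⟨$⟩ʳ b) → (lookup τ (lookup p a) Fin.< lookup τ (lookup p b)))

Occurrence : ∀ {n m} → Permutation′ m → Vec (Fin n) n → Vec (Fin n) m → Set
Occurrence π τ p = Increasing p × OrderIso π τ p

occurrence? : ∀ {n m} (π : Permutation′ m) (τ : Vec (Fin n) n) (p : Vec (Fin n) m) →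
              Dec (Occurrence π τ p)
occurrence? π τ p =
  (all? λ a → all? λ b → (a <? b) →-dec (lookup p a <? lookup p b)) ×-dec
  (all? λ a → all? λ b →
     ((lookup τ (lookup p a) <? lookup τ (lookup p b)) →-dec (π ⟨$⟩ʳ a <? π ⟨$⟩ʳ b)) ×-dec
     ((π ⟨$⟩ʳ a <? π ⟨$⟩ʳ b) →-dec (lookup τ (lookup p a) <? lookup τ (lookup p b))))

X : ∀ {m n} → Permutation′ m → Vec (Fin n) n → ℕ
X {m} {n} π τ = length (filter (occurrence? π τ) (vecs (allFin n) m))

mean : List ℕ → ℚ
mean []       = ℚ.0ℚ
mean (x ∷ xs) = (+ sum (x ∷ xs)) ℚ./ suc (length xs)

E : ∀ {m} → Permutation′ m → ℕ → ℚ
E π n = mean (map (X π) (S n))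

E² : ∀ {m} → Permutation′ m → ℕ → ℚ
E² π n = mean (map (λ τ → X π τ ℕ.* X π τ) (S n))

Var : ∀ {m} → Permutation′ m → ℕ → ℚ
Var π n = E² π n ℚ.- (E π n ℚ.* E π n)

c : ∀ {m} → Permutation′ m → ℚ
c {m} π = ℚ._/_ numer denom {{(2 ℕ.* m ∸ 1) !* (2 ℕ.* m ∸ 1) !≢0}}
  where
  numer : ℤ
  numer = (+ trace π) ℤ.- (+ (((2 ℕ.* m ∸ 1) C (m ∸ 1)) ℕ.^ 2))
  denom : ℕ
  denom = (2 ℕ.* m ∸ 1) ! ℕ.* (2 ℕ.* m ∸ 1) !

_^ℚ_ : ℕ → ℕ → ℚ
n ^ℚ k = (+ (n ℕ.^ k)) ℚ./ 1

{-# OPTIONS --safe #-}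
-- An occurrence of π in τ is a pair of increasing vectors p (positions) and v (values) with
-- τ ∘ p = v ∘ π, and a partial injection of k points extends to (n-k)! permutations. Hence
-- E[X²] is a sum over quadruples (p,q,v,w), and a quadruple contributes only if p, q coincide in
-- the same places as v ∘ π, w ∘ π. Writing f k for the falling factorial, the disjoint pairs give
-- f(2m)/m!⁴, the pairs meeting in one point give trace π · f(2m-1)/(2m-1)!², and the number r of
-- pairs meeting in at least two points bounds the rest. Counting all pairs of positions in the
-- same way gives f(m)² = f(2m) + m² f(2m-1) + m!² r, so that f(2m) cancels in the variance, and
-- comparing falling factorials shows r = O(n^(2m-2)).
--
-- For c π > 0, the Vandermonde identity gives A_m = Σ u uᵀ over the vectors
-- u_{kl}(i) = C(i,k) C(m-1-i,l). With T_{αβ} = Σ_i u_α(i) u_β(π i) and s_α = Σ_i u_α(i), the trace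
-- is Σ T², and since all rows of A_m have the same sum C(2m-1,m-1), Cauchy–Schwarz for T against
-- s_α s_β is the inequality trace π ≥ C(2m-1,m-1)²; it is strict because m ≥ 2 makes
-- m T_{αα} ≠ s_α² = 1 when u_α is the indicator of the first index.
module Submission where

open import Defs
open import Data.Nat using (ℕ; _≥_; _>_; _*_; _∸_)
open import Data.Fin using (Fin)
open import Data.Fin.Permutation using (Permutation′; _⟨$⟩ʳ_)
open import Data.Product using (_×_; ∃₂)
open import Relation.Binary.PropositionalEquality using (_≡_)
open import Data.Rational as ℚ using (ℚ)

open import Data.Nat using (zero; suc; _+_; _^_; _≤_; _<_; z≤n; s≤s; s<s; z<s; _!; _/_; NonZero)
open import Data.Nat.Properties hiding (_<?_)
open import Data.Nat.Combinatorics using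
  (_C_; nCn≡1; nCk≡nC[n∸k]; nCk+nC[k+1]≡[n+1]C[k+1]; k![n∸k]!∣n!)
open import Data.Nat.Combinatorics.Base using (_P′_)
open import Data.Nat.Combinatorics.Specification using (k>n⇒nCk≡0; nCk≡n!/k![n-k]!)
open import Data.Nat.DivMod using (m/n*n≡m)
open import Data.Nat.ListAction using (sum)
open import Data.Nat.Solver using (module +-*-Solver)
open import Data.Integer as ℤ using ()
import Data.Integer.Properties as ℤ
open import Data.Rational.Properties as ℚ using
  ( toℚᵘ-fromℚᵘ; toℚᵘ-injective; toℚᵘ-homo-+; toℚᵘ-homo-*; normalize-nonNeg; normalize-pos
  ; nonNegative⁻¹; positive⁻¹; nonNeg*nonNeg⇒nonNeg; *-monoˡ-≤-nonNeg; *-monoʳ-≤-nonNeg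
  ; ∣p+q∣≤∣p∣+∣q∣; ∣p-q∣≤∣p∣+∣q∣; ∣p*q∣≡∣p∣*∣q∣; 0≤p⇒∣p∣≡p )
open import Data.Rational.Solver using () renaming (module +-*-Solver to ℚ-Solver)
open import Data.Rational.Unnormalised as ℚᵘ using (mkℚᵘ; *≡*; _≃_)
import Data.Rational.Unnormalised.Properties as ℚᵘ
open import Data.Fin as Fin using (zero; suc; toℕ; fromℕ; punchIn; punchOut)
open import Data.Fin.Properties as Fin using (all?; any?; _<?_)
open import Data.Fin.Permutation using (_⟨$⟩ˡ_; flip; inverseˡ; inverseʳ)
open import Data.List using
  (List; []; _∷_; _++_; map; concatMap; filter; length; allFin; cartesianProduct)
open import Data.List.Properties using (length-map; map-tabulate)
open import Data.List.Relation.Unary.All as All using (All; []; _∷_)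
import Data.List.Relation.Unary.All.Properties as All
open import Data.Vec as Vec using (Vec; []; _∷_; lookup)
import Data.Vec.Properties as Vec
open import Data.Product using (_,_; proj₁; proj₂; ∃)
open import Data.Sum using (_⊎_; inj₁; inj₂)
open import Function using (_∘_; id)
open import Function.Definitions using () renaming (Injective to Inj)
open import Relation.Binary.Definitions using (DecidableEquality; tri<; tri≈; tri>)
open import Relation.Binary.PropositionalEquality using
  (_≢_; refl; sym; trans; cong; cong₂; subst; subst₂; module ≡-Reasoning)
open import Relation.Nullary using
  (¬_; Dec; yes; no; contradiction; ¬?; _×-dec_; _⊎-dec_; _→-dec_)

-- Each class of quadruples yields a single falling factorial because positions and values are
-- counted by the same number. If a class has D position pairs on k points, it has D value pairs as
-- well, every matching quadruple is carried by (n-k)! permutations, and D is f(k) over a constant;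
-- so D²(n-k)!/n! is f(k) over the square of that constant. For one common point, at place a of p
-- and b of q, the count is C(n,2m-1)[a,b], and the value pair must meet at (π(a),π(b)); this is how
-- the products [a,b][π(a),π(b)] arise.
--
-- The binomial subtracted in `c` comes from E[X]²: as C(2m-1,m-1) m!² = m (2m-1)!, the term m²
-- f(2m-1)/m!⁴ equals C(2m-1,m-1)² f(2m-1)/(2m-1)!².
--
-- The two remainders, R/n! in E[X²] and r/m!² in E[X]², are both at most r, so no finer count of
-- pairs with several common points enters.
--
-- Counts stay in ℕ with denominators cleared, and a witness `d` with `k + d ≡ n` stands for the
-- difference n-k.

private variable
  I K : Set

-- Finite sums over lists

∑ : List I → (I → ℕ) → ℕ
∑ xs f = sum (map f xs)

∑-cong-All : ∀ {xs : List I} {Q : I → Set} {f g : I → ℕ} → All Q xs →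
             (∀ {x} → Q x → f x ≡ g x) → ∑ xs f ≡ ∑ xs g
∑-cong-All []       eq = refl
∑-cong-All (q ∷ qs) eq = cong₂ _+_ (eq q) (∑-cong-All qs eq)

∑-cong : ∀ (xs : List I) {f g : I → ℕ} → (∀ x → f x ≡ g x) → ∑ xs f ≡ ∑ xs g
∑-cong []       eq = refl
∑-cong (x ∷ xs) eq = cong₂ _+_ (eq x) (∑-cong xs eq)

∑-mono : ∀ (xs : List I) {f g : I → ℕ} → (∀ x → f x ≤ g x) → ∑ xs f ≤ ∑ xs g
∑-mono []       le = z≤n
∑-mono (x ∷ xs) le = +-mono-≤ (le x) (∑-mono xs le)

∑-+ : ∀ (xs : List I) (f g : I → ℕ) → ∑ xs (λ x → f x + g x) ≡ ∑ xs f + ∑ xs g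
∑-+ []       f g = refl
∑-+ (x ∷ xs) f g rewrite ∑-+ xs f g =
  solve 4 (λ a b c d → (a :+ b) :+ (c :+ d) := (a :+ c) :+ (b :+ d)) refl
    (f x) (g x) (∑ xs f) (∑ xs g)
  where open +-*-Solver using (solve; _:=_; _:+_; _:*_; con)

∑-*ˡ : ∀ (xs : List I) c (f : I → ℕ) → ∑ xs (λ x → c * f x) ≡ c * ∑ xs f
∑-*ˡ []       c f = sym (*-zeroʳ c)
∑-*ˡ (x ∷ xs) c f rewrite ∑-*ˡ xs c f = sym (*-distribˡ-+ c (f x) (∑ xs f))

∑-*ʳ : ∀ (xs : List I) c (f : I → ℕ) → ∑ xs (λ x → f x * c) ≡ ∑ xs f * c
∑-*ʳ []       c f = refl
∑-*ʳ (x ∷ xs) c f rewrite ∑-*ʳ xs c f = sym (*-distribʳ-+ c (f x) (∑ xs f))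

∑-zero : ∀ (xs : List I) → ∑ xs (λ _ → 0) ≡ 0
∑-zero []       = refl
∑-zero (x ∷ xs) = ∑-zero xs

∑-≡0 : ∀ (xs : List I) {f : I → ℕ} → (∀ x → f x ≡ 0) → ∑ xs f ≡ 0
∑-≡0 xs eq = trans (∑-cong xs eq) (∑-zero xs)

∑-swap : ∀ (xs : List I) (ys : List K) (f : I → K → ℕ) →
         ∑ xs (λ x → ∑ ys (f x)) ≡ ∑ ys (λ y → ∑ xs (λ x → f x y))
∑-swap []       ys f = sym (∑-zero ys)
∑-swap (x ∷ xs) ys f rewrite ∑-swap xs ys f = sym (∑-+ ys (f x) _)

∑-product : ∀ (xs : List I) (ys : List K) (f : I → ℕ) (g : K → ℕ) →
            ∑ xs f * ∑ ys g ≡ ∑ xs (λ x → ∑ ys (λ y → f x * g y))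
∑-product xs ys f g = trans (sym (∑-*ʳ xs (∑ ys g) f))
                            (∑-cong xs λ x → sym (∑-*ˡ ys (f x) g))

∑-map : ∀ (h : I → K) (xs : List I) (f : K → ℕ) → ∑ (map h xs) f ≡ ∑ xs (f ∘ h)
∑-map h []       f = refl
∑-map h (x ∷ xs) f = cong (f (h x) +_) (∑-map h xs f)

∑-++ : ∀ (xs ys : List I) (f : I → ℕ) → ∑ (xs ++ ys) f ≡ ∑ xs f + ∑ ys f
∑-++ []       ys f = refl
∑-++ (x ∷ xs) ys f = trans (cong (f x +_) (∑-++ xs ys f)) (sym (+-assoc (f x) _ _))

∑-concatMap : ∀ (h : I → List K) (xs : List I) (f : K → ℕ) →
              ∑ (concatMap h xs) f ≡ ∑ xs (λ x → ∑ (h x) f)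
∑-concatMap h []       f = refl
∑-concatMap h (x ∷ xs) f =
  trans (∑-++ (h x) (concatMap h xs) f) (cong (∑ (h x) f +_) (∑-concatMap h xs f))

∑-const : ∀ (xs : List I) c → ∑ xs (λ _ → c) ≡ length xs * c
∑-const []       c = refl
∑-const (x ∷ xs) c = cong (c +_) (∑-const xs c)

∑-allFin-suc : ∀ n (f : Fin (suc n) → ℕ) →
               ∑ (allFin (suc n)) f ≡ f zero + ∑ (allFin n) (f ∘ suc)
∑-allFin-suc n f = cong (f zero +_)
  (trans (cong (λ xs → ∑ xs f) (sym (map-tabulate id suc))) (∑-map suc (allFin n) f))

∑-allFin-const : ∀ n c → ∑ (allFin n) (λ _ → c) ≡ n * c
∑-allFin-const zero    c = refl
∑-allFin-const (suc n) c =
  trans (∑-allFin-suc n (λ _ → c)) (cong (c +_) (∑-allFin-const n c))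

-- Indicators of decidable propositions, and sifting

𝟙 : ∀ {Q : Set} → Dec Q → ℕ
𝟙 (yes _) = 1
𝟙 (no  _) = 0

private variable
  Φ Ψ Ω : Set

𝟙-yes : (d : Dec Φ) → Φ → 𝟙 d ≡ 1
𝟙-yes (yes _) q = refl
𝟙-yes (no ¬q) q = contradiction q ¬q

𝟙-no : (d : Dec Φ) → ¬ Φ → 𝟙 d ≡ 0
𝟙-no (yes q) ¬q = contradiction q ¬q
𝟙-no (no  _) ¬q = refl

𝟙≤1 : (d : Dec Φ) → 𝟙 d ≤ 1
𝟙≤1 (yes _) = s≤s z≤n
𝟙≤1 (no  _) = z≤n

𝟙-cong : (d : Dec Φ) (e : Dec Ψ) → (Φ → Ψ) → (Ψ → Φ) → 𝟙 d ≡ 𝟙 e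
𝟙-cong (yes q) e f g = sym (𝟙-yes e (f q))
𝟙-cong (no ¬q) e f g = sym (𝟙-no e (¬q ∘ g))

𝟙-× : (d : Dec Φ) (e : Dec Ψ) → 𝟙 (d ×-dec e) ≡ 𝟙 d * 𝟙 e
𝟙-× (yes q) (yes r) = refl
𝟙-× (yes q) (no ¬r) = refl
𝟙-× (no ¬q) e       = refl

𝟙-×-cong : (d : Dec Φ) (e : Dec Ψ) (u : Dec Ω) → (Φ → Ψ → Ω) → (Ω → Φ × Ψ) →
           𝟙 d * 𝟙 e ≡ 𝟙 u
𝟙-×-cong d e u f g = trans (sym (𝟙-× d e)) (𝟙-cong _ u (λ (q , r) → f q r) g)

∑-filter : ∀ {Φ : I → Set} (Φ? : ∀ x → Dec (Φ x)) (xs : List I) (f : I → ℕ) →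
           ∑ (filter Φ? xs) f ≡ ∑ xs (λ x → 𝟙 (Φ? x) * f x)
∑-filter Φ? []       f = refl
∑-filter Φ? (x ∷ xs) f with Φ? x
... | yes _ = cong₂ _+_ (sym (+-identityʳ (f x))) (∑-filter Φ? xs f)
... | no  _ = ∑-filter Φ? xs f

length-filter : ∀ {Φ : I → Set} (Φ? : ∀ x → Dec (Φ x)) (xs : List I) →
                length (filter Φ? xs) ≡ ∑ xs (λ x → 𝟙 (Φ? x))
length-filter Φ? []       = refl
length-filter Φ? (x ∷ xs) with Φ? x
... | yes _ = cong suc (length-filter Φ? xs)
... | no  _ = length-filter Φ? xs

-- xs lists every element of I exactly once.
Sifting : List I → DecidableEquality I → Set
Sifting {I} xs _≟_ = ∀ (x : I) (f : I → ℕ) → ∑ xs (λ y → 𝟙 (y ≟ x) * f y) ≡ f x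

allFin-sifting : ∀ n → Sifting (allFin n) Fin._≟_
allFin-sifting (suc n) zero f = begin
  ∑ (allFin (suc n)) (λ y → 𝟙 (y Fin.≟ zero) * f y)
    ≡⟨ ∑-allFin-suc n _ ⟩
  f zero + 0 + ∑ (allFin n) (λ _ → 0)
    ≡⟨ cong (f zero + 0 +_) (∑-zero (allFin n)) ⟩
  f zero + 0 + 0
    ≡⟨ trans (+-identityʳ _) (+-identityʳ _) ⟩
  f zero ∎
  where open ≡-Reasoning
allFin-sifting (suc n) (suc x) f = begin
  ∑ (allFin (suc n)) (λ y → 𝟙 (y Fin.≟ suc x) * f y)
    ≡⟨ ∑-allFin-suc n (λ y → 𝟙 (y Fin.≟ suc x) * f y) ⟩
  ∑ (allFin n) (λ y → 𝟙 (suc y Fin.≟ suc x) * f (suc y))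
    ≡⟨ ∑-cong (allFin n) (λ y → cong (_* f (suc y))
         (𝟙-cong (suc y Fin.≟ suc x) (y Fin.≟ x) Fin.suc-injective (cong suc))) ⟩
  ∑ (allFin n) (λ y → 𝟙 (y Fin.≟ x) * f (suc y))
    ≡⟨ allFin-sifting n x (f ∘ suc) ⟩
  f (suc x) ∎
  where open ≡-Reasoning

∑-vecs-suc : ∀ (xs : List I) k (f : Vec I (suc k) → ℕ) →
             ∑ (vecs xs (suc k)) f ≡ ∑ xs (λ x → ∑ (vecs xs k) (λ v → f (x ∷ v)))
∑-vecs-suc xs k f = trans (∑-concatMap (λ x → map (x ∷_) (vecs xs k)) xs f)
                          (∑-cong xs λ x → ∑-map (x ∷_) (vecs xs k) f)

vecs-sifting : ∀ {xs : List I} {_≟_ : DecidableEquality I} → Sifting xs _≟_ →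
               ∀ k → Sifting (vecs xs k) (Vec.≡-dec _≟_)
vecs-sifting sift zero [] f = trans (+-identityʳ _) (+-identityʳ _)
vecs-sifting {xs = xs} {_≟_} sift (suc k) (x ∷ v) f = begin
  ∑ (vecs xs (suc k)) (λ w → 𝟙 (w ≟ⱽ (x ∷ v)) * f w)
    ≡⟨ ∑-vecs-suc xs k _ ⟩
  ∑ xs (λ y → ∑ (vecs xs k) (λ w → 𝟙 ((y ∷ w) ≟ⱽ (x ∷ v)) * f (y ∷ w)))
    ≡⟨ ∑-cong xs (λ y → trans
         (∑-cong (vecs xs k) λ w → trans
           (cong (_* f (y ∷ w)) (sym (𝟙-×-cong (y ≟ x) (w ≟ⱽ v) ((y ∷ w) ≟ⱽ (x ∷ v))
              (cong₂ _∷_) Vec.∷-injective)))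
           (*-assoc (𝟙 (y ≟ x)) _ _))
         (∑-*ˡ (vecs xs k) (𝟙 (y ≟ x)) _)) ⟩
  ∑ xs (λ y → 𝟙 (y ≟ x) * ∑ (vecs xs k) (λ w → 𝟙 (w ≟ⱽ v) * f (y ∷ w)))
    ≡⟨ sift x _ ⟩
  ∑ (vecs xs k) (λ w → 𝟙 (w ≟ⱽ v) * f (x ∷ w))
    ≡⟨ vecs-sifting sift k v _ ⟩
  f (x ∷ v) ∎
  where
  open ≡-Reasoning
  _≟ⱽ_ : ∀ {k} → DecidableEquality (Vec _ k)
  _≟ⱽ_ = Vec.≡-dec _≟_

-- Permutations extending a partial injection

S-injective : ∀ n → All Injective (S n)
S-injective n = All.all-filter injective? (vecs (allFin n) n)

_≟ⱽ_ : ∀ {n k} → DecidableEquality (Vec (Fin n) k)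
_≟ⱽ_ = Vec.≡-dec Fin._≟_

vecs-sift : ∀ n k → Sifting (vecs (allFin n) k) _≟ⱽ_
vecs-sift n = vecs-sifting (allFin-sifting n)

lookup-ext : ∀ {n k} {v w : Vec (Fin n) k} → (∀ i → lookup v i ≡ lookup w i) → v ≡ w
lookup-ext {v = v} {w} eq =
  trans (sym (Vec.tabulate∘lookup v)) (trans (Vec.tabulate-cong eq) (Vec.tabulate∘lookup w))

module _ {n k : ℕ} (s t : Fin k → Fin n) where

  -- A partial map `s a ↦ t a` is given by two enumerations, so domain and image have the same form
  -- and partial maps can be concatenated.
  Extends : Vec (Fin n) n → Set
  Extends τ = ∀ a → lookup τ (s a) ≡ t a

  extends? : ∀ τ → Dec (Extends τ)
  extends? τ = all? λ a → lookup τ (s a) Fin.≟ t a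

_◂_ : ∀ {n k} → Fin n → (Fin k → Fin n) → Fin (suc k) → Fin n
(x ◂ s) zero    = x
(x ◂ s) (suc a) = s a

◂-injective : ∀ {n k} {x : Fin n} {s : Fin k → Fin n} → Inj _≡_ _≡_ s →
              (∀ a → s a ≢ x) → Inj _≡_ _≡_ (x ◂ s)
◂-injective inj x∉ {zero}  {zero}  eq = refl
◂-injective inj x∉ {zero}  {suc b} eq = contradiction (sym eq) (x∉ b)
◂-injective inj x∉ {suc a} {zero}  eq = contradiction eq (x∉ a)
◂-injective inj x∉ {suc a} {suc b} eq = cong suc (inj eq)

-- A missed `x` could be added to `s`, which would inject `Fin (suc n)` into `Fin n`.
injective⇒surjective : ∀ {n} {s : Fin n → Fin n} → Inj _≡_ _≡_ s → ∀ x → ∃ λ a → s a ≡ x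
injective⇒surjective {n} {s} inj x with any? (λ a → s a Fin.≟ x)
... | yes p = p
... | no ¬p = contradiction (Fin.injective⇒≤ (◂-injective inj λ a eq → ¬p (a , eq))) 1+n≰n

-- If every point were hit, choosing preimages would inject `Fin n` into `Fin k`.
missed : ∀ {n k} → k < n → (s : Fin k → Fin n) → ∃ λ x → ∀ a → s a ≢ x
missed {n} {k} k<n s with any? (λ x → all? (λ a → ¬? (s a Fin.≟ x)))
... | yes p = p
... | no ¬p = contradiction (Fin.injective⇒≤ {f = proj₁ ∘ hit} inj) (<⇒≱ k<n)
  where
  hit : ∀ x → ∃ λ a → s a ≡ x
  hit x with any? (λ a → s a Fin.≟ x)
  ... | yes q = q
  ... | no ¬q = contradiction (x , λ a eq → ¬q (a , eq)) ¬p
  inj : Inj _≡_ _≡_ (proj₁ ∘ hit)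
  inj {x} {y} eq = trans (sym (proj₂ (hit x))) (trans (cong s eq) (proj₂ (hit y)))

-- Injectivity allows at most one hit, so the indicator of a miss and the number of hits are
-- complementary.
∑-𝟙-image : ∀ {n k} {t : Fin k → Fin n} → Inj _≡_ _≡_ t → (y : Fin n) →
            𝟙 (all? (λ a → ¬? (t a Fin.≟ y))) + ∑ (allFin k) (λ a → 𝟙 (y Fin.≟ t a)) ≡ 1
∑-𝟙-image {n} {k} {t} inj y with any? (λ a → t a Fin.≟ y)
... | yes (a , refl) = cong₂ _+_
  (𝟙-no (all? (λ b → ¬? (t b Fin.≟ t a))) (λ y∉ → y∉ a refl))
  (trans (∑-cong (allFin k) λ b →
           trans (𝟙-cong (t a Fin.≟ t b) (b Fin.≟ a) (sym ∘ inj) (cong t ∘ sym))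
                 (sym (*-identityʳ _)))
         (allFin-sifting k a (λ _ → 1)))
... | no ¬p = cong₂ _+_
  (𝟙-yes (all? (λ b → ¬? (t b Fin.≟ y))) (λ a eq → ¬p (a , eq)))
  (∑-≡0 (allFin k) λ b → 𝟙-no (y Fin.≟ t b) (λ eq → ¬p (b , sym eq)))

count-missed : ∀ {n k} {t : Fin k → Fin n} → Inj _≡_ _≡_ t →
               ∑ (allFin n) (λ y → 𝟙 (all? (λ a → ¬? (t a Fin.≟ y)))) + k ≡ n
count-missed {n} {k} {t} inj = begin
  ∑ (allFin n) m + k
    ≡⟨ cong (∑ (allFin n) m +_) (sym hits) ⟩
  ∑ (allFin n) m + ∑ (allFin n) (λ y → ∑ (allFin k) (λ a → 𝟙 (y Fin.≟ t a)))
    ≡⟨ ∑-+ (allFin n) m _ ⟨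
  ∑ (allFin n) (λ y → m y + ∑ (allFin k) (λ a → 𝟙 (y Fin.≟ t a)))
    ≡⟨ ∑-cong (allFin n) (∑-𝟙-image inj) ⟩
  ∑ (allFin n) (λ _ → 1)
    ≡⟨ ∑-allFin-const n 1 ⟩
  n * 1
    ≡⟨ *-identityʳ n ⟩
  n ∎
  where
  open ≡-Reasoning
  m : Fin n → ℕ
  m y = 𝟙 (all? (λ a → ¬? (t a Fin.≟ y)))
  hits : ∑ (allFin n) (λ y → ∑ (allFin k) (λ a → 𝟙 (y Fin.≟ t a))) ≡ k
  hits = begin
    ∑ (allFin n) (λ y → ∑ (allFin k) (λ a → 𝟙 (y Fin.≟ t a)))
      ≡⟨ ∑-swap (allFin n) (allFin k) _ ⟩
    ∑ (allFin k) (λ a → ∑ (allFin n) (λ y → 𝟙 (y Fin.≟ t a)))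
      ≡⟨ ∑-cong (allFin k) (λ a → trans
           (∑-cong (allFin n) λ y → sym (*-identityʳ _))
           (allFin-sifting n (t a) (λ _ → 1))) ⟩
    ∑ (allFin k) (λ _ → 1)
      ≡⟨ trans (∑-allFin-const k 1) (*-identityʳ k) ⟩
    k ∎

count-extensions : ∀ {n k} d → k + d ≡ n → {s t : Fin k → Fin n} →
                   Inj _≡_ _≡_ s → Inj _≡_ _≡_ t →
                   ∑ (S n) (λ τ → 𝟙 (extends? s t τ)) ≡ d !
count-extensions {n} {k} zero k+0≡n {s} {t} s-inj t-inj
  with refl ← trans (sym (+-identityʳ k)) k+0≡n = begin
  ∑ (S n) (λ τ → 𝟙 (extends? s t τ))
    ≡⟨ ∑-filter injective? (vecs (allFin n) n) _ ⟩
  ∑ (vecs (allFin n) n) (λ τ → 𝟙 (injective? τ) * 𝟙 (extends? s t τ))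
    ≡⟨ ∑-cong (vecs (allFin n) n) (λ τ → trans
         (*-comm (𝟙 (injective? τ)) _)
         (cong (_* 𝟙 (injective? τ)) (𝟙-cong (extends? s t τ) (τ ≟ⱽ τ₀) unique extends))) ⟩
  ∑ (vecs (allFin n) n) (λ τ → 𝟙 (τ ≟ⱽ τ₀) * 𝟙 (injective? τ))
    ≡⟨ vecs-sift n n τ₀ _ ⟩
  𝟙 (injective? τ₀)
    ≡⟨ 𝟙-yes (injective? τ₀) τ₀-inj ⟩
  1 ∎
  where
  open ≡-Reasoning
  s⁻¹ : Fin n → Fin n
  s⁻¹ x = proj₁ (injective⇒surjective s-inj x)
  s-s⁻¹ : ∀ x → s (s⁻¹ x) ≡ x
  s-s⁻¹ x = proj₂ (injective⇒surjective s-inj x)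
  τ₀ : Vec (Fin n) n
  τ₀ = Vec.tabulate (t ∘ s⁻¹)
  τ₀-lookup : ∀ x → lookup τ₀ x ≡ t (s⁻¹ x)
  τ₀-lookup = Vec.lookup∘tabulate (t ∘ s⁻¹)
  τ₀-inj : Injective τ₀
  τ₀-inj x y eq = trans (sym (s-s⁻¹ x)) (trans (cong s
    (t-inj (trans (sym (τ₀-lookup x)) (trans eq (τ₀-lookup y))))) (s-s⁻¹ y))
  unique : ∀ {τ} → Extends s t τ → τ ≡ τ₀
  unique {τ} ext = lookup-ext λ x → trans (cong (lookup τ) (sym (s-s⁻¹ x)))
    (trans (ext (s⁻¹ x)) (sym (τ₀-lookup x)))
  extends : ∀ {τ} → τ ≡ τ₀ → Extends s t τ
  extends refl a = trans (τ₀-lookup (s a)) (cong t (s-inj (s-s⁻¹ (s a))))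
count-extensions {n} {k} (suc d) k+1+d≡n {s} {t} s-inj t-inj = begin
  ∑ (S n) (λ τ → 𝟙 (extends? s t τ))
    -- The sum is split by the value `y` of `τ` at the new point `x`.
    ≡⟨ ∑-cong (S n) (λ τ → sym (allFin-sifting n (lookup τ x) (λ _ → 𝟙 (extends? s t τ)))) ⟩
  ∑ (S n) (λ τ → ∑ (allFin n) (λ y → 𝟙 (y Fin.≟ lookup τ x) * 𝟙 (extends? s t τ)))
    ≡⟨ ∑-swap (S n) (allFin n) _ ⟩
  ∑ (allFin n) (λ y → ∑ (S n) (λ τ → 𝟙 (y Fin.≟ lookup τ x) * 𝟙 (extends? s t τ)))
    ≡⟨ ∑-cong (allFin n) (λ y → ∑-cong (S n) λ τ →
         𝟙-×-cong (y Fin.≟ lookup τ x) (extends? s t τ) (extends? (x ◂ s) (y ◂ t) τ)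
           (λ { eq ext zero → sym eq ; eq ext (suc a) → ext a })
           (λ ext → sym (ext zero) , ext ∘ suc)) ⟩
  ∑ (allFin n) (λ y → ∑ (S n) (λ τ → 𝟙 (extends? (x ◂ s) (y ◂ t) τ)))
    ≡⟨ ∑-cong (allFin n) value ⟩
  ∑ (allFin n) (λ y → 𝟙 (free? y) * d !)
    ≡⟨ ∑-*ʳ (allFin n) (d !) _ ⟩
  ∑ (allFin n) (λ y → 𝟙 (free? y)) * d !
    ≡⟨ cong (_* d !) (+-cancelʳ-≡ k _ (suc d)
         (trans (count-missed t-inj) (trans (sym k+1+d≡n) (+-comm k (suc d))))) ⟩
  suc d * d ! ∎
  where
  open ≡-Reasoning
  new : ∃ λ x → ∀ a → s a ≢ x
  new = missed (subst (k <_) k+1+d≡n (m<m+n k (s≤s z≤n))) s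
  x : Fin n
  x = proj₁ new
  free? : (y : Fin n) → Dec (∀ a → t a ≢ y)
  free? y = all? (λ a → ¬? (t a Fin.≟ y))
  value : ∀ y → ∑ (S n) (λ τ → 𝟙 (extends? (x ◂ s) (y ◂ t) τ)) ≡ 𝟙 (free? y) * d !
  value y with any? (λ a → t a Fin.≟ y)
  ... | no ¬p = trans
    (count-extensions d (trans (sym (+-suc k d)) k+1+d≡n)
      (◂-injective s-inj (proj₂ new)) (◂-injective t-inj (λ a eq → ¬p (a , eq))))
    (sym (trans (cong (_* d !) (𝟙-yes (free? y) λ a eq → ¬p (a , eq))) (*-identityˡ (d !))))
  -- A value `t a` already in use would be taken at both `x` and `s a`, against the injectivity of
  -- `τ`.
  ... | yes (a , refl) = trans
    (trans (∑-cong-All (S-injective n) λ {τ} τ-inj → 𝟙-no (extends? (x ◂ s) (t a ◂ t) τ)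
             λ ext → proj₂ new a (τ-inj _ _ (trans (ext (suc a)) (sym (ext zero)))))
           (∑-zero (S n)))
    (sym (cong (_* d !) (𝟙-no (free? (t a)) λ y∉ → y∉ a refl)))

-- Increasing vectors and their coincidences

-- The split on whether 0 is chosen is Pascal's recursion, so that counts over `subs` follow from
-- Pascal's rule.
subs : ∀ n k → List (Vec (Fin n) k)
subs n       zero    = [] ∷ []
subs zero    (suc k) = []
subs (suc n) (suc k) =
  map (λ p → zero ∷ Vec.map suc p) (subs n k) ++ map (Vec.map suc) (subs n (suc k))

∑-subs-suc : ∀ n k (f : Vec (Fin (suc n)) (suc k) → ℕ) →
             ∑ (subs (suc n) (suc k)) f ≡
             ∑ (subs n k) (λ p → f (zero ∷ Vec.map suc p)) + ∑ (subs n (suc k)) (f ∘ Vec.map suc)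
∑-subs-suc n k f = trans (∑-++ (map (λ p → zero ∷ Vec.map suc p) (subs n k)) _ f)
  (cong₂ _+_ (∑-map _ (subs n k) f) (∑-map _ (subs n (suc k)) f))

increasing? : ∀ {n k} (p : Vec (Fin n) k) → Dec (Increasing p)
increasing? p = all? λ a → all? λ b → (a <? b) →-dec (lookup p a <? lookup p b)

increasing-map : ∀ {n k} (p : Vec (Fin n) k) → Increasing p → Increasing (Vec.map suc p)
increasing-map p inc a b a<b
  rewrite Vec.lookup-map a Fin.suc p | Vec.lookup-map b Fin.suc p = s<s (inc a b a<b)

increasing-map⁻ : ∀ {n k} (p : Vec (Fin n) k) → Increasing (Vec.map suc p) → Increasing p
increasing-map⁻ p inc a b a<b with s<s lt ←
  subst₂ Fin._<_ (Vec.lookup-map a Fin.suc p) (Vec.lookup-map b suc p) (inc a b a<b) = lt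

increasing-0∷ : ∀ {n k} (p : Vec (Fin n) k) → Increasing p → Increasing (zero ∷ Vec.map suc p)
increasing-0∷ p inc zero    (suc b) a<b rewrite Vec.lookup-map b Fin.suc p = z<s
increasing-0∷ p inc (suc a) (suc b) (s<s a<b) = increasing-map p inc a b a<b

increasing-0∷⁻ : ∀ {n k} (p : Vec (Fin n) k) → Increasing (zero ∷ Vec.map suc p) → Increasing p
increasing-0∷⁻ p inc = increasing-map⁻ p λ a b a<b → inc (suc a) (suc b) (s<s a<b)

subs-increasing : ∀ n k → All Increasing (subs n k)
subs-increasing n       zero    = (λ ()) ∷ []
subs-increasing zero    (suc k) = []
subs-increasing (suc n) (suc k) = All.++⁺
  (All.map⁺ (All.map (λ {p} → increasing-0∷ p) (subs-increasing n k)))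
  (All.map⁺ (All.map (λ {p} → increasing-map p) (subs-increasing n (suc k))))

increasing⇒injective : ∀ {n k} (p : Vec (Fin n) k) → Increasing p → Inj _≡_ _≡_ (lookup p)
increasing⇒injective p inc {a} {b} eq with Fin.<-cmp a b
... | tri< a<b _ _  = contradiction (inc a b a<b) (Fin.<-irrefl eq)
... | tri≈ _ a≡b _  = a≡b
... | tri> _ _ b<a  = contradiction (inc b a b<a) (Fin.<-irrefl (sym eq))

-- An entry 0 makes `f` vanish, so only vectors with all entries in the image of `suc` contribute.
∑-vecs-map-suc : ∀ n k (f : Vec (Fin (suc n)) k → ℕ) →
                 (∀ v a → lookup v a ≡ zero → f v ≡ 0) →
                 ∑ (vecs (allFin (suc n)) k) f ≡ ∑ (vecs (allFin n) k) (f ∘ Vec.map suc)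
∑-vecs-map-suc n zero    f f-zero = refl
∑-vecs-map-suc n (suc k) f f-zero = begin
  ∑ (vecs (allFin (suc n)) (suc k)) f
    ≡⟨ ∑-vecs-suc (allFin (suc n)) k f ⟩
  ∑ (allFin (suc n)) (λ x → ∑ (vecs (allFin (suc n)) k) (λ v → f (x ∷ v)))
    ≡⟨ ∑-allFin-suc n (λ x → ∑ (vecs (allFin (suc n)) k) (λ v → f (x ∷ v))) ⟩
  ∑ (vecs (allFin (suc n)) k) (λ v → f (zero ∷ v)) +
  ∑ (allFin n) (λ x → ∑ (vecs (allFin (suc n)) k) (λ v → f (suc x ∷ v)))
    ≡⟨ cong₂ _+_
         (∑-≡0 (vecs (allFin (suc n)) k) λ v → f-zero (zero ∷ v) zero refl)
         (∑-cong (allFin n) λ x → ∑-vecs-map-suc n k (λ v → f (suc x ∷ v))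
            λ v a eq → f-zero (suc x ∷ v) (suc a) eq) ⟩
  ∑ (allFin n) (λ x → ∑ (vecs (allFin n) k) (λ v → f (suc x ∷ Vec.map suc v)))
    ≡⟨ ∑-vecs-suc (allFin n) k (f ∘ Vec.map suc) ⟨
  ∑ (vecs (allFin n) (suc k)) (f ∘ Vec.map suc) ∎
  where open ≡-Reasoning

-- Passes from the filter over all vectors, as in the definition of `X`, to the recursive list
-- `subs`. Only the head of an increasing vector can be 0, which is the split defining `subs`.
∑-increasing : ∀ n k (f : Vec (Fin n) k → ℕ) →
               ∑ (vecs (allFin n) k) (λ v → 𝟙 (increasing? v) * f v) ≡ ∑ (subs n k) f
∑-increasing n       zero    f = cong (_+ 0) (*-identityˡ (f []))
∑-increasing zero    (suc k) f = refl
∑-increasing (suc n) (suc k) f = begin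
  ∑ (vecs (allFin (suc n)) (suc k)) g
    ≡⟨ ∑-vecs-suc (allFin (suc n)) k g ⟩
  ∑ (allFin (suc n)) (λ x → ∑ (vecs (allFin (suc n)) k) (λ v → g (x ∷ v)))
    ≡⟨ ∑-allFin-suc n (λ x → ∑ (vecs (allFin (suc n)) k) (λ v → g (x ∷ v))) ⟩
  ∑ (vecs (allFin (suc n)) k) (λ v → g (zero ∷ v)) +
  ∑ (allFin n) (λ x → ∑ (vecs (allFin (suc n)) k) (λ v → g (suc x ∷ v)))
    ≡⟨ cong₂ _+_
         (∑-vecs-map-suc n k (λ v → g (zero ∷ v)) (g-zero zero))
         (∑-cong (allFin n) λ x → ∑-vecs-map-suc n k (λ v → g (suc x ∷ v)) (g-zero (suc x))) ⟩
  ∑ (vecs (allFin n) k) (λ v → g (zero ∷ Vec.map suc v)) +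
  ∑ (allFin n) (λ x → ∑ (vecs (allFin n) k) (λ v → g (Vec.map suc (x ∷ v))))
    ≡⟨ cong₂ _+_
         (∑-cong (vecs (allFin n) k) λ v → cong (_* f (zero ∷ Vec.map suc v))
           (𝟙-cong (increasing? (zero ∷ Vec.map suc v)) (increasing? v)
                   (increasing-0∷⁻ v) (increasing-0∷ v)))
         (sym (∑-vecs-suc (allFin n) k (g ∘ Vec.map suc))) ⟩
  ∑ (vecs (allFin n) k) (λ v → 𝟙 (increasing? v) * f (zero ∷ Vec.map suc v)) +
  ∑ (vecs (allFin n) (suc k)) (g ∘ Vec.map suc)
    ≡⟨ cong₂ _+_ (∑-increasing n k _)
         (trans (∑-cong (vecs (allFin n) (suc k)) λ v → cong (_* f (Vec.map suc v))
                  (𝟙-cong (increasing? (Vec.map suc v)) (increasing? v)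
                          (increasing-map⁻ v) (increasing-map v)))
                (∑-increasing n (suc k) _)) ⟩
  ∑ (subs n k) (λ p → f (zero ∷ Vec.map suc p)) + ∑ (subs n (suc k)) (f ∘ Vec.map suc)
    ≡⟨ ∑-subs-suc n k f ⟨
  ∑ (subs (suc n) (suc k)) f ∎
  where
  open ≡-Reasoning
  g : Vec (Fin (suc n)) (suc k) → ℕ
  g v = 𝟙 (increasing? v) * f v
  g-zero : ∀ x (v : Vec (Fin (suc n)) k) a → lookup v a ≡ zero → g (x ∷ v) ≡ 0
  g-zero x v a eq = cong (_* f (x ∷ v)) (𝟙-no (increasing? (x ∷ v)) λ inc →
    n≮0 (subst (x Fin.<_) eq (inc zero (suc a) z<s)))

-- Counting pairs that are disjoint or meet exactly once

Disjoint : ∀ {n k l} → Vec (Fin n) k → Vec (Fin n) l → Set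
Disjoint p q = ∀ a b → lookup p a ≢ lookup q b

disjoint? : ∀ {n k l} (p : Vec (Fin n) k) (q : Vec (Fin n) l) → Dec (Disjoint p q)
disjoint? p q = all? λ a → all? λ b → ¬? (lookup p a Fin.≟ lookup q b)

-- One common entry and no other. Its place in each vector is recorded because the count depends on
-- both places.
MeetAt : ∀ {n k l} → Fin k → Fin l → Vec (Fin n) k → Vec (Fin n) l → Set
MeetAt a b p q = lookup p a ≡ lookup q b ×
  (∀ a′ b′ → lookup p a′ ≡ lookup q b′ → a′ ≡ a × b′ ≡ b)

meetAt? : ∀ {n k l} a b (p : Vec (Fin n) k) (q : Vec (Fin n) l) → Dec (MeetAt a b p q)
meetAt? a b p q = (lookup p a Fin.≟ lookup q b) ×-dec
  (all? λ a′ → all? λ b′ →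
    (lookup p a′ Fin.≟ lookup q b′) →-dec ((a′ Fin.≟ a) ×-dec (b′ Fin.≟ b)))

module _ {n k l : ℕ} (p : Vec (Fin n) k) (q : Vec (Fin n) l) where

  lookup-map-suc⁺ : ∀ {a b} → lookup p a ≡ lookup q b →
                    lookup (Vec.map suc p) a ≡ lookup (Vec.map suc q) b
  lookup-map-suc⁺ {a} {b} eq = trans (Vec.lookup-map a Fin.suc p)
    (trans (cong suc eq) (sym (Vec.lookup-map b Fin.suc q)))

  lookup-map-suc⁻ : ∀ {a b} → lookup (Vec.map suc p) a ≡ lookup (Vec.map suc q) b →
                    lookup p a ≡ lookup q b
  lookup-map-suc⁻ {a} {b} eq = Fin.suc-injective
    (trans (sym (Vec.lookup-map a Fin.suc p)) (trans eq (Vec.lookup-map b Fin.suc q)))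

lookup-map-suc≢0 : ∀ {n k} (p : Vec (Fin n) k) {a} → lookup (Vec.map Fin.suc p) a ≢ zero
lookup-map-suc≢0 p {a} eq with () ← trans (sym (Vec.lookup-map a Fin.suc p)) eq

private
  0∷ : ∀ {n k} → Vec (Fin n) k → Vec (Fin (suc n)) (suc k)
  0∷ p = zero ∷ Vec.map suc p
  ↑ : ∀ {n k} → Vec (Fin n) k → Vec (Fin (suc n)) k
  ↑ = Vec.map suc

module _ {n k l : ℕ} (p : Vec (Fin n) k) (q : Vec (Fin n) l) where

  𝟙-disjoint-00 : 𝟙 (disjoint? (0∷ p) (0∷ q)) ≡ 0
  𝟙-disjoint-00 = 𝟙-no (disjoint? (0∷ p) (0∷ q)) λ dis → dis zero zero refl

  𝟙-disjoint-0↑ : 𝟙 (disjoint? (0∷ p) (↑ q)) ≡ 𝟙 (disjoint? p q)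
  𝟙-disjoint-0↑ = 𝟙-cong (disjoint? (0∷ p) (↑ q)) (disjoint? p q)
    (λ dis a b → dis (suc a) b ∘ lookup-map-suc⁺ p q)
    (λ { dis zero    b eq → lookup-map-suc≢0 q (sym eq)
       ; dis (suc a) b eq → dis a b (lookup-map-suc⁻ p q eq) })

  𝟙-disjoint-↑0 : 𝟙 (disjoint? (↑ p) (0∷ q)) ≡ 𝟙 (disjoint? p q)
  𝟙-disjoint-↑0 = 𝟙-cong (disjoint? (↑ p) (0∷ q)) (disjoint? p q)
    (λ dis a b → dis a (suc b) ∘ lookup-map-suc⁺ p q)
    (λ { dis a zero    eq → lookup-map-suc≢0 p eq
       ; dis a (suc b) eq → dis a b (lookup-map-suc⁻ p q eq) })

  𝟙-disjoint-↑↑ : 𝟙 (disjoint? (↑ p) (↑ q)) ≡ 𝟙 (disjoint? p q)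
  𝟙-disjoint-↑↑ = 𝟙-cong (disjoint? (↑ p) (↑ q)) (disjoint? p q)
    (λ dis a b → dis a b ∘ lookup-map-suc⁺ p q)
    (λ dis a b → dis a b ∘ lookup-map-suc⁻ p q)

  𝟙-meet-00 : 𝟙 (meetAt? zero zero (0∷ p) (0∷ q)) ≡ 𝟙 (disjoint? p q)
  𝟙-meet-00 = 𝟙-cong (meetAt? zero zero (0∷ p) (0∷ q)) (disjoint? p q)
    (λ { (_ , only) a b eq → contradiction (proj₁ (only (suc a) (suc b) (lookup-map-suc⁺ p q eq))) λ () })
    (λ dis → refl , λ
       { zero    zero    eq → refl , refl
       ; zero    (suc b) eq → contradiction (sym eq) (lookup-map-suc≢0 q)
       ; (suc a) zero    eq → contradiction eq (lookup-map-suc≢0 p)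
       ; (suc a) (suc b) eq → contradiction (lookup-map-suc⁻ p q eq) (dis a b) })

  𝟙-meet-s00 : ∀ a b → 𝟙 (meetAt? (suc a) b (0∷ p) (0∷ q)) ≡ 0
  𝟙-meet-s00 a b = 𝟙-no (meetAt? (suc a) b (0∷ p) (0∷ q)) λ { (_ , only) →
    contradiction (proj₁ (only zero zero refl)) λ () }

  𝟙-meet-00s : ∀ a b → 𝟙 (meetAt? a (suc b) (0∷ p) (0∷ q)) ≡ 0
  𝟙-meet-00s a b = 𝟙-no (meetAt? a (suc b) (0∷ p) (0∷ q)) λ { (_ , only) →
    contradiction (proj₂ (only zero zero refl)) λ () }

  𝟙-meet-0↑ : ∀ a b → 𝟙 (meetAt? (suc a) b (0∷ p) (↑ q)) ≡ 𝟙 (meetAt? a b p q)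
  𝟙-meet-0↑ a b = 𝟙-cong (meetAt? (suc a) b (0∷ p) (↑ q)) (meetAt? a b p q)
    (λ { (meet , only) → lookup-map-suc⁻ p q meet , λ a′ b′ eq →
         let (a≡ , b≡) = only (suc a′) b′ (lookup-map-suc⁺ p q eq) in Fin.suc-injective a≡ , b≡ })
    (λ { (meet , only) → lookup-map-suc⁺ p q meet , λ
         { zero     b′ eq → contradiction (sym eq) (lookup-map-suc≢0 q)
         ; (suc a′) b′ eq → let (a≡ , b≡) = only a′ b′ (lookup-map-suc⁻ p q eq) in cong suc a≡ , b≡ } })

  𝟙-meet-↑0 : ∀ a b → 𝟙 (meetAt? a (suc b) (↑ p) (0∷ q)) ≡ 𝟙 (meetAt? a b p q)
  𝟙-meet-↑0 a b = 𝟙-cong (meetAt? a (suc b) (↑ p) (0∷ q)) (meetAt? a b p q)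
    (λ { (meet , only) → lookup-map-suc⁻ p q meet , λ a′ b′ eq →
         let (a≡ , b≡) = only a′ (suc b′) (lookup-map-suc⁺ p q eq) in a≡ , Fin.suc-injective b≡ })
    (λ { (meet , only) → lookup-map-suc⁺ p q meet , λ
         { a′ zero     eq → contradiction eq (lookup-map-suc≢0 p)
         ; a′ (suc b′) eq → let (a≡ , b≡) = only a′ b′ (lookup-map-suc⁻ p q eq) in a≡ , cong suc b≡ } })

  𝟙-meet-↑↑ : ∀ a b → 𝟙 (meetAt? a b (↑ p) (↑ q)) ≡ 𝟙 (meetAt? a b p q)
  𝟙-meet-↑↑ a b = 𝟙-cong (meetAt? a b (↑ p) (↑ q)) (meetAt? a b p q)
    (λ { (meet , only) → lookup-map-suc⁻ p q meet , λ a′ b′ eq → only a′ b′ (lookup-map-suc⁺ p q eq) })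
    (λ { (meet , only) → lookup-map-suc⁺ p q meet , λ a′ b′ eq → only a′ b′ (lookup-map-suc⁻ p q eq) })

  𝟙-meet-zero-0↑ : ∀ b → 𝟙 (meetAt? zero b (0∷ p) (↑ q)) ≡ 0
  𝟙-meet-zero-0↑ b = 𝟙-no (meetAt? zero b (0∷ p) (↑ q)) λ { (meet , _) →
    lookup-map-suc≢0 q (sym meet) }

  𝟙-meet-zero-↑0 : ∀ a → 𝟙 (meetAt? a zero (↑ p) (0∷ q)) ≡ 0
  𝟙-meet-zero-↑0 a = 𝟙-no (meetAt? a zero (↑ p) (0∷ q)) λ { (meet , _) →
    lookup-map-suc≢0 p meet }

∑∑ : ∀ n k l → (Vec (Fin n) k → Vec (Fin n) l → ℕ) → ℕ
∑∑ n k l f = ∑ (subs n k) (λ p → ∑ (subs n l) (f p))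

∑∑-cong : ∀ n k l {f g : Vec (Fin n) k → Vec (Fin n) l → ℕ} →
          (∀ p q → f p q ≡ g p q) → ∑∑ n k l f ≡ ∑∑ n k l g
∑∑-cong n k l eq = ∑-cong (subs n k) λ p → ∑-cong (subs n l) (eq p)

∑∑-≡0 : ∀ n k l {f : Vec (Fin n) k → Vec (Fin n) l → ℕ} → (∀ p q → f p q ≡ 0) → ∑∑ n k l f ≡ 0
∑∑-≡0 n k l eq = ∑-≡0 (subs n k) λ p → ∑-≡0 (subs n l) (eq p)

∑∑-+ : ∀ n k l (f g : Vec (Fin n) k → Vec (Fin n) l → ℕ) →
       ∑∑ n k l (λ p q → f p q + g p q) ≡ ∑∑ n k l f + ∑∑ n k l g
∑∑-+ n k l f g = trans (∑-cong (subs n k) λ p → ∑-+ (subs n l) (f p) (g p)) (∑-+ (subs n k) _ _)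

∑∑-*ʳ : ∀ n k l (f : Vec (Fin n) k → Vec (Fin n) l → ℕ) c →
        ∑∑ n k l (λ p q → f p q * c) ≡ ∑∑ n k l f * c
∑∑-*ʳ n k l f c = trans (∑-cong (subs n k) λ p → ∑-*ʳ (subs n l) c (f p)) (∑-*ʳ (subs n k) c _)

∑∑-suc : ∀ n k l (f : Vec (Fin (suc n)) (suc k) → Vec (Fin (suc n)) (suc l) → ℕ) →
         ∑∑ (suc n) (suc k) (suc l) f ≡
         (∑∑ n k l (λ p q → f (0∷ p) (0∷ q)) + ∑∑ n k (suc l) (λ p q → f (0∷ p) (↑ q))) +
         (∑∑ n (suc k) l (λ p q → f (↑ p) (0∷ q)) + ∑∑ n (suc k) (suc l) (λ p q → f (↑ p) (↑ q)))
∑∑-suc n k l f = trans (∑-subs-suc n k _) (cong₂ _+_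
  (trans (∑-cong (subs n k) λ p → ∑-subs-suc n l (f (0∷ p))) (∑-+ (subs n k) _ _))
  (trans (∑-cong (subs n (suc k)) λ p → ∑-subs-suc n l (f (↑ p))) (∑-+ (subs n (suc k)) _ _)))

-- The number of interleavings of two sequences of lengths `a` and `b`. By definition `⟦ i , j ⟧` is
-- a product of two such numbers.
shuffles : ℕ → ℕ → ℕ
shuffles a b = (a + b) C a

shuffles-zeroʳ : ∀ a → shuffles a 0 ≡ 1
shuffles-zeroʳ a = trans (cong (_C a) (+-identityʳ a)) (nCn≡1 a)

shuffles-suc : ∀ a b → shuffles (suc a) (suc b) ≡ shuffles a (suc b) + shuffles (suc a) b
shuffles-suc a b = trans (sym (nCk+nC[k+1]≡[n+1]C[k+1] (a + suc b) a))
  (cong (λ s → shuffles a (suc b) + s C suc a) (+-suc a b))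

∑-subs-1 : ∀ n k → ∑ (subs n k) (λ _ → 1) ≡ n C k
∑-subs-1 n       zero    = refl
∑-subs-1 zero    (suc k) = refl
∑-subs-1 (suc n) (suc k) = trans (∑-subs-suc n k _)
  (trans (cong₂ _+_ (∑-subs-1 n k) (∑-subs-1 n (suc k))) (nCk+nC[k+1]≡[n+1]C[k+1] n k))

-- A disjoint pair is a union of `k + l` points together with a shuffle of its two parts. The
-- induction asks which of the two vectors contains 0, and uses Pascal's rule both for the union and
-- for the shuffles.
count-disjoint : ∀ n k l → ∑∑ n k l (λ p q → 𝟙 (disjoint? p q)) ≡ (n C (k + l)) * shuffles k l
count-disjoint n zero l = trans (+-identityʳ _)
  (trans (∑-cong (subs n l) λ q → 𝟙-yes (disjoint? [] q) λ ())
         (trans (∑-subs-1 n l) (sym (*-identityʳ (n C l)))))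
count-disjoint n (suc k) zero = trans
  (∑-cong (subs n (suc k)) λ p → trans (+-identityʳ _) (𝟙-yes (disjoint? p []) λ _ ()))
  (trans (∑-subs-1 n (suc k)) (trans (sym (*-identityʳ _))
    (cong₂ _*_ (cong (n C_) (sym (+-identityʳ (suc k)))) (sym (shuffles-zeroʳ (suc k))))))
count-disjoint zero    (suc k) (suc l) = refl
count-disjoint (suc n) (suc k) (suc l) = begin
  ∑∑ (suc n) (suc k) (suc l) (λ p q → 𝟙 (disjoint? p q))
    ≡⟨ ∑∑-suc n k l _ ⟩
  (∑∑ n k l (λ p q → 𝟙 (disjoint? (0∷ p) (0∷ q))) +
   ∑∑ n k (suc l) (λ p q → 𝟙 (disjoint? (0∷ p) (↑ q)))) +
  (∑∑ n (suc k) l (λ p q → 𝟙 (disjoint? (↑ p) (0∷ q))) +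
   ∑∑ n (suc k) (suc l) (λ p q → 𝟙 (disjoint? (↑ p) (↑ q))))
    ≡⟨ cong₂ _+_
         (cong₂ _+_ (∑∑-≡0 n k l 𝟙-disjoint-00)
                    (trans (∑∑-cong n k (suc l) 𝟙-disjoint-0↑) (count-disjoint n k (suc l))))
         (cong₂ _+_ (trans (∑∑-cong n (suc k) l 𝟙-disjoint-↑0) (count-disjoint n (suc k) l))
                    (trans (∑∑-cong n (suc k) (suc l) 𝟙-disjoint-↑↑)
                           (count-disjoint n (suc k) (suc l)))) ⟩
  (n C (k + suc l)) * shuffles k (suc l) +
  ((n C (suc k + l)) * shuffles (suc k) l + (n C suc (k + suc l)) * shuffles (suc k) (suc l))
    ≡⟨ cong (λ s → (n C (k + suc l)) * shuffles k (suc l) +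
                   ((n C s) * shuffles (suc k) l + (n C suc (k + suc l)) * shuffles (suc k) (suc l)))
            (sym (+-suc k l)) ⟩
  (n C (k + suc l)) * shuffles k (suc l) +
  ((n C (k + suc l)) * shuffles (suc k) l + (n C suc (k + suc l)) * shuffles (suc k) (suc l))
    ≡⟨ cong (λ s → (n C (k + suc l)) * shuffles k (suc l) +
         ((n C (k + suc l)) * shuffles (suc k) l + (n C suc (k + suc l)) * s)) (shuffles-suc k l) ⟩
  (n C (k + suc l)) * shuffles k (suc l) +
  ((n C (k + suc l)) * shuffles (suc k) l +
   (n C suc (k + suc l)) * (shuffles k (suc l) + shuffles (suc k) l))
    ≡⟨ solve 4 (λ c d x y → c :* x :+ (c :* y :+ d :* (x :+ y)) := (c :+ d) :* (x :+ y)) refl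
         (n C (k + suc l)) (n C suc (k + suc l)) (shuffles k (suc l)) (shuffles (suc k) l) ⟩
  (n C (k + suc l) + n C suc (k + suc l)) * (shuffles k (suc l) + shuffles (suc k) l)
    ≡⟨ cong₂ _*_ (nCk+nC[k+1]≡[n+1]C[k+1] n (k + suc l)) (sym (shuffles-suc k l)) ⟩
  (suc n C suc (k + suc l)) * shuffles (suc k) (suc l) ∎
  where
  open ≡-Reasoning
  open +-*-Solver using (solve; _:=_; _:+_; _:*_; con)

-- Such a pair is a union of `suc (k + l)` points with one shuffle below the common point and one
-- above it. For `k = l` the product of the shuffles is `⟦ a , b ⟧`, which is how the matrix enters.
count-meetAt : ∀ n k l (a : Fin (suc k)) (b : Fin (suc l)) →
  ∑∑ n (suc k) (suc l) (λ p q → 𝟙 (meetAt? a b p q)) ≡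
  (n C suc (k + l)) * (shuffles (toℕ a) (toℕ b) * shuffles (k ∸ toℕ a) (l ∸ toℕ b))
count-meetAt zero    k l a b = refl
count-meetAt (suc n) k l zero zero = begin
  ∑∑ (suc n) (suc k) (suc l) (λ p q → 𝟙 (meetAt? zero zero p q))
    ≡⟨ ∑∑-suc n k l (λ p q → 𝟙 (meetAt? zero zero p q)) ⟩
  (∑∑ n k l (λ p q → 𝟙 (meetAt? zero zero (0∷ p) (0∷ q))) +
   ∑∑ n k (suc l) (λ p q → 𝟙 (meetAt? zero zero (0∷ p) (↑ q)))) +
  (∑∑ n (suc k) l (λ p q → 𝟙 (meetAt? zero zero (↑ p) (0∷ q))) +
   ∑∑ n (suc k) (suc l) (λ p q → 𝟙 (meetAt? zero zero (↑ p) (↑ q))))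
    ≡⟨ cong₂ _+_
         (cong₂ _+_ (trans (∑∑-cong n k l 𝟙-meet-00) (count-disjoint n k l))
                    (∑∑-≡0 n k (suc l) λ p q → 𝟙-meet-zero-0↑ p q zero))
         (cong₂ _+_ (∑∑-≡0 n (suc k) l λ p q → 𝟙-meet-zero-↑0 p q zero)
                    (trans (∑∑-cong n (suc k) (suc l) λ p q → 𝟙-meet-↑↑ p q zero zero)
                           (count-meetAt n k l zero zero))) ⟩
  ((n C (k + l)) * shuffles k l + 0) + (0 + (n C suc (k + l)) * (1 * shuffles k l))
    ≡⟨ solve 3 (λ c d x → (c :* x :+ con 0) :+ (con 0 :+ d :* (con 1 :* x)) :=
                          (c :+ d) :* (con 1 :* x)) refl
         (n C (k + l)) (n C suc (k + l)) (shuffles k l) ⟩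
  (n C (k + l) + n C suc (k + l)) * (1 * shuffles k l)
    ≡⟨ cong (_* (1 * shuffles k l)) (nCk+nC[k+1]≡[n+1]C[k+1] n (k + l)) ⟩
  (suc n C suc (k + l)) * (1 * shuffles k l) ∎
  where
  open ≡-Reasoning
  open +-*-Solver using (solve; _:=_; _:+_; _:*_; con)
count-meetAt (suc n) (suc k) l (suc a) zero = begin
  ∑∑ (suc n) (suc (suc k)) (suc l) (λ p q → 𝟙 (meetAt? (suc a) zero p q))
    ≡⟨ ∑∑-suc n (suc k) l (λ p q → 𝟙 (meetAt? (suc a) zero p q)) ⟩
  (∑∑ n (suc k) l (λ p q → 𝟙 (meetAt? (suc a) zero (0∷ p) (0∷ q))) +
   ∑∑ n (suc k) (suc l) (λ p q → 𝟙 (meetAt? (suc a) zero (0∷ p) (↑ q)))) +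
  (∑∑ n (suc (suc k)) l (λ p q → 𝟙 (meetAt? (suc a) zero (↑ p) (0∷ q))) +
   ∑∑ n (suc (suc k)) (suc l) (λ p q → 𝟙 (meetAt? (suc a) zero (↑ p) (↑ q))))
    ≡⟨ cong₂ _+_
         (cong₂ _+_ (∑∑-≡0 n (suc k) l λ p q → 𝟙-meet-s00 p q a zero)
                    (trans (∑∑-cong n (suc k) (suc l) λ p q → 𝟙-meet-0↑ p q a zero)
                           (count-meetAt n k l a zero)))
         (cong₂ _+_ (∑∑-≡0 n (suc (suc k)) l λ p q → 𝟙-meet-zero-↑0 p q (suc a))
                    (trans (∑∑-cong n (suc (suc k)) (suc l) λ p q → 𝟙-meet-↑↑ p q (suc a) zero)
                           (count-meetAt n (suc k) l (suc a) zero))) ⟩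
  (n C suc (k + l)) * (shuffles (toℕ a) 0 * z) + (n C suc (suc k + l)) * (shuffles (suc (toℕ a)) 0 * z)
    -- With `b = 0` the part below the common point comes from `p` alone and admits one shuffle,
    -- whatever its length.
    ≡⟨ cong (λ x → (n C suc (k + l)) * (x * z) +
                   (n C suc (suc k + l)) * (shuffles (suc (toℕ a)) 0 * z))
         (trans (shuffles-zeroʳ (toℕ a)) (sym (shuffles-zeroʳ (suc (toℕ a))))) ⟩
  (n C suc (k + l)) * (shuffles (suc (toℕ a)) 0 * z) +
  (n C suc (suc k + l)) * (shuffles (suc (toℕ a)) 0 * z)
    ≡⟨ *-distribʳ-+ (shuffles (suc (toℕ a)) 0 * z) (n C suc (k + l)) _ ⟨
  (n C suc (k + l) + n C suc (suc k + l)) * (shuffles (suc (toℕ a)) 0 * z)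
    ≡⟨ cong (_* (shuffles (suc (toℕ a)) 0 * z)) (nCk+nC[k+1]≡[n+1]C[k+1] n (suc (k + l))) ⟩
  (suc n C suc (suc k + l)) * (shuffles (suc (toℕ a)) 0 * z) ∎
  where
  open ≡-Reasoning
  z = shuffles (k ∸ toℕ a) l
count-meetAt (suc n) k (suc l) zero (suc b) = begin
  ∑∑ (suc n) (suc k) (suc (suc l)) (λ p q → 𝟙 (meetAt? zero (suc b) p q))
    ≡⟨ ∑∑-suc n k (suc l) (λ p q → 𝟙 (meetAt? zero (suc b) p q)) ⟩
  (∑∑ n k (suc l) (λ p q → 𝟙 (meetAt? zero (suc b) (0∷ p) (0∷ q))) +
   ∑∑ n k (suc (suc l)) (λ p q → 𝟙 (meetAt? zero (suc b) (0∷ p) (↑ q)))) +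
  (∑∑ n (suc k) (suc l) (λ p q → 𝟙 (meetAt? zero (suc b) (↑ p) (0∷ q))) +
   ∑∑ n (suc k) (suc (suc l)) (λ p q → 𝟙 (meetAt? zero (suc b) (↑ p) (↑ q))))
    ≡⟨ cong₂ _+_
         (cong₂ _+_ (∑∑-≡0 n k (suc l) λ p q → 𝟙-meet-00s p q zero b)
                    (∑∑-≡0 n k (suc (suc l)) λ p q → 𝟙-meet-zero-0↑ p q (suc b)))
         (cong₂ _+_ (trans (∑∑-cong n (suc k) (suc l) λ p q → 𝟙-meet-↑0 p q zero b)
                           (count-meetAt n k l zero b))
                    (trans (∑∑-cong n (suc k) (suc (suc l)) λ p q → 𝟙-meet-↑↑ p q zero (suc b))
                           (count-meetAt n k (suc l) zero (suc b)))) ⟩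
  (n C suc (k + l)) * (1 * z) + (n C suc (k + suc l)) * (1 * z)
    ≡⟨ *-distribʳ-+ (1 * z) (n C suc (k + l)) _ ⟨
  (n C suc (k + l) + n C suc (k + suc l)) * (1 * z)
    ≡⟨ cong (λ s → (n C s + n C suc (k + suc l)) * (1 * z)) (sym (+-suc k l)) ⟩
  (n C (k + suc l) + n C suc (k + suc l)) * (1 * z)
    ≡⟨ cong (_* (1 * z)) (nCk+nC[k+1]≡[n+1]C[k+1] n (k + suc l)) ⟩
  (suc n C suc (k + suc l)) * (1 * z) ∎
  where
  open ≡-Reasoning
  z = shuffles k (l ∸ toℕ b)
count-meetAt (suc n) (suc k) (suc l) (suc a) (suc b) = begin
  ∑∑ (suc n) (suc (suc k)) (suc (suc l)) (λ p q → 𝟙 (meetAt? (suc a) (suc b) p q))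
    ≡⟨ ∑∑-suc n (suc k) (suc l) (λ p q → 𝟙 (meetAt? (suc a) (suc b) p q)) ⟩
  (∑∑ n (suc k) (suc l) (λ p q → 𝟙 (meetAt? (suc a) (suc b) (0∷ p) (0∷ q))) +
   ∑∑ n (suc k) (suc (suc l)) (λ p q → 𝟙 (meetAt? (suc a) (suc b) (0∷ p) (↑ q)))) +
  (∑∑ n (suc (suc k)) (suc l) (λ p q → 𝟙 (meetAt? (suc a) (suc b) (↑ p) (0∷ q))) +
   ∑∑ n (suc (suc k)) (suc (suc l)) (λ p q → 𝟙 (meetAt? (suc a) (suc b) (↑ p) (↑ q))))
    ≡⟨ cong₂ _+_
         (cong₂ _+_ (∑∑-≡0 n (suc k) (suc l) λ p q → 𝟙-meet-s00 p q a (suc b))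
                    (trans (∑∑-cong n (suc k) (suc (suc l)) λ p q → 𝟙-meet-0↑ p q a (suc b))
                           (count-meetAt n k (suc l) a (suc b))))
         (cong₂ _+_ (trans (∑∑-cong n (suc (suc k)) (suc l) λ p q → 𝟙-meet-↑0 p q (suc a) b)
                           (count-meetAt n (suc k) l (suc a) b))
                    (trans (∑∑-cong n (suc (suc k)) (suc (suc l)) λ p q → 𝟙-meet-↑↑ p q (suc a) (suc b))
                           (count-meetAt n (suc k) (suc l) (suc a) (suc b)))) ⟩
  (n C suc (k + suc l)) * (shuffles (toℕ a) (suc (toℕ b)) * z) +
  ((n C suc (suc k + l)) * (shuffles (suc (toℕ a)) (toℕ b) * z) +
   (n C suc (suc k + suc l)) * (shuffles (suc (toℕ a)) (suc (toℕ b)) * z))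
    ≡⟨ cong₂ (λ s t → (n C suc (k + suc l)) * (shuffles (toℕ a) (suc (toℕ b)) * z) +
         ((n C suc s) * (shuffles (suc (toℕ a)) (toℕ b) * z) + (n C suc (suc k + suc l)) * (t * z)))
         (sym (+-suc k l)) (shuffles-suc (toℕ a) (toℕ b)) ⟩
  (n C suc (k + suc l)) * (shuffles (toℕ a) (suc (toℕ b)) * z) +
  ((n C suc (k + suc l)) * (shuffles (suc (toℕ a)) (toℕ b) * z) +
   (n C suc (suc k + suc l)) *
     ((shuffles (toℕ a) (suc (toℕ b)) + shuffles (suc (toℕ a)) (toℕ b)) * z))
    ≡⟨ solve 5 (λ c d x y w → c :* (x :* w) :+ (c :* (y :* w) :+ d :* ((x :+ y) :* w)) :=
                              (c :+ d) :* ((x :+ y) :* w)) refl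
         (n C suc (k + suc l)) (n C suc (suc k + suc l))
         (shuffles (toℕ a) (suc (toℕ b))) (shuffles (suc (toℕ a)) (toℕ b)) z ⟩
  (n C suc (k + suc l) + n C suc (suc k + suc l)) *
    ((shuffles (toℕ a) (suc (toℕ b)) + shuffles (suc (toℕ a)) (toℕ b)) * z)
    ≡⟨ cong₂ (λ s t → s * (t * z)) (nCk+nC[k+1]≡[n+1]C[k+1] n (suc (k + suc l)))
         (sym (shuffles-suc (toℕ a) (toℕ b))) ⟩
  (suc n C suc (suc k + suc l)) * (shuffles (suc (toℕ a)) (suc (toℕ b)) * z) ∎
  where
  open ≡-Reasoning
  open +-*-Solver using (solve; _:=_; _:+_; _:*_; con)
  z = shuffles (k ∸ toℕ a) (l ∸ toℕ b)

-- Moments of the number of occurrences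

π-injective : ∀ {m} (π : Permutation′ m) → Inj _≡_ _≡_ (π ⟨$⟩ʳ_)
π-injective π eq = trans (sym (inverseˡ π)) (trans (cong (π ⟨$⟩ˡ_) eq) (inverseˡ π))

orderIso? : ∀ {n m} (π : Permutation′ m) (τ : Vec (Fin n) n) (p : Vec (Fin n) m) →
            Dec (OrderIso π τ p)
orderIso? π τ p = all? λ a → all? λ b →
  ((lookup τ (lookup p a) <? lookup τ (lookup p b)) →-dec (π ⟨$⟩ʳ a <? π ⟨$⟩ʳ b)) ×-dec
  ((π ⟨$⟩ʳ a <? π ⟨$⟩ʳ b) →-dec (lookup τ (lookup p a) <? lookup τ (lookup p b)))

module _ {n m : ℕ} (π : Permutation′ m) where

  carries? : (p v : Vec (Fin n) m) (τ : Vec (Fin n) n) →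
             Dec (Extends (lookup p) (lookup v ∘ (π ⟨$⟩ʳ_)) τ)
  carries? p v = extends? (lookup p) (lookup v ∘ (π ⟨$⟩ʳ_))

  -- The positions p form an occurrence of π in τ iff τ ∘ p = v ∘ π for some increasing v, which is
  -- then unique; in this form positions and values play symmetric roles.
  occ : Vec (Fin n) m → Vec (Fin n) n → ℕ
  occ p τ = ∑ (subs n m) (λ v → 𝟙 (carries? p v τ))

  -- The only candidate for `v` is `τ ∘ p ∘ π⁻¹`, and it is increasing exactly when `τ ∘ p` is
  -- order-isomorphic to `π`.
  occ≡𝟙 : ∀ p τ → occ p τ ≡ 𝟙 (orderIso? π τ p)
  occ≡𝟙 p τ = begin
    ∑ (subs n m) (λ v → 𝟙 (carries? p v τ))
      ≡⟨ ∑-increasing n m _ ⟨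
    ∑ (vecs (allFin n) m) (λ v → 𝟙 (increasing? v) * 𝟙 (carries? p v τ))
      ≡⟨ ∑-cong (vecs (allFin n) m) (λ v → trans (*-comm (𝟙 (increasing? v)) _)
           (cong (_* 𝟙 (increasing? v)) (𝟙-cong (carries? p v τ) (v ≟ⱽ v₀) unique carried))) ⟩
    ∑ (vecs (allFin n) m) (λ v → 𝟙 (v ≟ⱽ v₀) * 𝟙 (increasing? v))
      ≡⟨ vecs-sift n m v₀ _ ⟩
    𝟙 (increasing? v₀)
      ≡⟨ 𝟙-cong (increasing? v₀) (orderIso? π τ p) inc⇒iso iso⇒inc ⟩
    𝟙 (orderIso? π τ p) ∎
    where
    open ≡-Reasoning
    h : Fin m → Fin n
    h a = lookup τ (lookup p a)
    v₀ : Vec (Fin n) m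
    v₀ = Vec.tabulate (λ c → h (π ⟨$⟩ˡ c))
    v₀-lookup : ∀ c → lookup v₀ c ≡ h (π ⟨$⟩ˡ c)
    v₀-lookup = Vec.lookup∘tabulate (λ c → h (π ⟨$⟩ˡ c))
    v₀-π : ∀ a → lookup v₀ (π ⟨$⟩ʳ a) ≡ h a
    v₀-π a = trans (v₀-lookup (π ⟨$⟩ʳ a)) (cong h (inverseˡ π))
    unique : ∀ {v} → Extends (lookup p) (lookup v ∘ (π ⟨$⟩ʳ_)) τ → v ≡ v₀
    unique {v} ext = lookup-ext λ c → trans (cong (lookup v) (sym (inverseʳ π)))
      (trans (sym (ext (π ⟨$⟩ˡ c))) (sym (v₀-lookup c)))
    carried : ∀ {v} → v ≡ v₀ → Extends (lookup p) (lookup v ∘ (π ⟨$⟩ʳ_)) τ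
    carried refl a = sym (v₀-π a)
    inc⇒mono : Increasing v₀ → ∀ a b → π ⟨$⟩ʳ a Fin.< π ⟨$⟩ʳ b → h a Fin.< h b
    inc⇒mono inc a b lt = subst₂ Fin._<_ (v₀-π a) (v₀-π b) (inc _ _ lt)
    inc⇒iso : Increasing v₀ → OrderIso π τ p
    inc⇒iso inc a b = back , inc⇒mono inc a b
      where
      back : h a Fin.< h b → π ⟨$⟩ʳ a Fin.< π ⟨$⟩ʳ b
      back lt with Fin.<-cmp (π ⟨$⟩ʳ a) (π ⟨$⟩ʳ b)
      ... | tri< πa<πb _ _ = πa<πb
      ... | tri≈ _ πa≡πb _ = contradiction lt (Fin.<-irrefl (cong h (π-injective π πa≡πb)))
      ... | tri> _ _ πb<πa = contradiction (inc⇒mono inc b a πb<πa) (Fin.<-asym lt)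
    iso⇒inc : OrderIso π τ p → Increasing v₀
    iso⇒inc iso c d c<d = subst₂ Fin._<_ (sym (v₀-lookup c)) (sym (v₀-lookup d))
      (proj₂ (iso (π ⟨$⟩ˡ c) (π ⟨$⟩ˡ d))
        (subst₂ Fin._<_ (sym (inverseʳ π)) (sym (inverseʳ π)) c<d))

  X≡∑occ : ∀ τ → X π τ ≡ ∑ (subs n m) (λ p → occ p τ)
  X≡∑occ τ = begin
    X π τ
      ≡⟨ length-filter (occurrence? π τ) (vecs (allFin n) m) ⟩
    ∑ (vecs (allFin n) m) (λ p → 𝟙 (occurrence? π τ p))
      ≡⟨ ∑-cong (vecs (allFin n) m) (λ p → 𝟙-× (increasing? p) (orderIso? π τ p)) ⟩
    ∑ (vecs (allFin n) m) (λ p → 𝟙 (increasing? p) * 𝟙 (orderIso? π τ p))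
      ≡⟨ ∑-increasing n m _ ⟩
    ∑ (subs n m) (λ p → 𝟙 (orderIso? π τ p))
      ≡⟨ ∑-cong (subs n m) (λ p → occ≡𝟙 p τ) ⟨
    ∑ (subs n m) (λ p → occ p τ) ∎
    where open ≡-Reasoning

-- Every permutation extends the empty partial injection.
∑-S-1 : ∀ n → ∑ (S n) (λ _ → 1) ≡ n !
∑-S-1 n = trans (∑-cong (S n) λ τ → sym (𝟙-yes (extends? {n} {0} (λ ()) (λ ()) τ) λ ()))
  (count-extensions {n} {0} n refl {λ ()} {λ ()} (λ { {()} }) (λ { {()} }))

length-S : ∀ n → length (S n) ≡ n !
length-S n = trans (sym (*-identityʳ _)) (trans (sym (∑-const (S n) 1)) (∑-S-1 n))

∑-∑-const : ∀ {I K : Set} (xs : List I) (ys : List K) c →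
            ∑ xs (λ _ → ∑ ys (λ _ → c)) ≡ ∑ xs (λ _ → 1) * (∑ ys (λ _ → 1) * c)
∑-∑-const xs ys c = sym (trans
  (cong (∑ xs (λ _ → 1) *_) (trans (sym (∑-*ʳ ys c (λ _ → 1))) (∑-cong ys λ _ → *-identityˡ c)))
  (trans (sym (∑-*ʳ xs _ (λ _ → 1))) (∑-cong xs λ _ → *-identityˡ _)))

-- Each pair of increasing `p` and `v` prescribes `m` values of `τ` and leaves `d !` permutations.
first-moment : ∀ {m} (π : Permutation′ m) n d → m + d ≡ n →
               ∑ (S n) (X π) ≡ (n C m) * ((n C m) * d !)
first-moment {m} π n d m+d≡n = begin
  ∑ (S n) (X π)
    ≡⟨ ∑-cong (S n) (X≡∑occ π) ⟩
  ∑ (S n) (λ τ → ∑ (subs n m) (λ p → occ π p τ))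
    ≡⟨ ∑-swap (S n) (subs n m) _ ⟩
  ∑ (subs n m) (λ p → ∑ (S n) (occ π p))
    ≡⟨ ∑-cong-All (subs-increasing n m) (λ {p} p-inc →
         trans (∑-swap (S n) (subs n m) (λ τ v → 𝟙 (carries? π p v τ)))
               (∑-cong-All (subs-increasing n m) λ {v} v-inc →
                 count-extensions d m+d≡n (increasing⇒injective p p-inc)
                   (π-injective π ∘ increasing⇒injective v v-inc))) ⟩
  ∑ (subs n m) (λ p → ∑ (subs n m) (λ v → d !))
    ≡⟨ ∑-∑-const (subs n m) (subs n m) (d !) ⟩
  ∑ (subs n m) (λ _ → 1) * (∑ (subs n m) (λ _ → 1) * d !)
    ≡⟨ cong (λ x → x * (x * d !)) (∑-subs-1 n m) ⟩
  (n C m) * ((n C m) * d !) ∎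
  where open ≡-Reasoning

-- Pairs of occurrences and the second moment

_⊕_ : ∀ {n k l} → (Fin k → Fin n) → (Fin l → Fin n) → Fin (k + l) → Fin n
_⊕_ {k = zero}  s₁ s₂ = s₂
_⊕_ {k = suc k} s₁ s₂ = s₁ zero ◂ ((s₁ ∘ suc) ⊕ s₂)

module _ {n l : ℕ} {s₂ t₂ : Fin l → Fin n} (Q : Fin n → Fin n → Set) where

  -- An arbitrary relation `Q` covers both uses: the conditions of an extension, and distinctness
  -- from a fixed point.
  ⊕-intro : ∀ {k} {s₁ t₁ : Fin k → Fin n} → (∀ a → Q (s₁ a) (t₁ a)) → (∀ b → Q (s₂ b) (t₂ b)) →
            ∀ c → Q ((s₁ ⊕ s₂) c) ((t₁ ⊕ t₂) c)
  ⊕-intro {zero}  q₁ q₂ c       = q₂ c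
  ⊕-intro {suc k} q₁ q₂ zero    = q₁ zero
  ⊕-intro {suc k} q₁ q₂ (suc c) = ⊕-intro (q₁ ∘ suc) q₂ c

  ⊕-elim : ∀ {k} {s₁ t₁ : Fin k → Fin n} → (∀ c → Q ((s₁ ⊕ s₂) c) ((t₁ ⊕ t₂) c)) →
           (∀ a → Q (s₁ a) (t₁ a)) × (∀ b → Q (s₂ b) (t₂ b))
  ⊕-elim {zero}  q = (λ ()) , q
  ⊕-elim {suc k} q with q₁ , q₂ ← ⊕-elim {k} (q ∘ suc) =
    (λ { zero → q zero ; (suc a) → q₁ a }) , q₂

⊕-injective : ∀ {n k l} {s₁ : Fin k → Fin n} {s₂ : Fin l → Fin n} →
              Inj _≡_ _≡_ s₁ → Inj _≡_ _≡_ s₂ → (∀ a b → s₁ a ≢ s₂ b) → Inj _≡_ _≡_ (s₁ ⊕ s₂)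
⊕-injective {k = zero}  i₁ i₂ dis = i₂
⊕-injective {k = suc k} {s₁ = s₁} {s₂} i₁ i₂ dis = ◂-injective
  (⊕-injective (Fin.suc-injective ∘ i₁) i₂ (dis ∘ suc))
  (⊕-intro {s₂ = s₂} {s₂} (λ x _ → x ≢ s₁ zero) {s₁ = s₁ ∘ suc} {s₁ ∘ suc}
    (λ a eq → contradiction (i₁ eq) λ ()) (λ b eq → dis zero b (sym eq)))

count-joint : ∀ {n k l} d → (k + l) + d ≡ n →
  {s₁ t₁ : Fin k → Fin n} {s₂ t₂ : Fin l → Fin n} →
  Inj _≡_ _≡_ s₁ → Inj _≡_ _≡_ s₂ → (∀ a b → s₁ a ≢ s₂ b) →
  Inj _≡_ _≡_ t₁ → Inj _≡_ _≡_ t₂ → (∀ a b → t₁ a ≢ t₂ b) →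
  ∑ (S n) (λ τ → 𝟙 (extends? s₁ t₁ τ) * 𝟙 (extends? s₂ t₂ τ)) ≡ d !
count-joint {n} d eq {s₁} {t₁} {s₂} {t₂} s₁-inj s₂-inj s-dis t₁-inj t₂-inj t-dis = trans
  (∑-cong (S n) λ τ →
    𝟙-×-cong (extends? s₁ t₁ τ) (extends? s₂ t₂ τ) (extends? (s₁ ⊕ s₂) (t₁ ⊕ t₂) τ)
      (⊕-intro (λ x y → lookup τ x ≡ y)) (⊕-elim (λ x y → lookup τ x ≡ y)))
  (count-extensions d eq (⊕-injective s₁-inj s₂-inj s-dis) (⊕-injective t₁-inj t₂-inj t-dis))

𝟙-×-no : ∀ {Q R : Set} (d : Dec Q) (e : Dec R) → (Q → ¬ R) → 𝟙 d * 𝟙 e ≡ 0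
𝟙-×-no (yes q) e nqr = trans (+-identityʳ _) (𝟙-no e (nqr q))
𝟙-×-no (no  _) e nqr = refl

∑-S-≡0 : ∀ {n} {f : Vec (Fin n) n → ℕ} → (∀ {τ} → Injective τ → f τ ≡ 0) → ∑ (S n) f ≡ 0
∑-S-≡0 {n} eq = trans (∑-cong-All (S-injective n) eq) (∑-zero (S n))

module _ {n m : ℕ} (π : Permutation′ m) where

  transport⁺ : ∀ {p q v w : Vec (Fin n) m} (τ : Vec (Fin n) n) →
    Extends (lookup p) (lookup v ∘ (π ⟨$⟩ʳ_)) τ → Extends (lookup q) (lookup w ∘ (π ⟨$⟩ʳ_)) τ →
    ∀ {a b} → lookup p a ≡ lookup q b → lookup v (π ⟨$⟩ʳ a) ≡ lookup w (π ⟨$⟩ʳ b)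
  transport⁺ τ ext₁ ext₂ {a} {b} eq =
    trans (sym (ext₁ a)) (trans (cong (lookup τ) eq) (ext₂ b))

  -- Here injectivity of `τ` enters: a coincidence of values must come from a coincidence of
  -- positions.
  transport⁻ : ∀ {p q v w : Vec (Fin n) m} (τ : Vec (Fin n) n) → Injective τ →
    Extends (lookup p) (lookup v ∘ (π ⟨$⟩ʳ_)) τ → Extends (lookup q) (lookup w ∘ (π ⟨$⟩ʳ_)) τ →
    ∀ {c d} → lookup v c ≡ lookup w d → lookup p (π ⟨$⟩ˡ c) ≡ lookup q (π ⟨$⟩ˡ d)
  transport⁻ {v = v} {w} τ inj ext₁ ext₂ {c} {d} eq = inj _ _ (trans (ext₁ (π ⟨$⟩ˡ c))
    (trans (cong (lookup v) (inverseʳ π))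
      (trans eq (trans (cong (lookup w) (sym (inverseʳ π))) (sym (ext₂ (π ⟨$⟩ˡ d)))))))

  joint : (p q v w : Vec (Fin n) m) → ℕ
  joint p q v w = ∑ (S n) (λ τ → 𝟙 (carries? π p v τ) * 𝟙 (carries? π q w τ))

  -- Disjoint `v` and `w` give 2m independent prescriptions. A coincidence of `v` and `w` would
  -- force one of `p` and `q`, so then no permutation carries both.
  joint-disjoint : ∀ d → (m + m) + d ≡ n → {p q v w : Vec (Fin n) m} →
    Increasing p → Increasing q → Increasing v → Increasing w →
    Disjoint p q → joint p q v w ≡ 𝟙 (disjoint? v w) * d !
  joint-disjoint d eq {p} {q} {v} {w} p-inc q-inc v-inc w-inc p#q with disjoint? v w
  ... | yes v#w = trans
    (count-joint d eq (increasing⇒injective p p-inc) (increasing⇒injective q q-inc) p#q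
      (π-injective π ∘ increasing⇒injective v v-inc) (π-injective π ∘ increasing⇒injective w w-inc)
      (λ a b → v#w (π ⟨$⟩ʳ a) (π ⟨$⟩ʳ b)))
    (sym (*-identityˡ (d !)))
  ... | no ¬v#w = ∑-S-≡0 λ {τ} τ-inj → 𝟙-×-no (carries? π p v τ) (carries? π q w τ)
    λ ext₁ ext₂ → ¬v#w λ a b v≡w → p#q _ _ (transport⁻ {p} {q} {v} {w} τ τ-inj ext₁ ext₂ v≡w)

-- The common point is prescribed twice. Dropping it from the second map by `punchIn b` leaves 2m-1
-- distinct points, and `fill` recovers the dropped condition from the first map.
joint-meet : ∀ {n M} (π : Permutation′ (suc M)) d → (suc M + M) + d ≡ n →
  {p q v w : Vec (Fin n) (suc M)} →
  Increasing p → Increasing q → Increasing v → Increasing w →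
  ∀ {a b} → MeetAt a b p q →
  joint π p q v w ≡ 𝟙 (meetAt? (π ⟨$⟩ʳ a) (π ⟨$⟩ʳ b) v w) * d !
joint-meet {n} π d eq {p} {q} {v} {w} p-inc q-inc v-inc w-inc {a} {b} (p≡q , only)
  with meetAt? (π ⟨$⟩ʳ a) (π ⟨$⟩ʳ b) v w
... | yes (v≡w , only′) = trans
  (∑-cong (S n) λ τ → trans
    (𝟙-×-cong (carries? π p v τ) (carries? π q w τ)
              (carries? π p v τ ×-dec extends? q′ w′ τ)
      (λ ext₁ ext₂ → ext₁ , ext₂ ∘ punchIn b) (λ (ext₁ , ext₂) → ext₁ , fill τ ext₁ ext₂))
    (𝟙-× (carries? π p v τ) (extends? q′ w′ τ)))
  (trans
    (count-joint d eq (increasing⇒injective p p-inc)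
      (Fin.punchIn-injective b _ _ ∘ increasing⇒injective q q-inc)
      (λ a′ j p≡ → Fin.punchInᵢ≢i b j (proj₂ (only a′ (punchIn b j) p≡)))
      (π-injective π ∘ increasing⇒injective v v-inc)
      (Fin.punchIn-injective b _ _ ∘ π-injective π ∘ increasing⇒injective w w-inc)
      (λ a′ j v≡ → Fin.punchInᵢ≢i b j
        (π-injective π (proj₂ (only′ (π ⟨$⟩ʳ a′) (π ⟨$⟩ʳ punchIn b j) v≡)))))
    (sym (*-identityˡ (d !))))
  where
  q′ = lookup q ∘ punchIn b
  w′ = lookup w ∘ (π ⟨$⟩ʳ_) ∘ punchIn b
  fill : ∀ τ → Extends (lookup p) (lookup v ∘ (π ⟨$⟩ʳ_)) τ → Extends q′ w′ τ →
         Extends (lookup q) (lookup w ∘ (π ⟨$⟩ʳ_)) τ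
  fill τ ext₁ ext₂ b′ with b Fin.≟ b′
  ... | yes refl = trans (cong (lookup τ) (sym p≡q)) (trans (ext₁ a) v≡w)
  ... | no b≢b′  = subst (λ c → lookup τ (lookup q c) ≡ lookup w (π ⟨$⟩ʳ c))
                         (Fin.punchIn-punchOut b≢b′) (ext₂ (punchOut b≢b′))
... | no ¬meet = ∑-S-≡0 λ {τ} τ-inj → 𝟙-×-no (carries? π p v τ) (carries? π q w τ)
  λ ext₁ ext₂ → ¬meet
    ( transport⁺ π {p} {q} {v} {w} τ ext₁ ext₂ p≡q
    , λ c d v≡w → let (c≡ , d≡) = only _ _ (transport⁻ π {p} {q} {v} {w} τ τ-inj ext₁ ext₂ v≡w) in
        trans (sym (inverseʳ π)) (cong (π ⟨$⟩ʳ_) c≡) ,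
        trans (sym (inverseʳ π)) (cong (π ⟨$⟩ʳ_) d≡))

module _ {n m : ℕ} (p q : Vec (Fin n) m) where

  -- p and q share at least two positions.
  many? : Dec (¬ (Disjoint p q ⊎ ∃₂ λ a b → MeetAt a b p q))
  many? = ¬? (disjoint? p q ⊎-dec any? (λ a → any? (λ b → meetAt? a b p q)))

  -- The three classes exclude each other and `MeetAt` holds for at most one `(a , b)`, so all
  -- summands but one vanish.
  overlap-cases : ∀ w g (h : Fin m → Fin m → ℕ) → (Disjoint p q → w ≡ g) →
    (∀ a b → MeetAt a b p q → w ≡ h a b) →
    w ≡ 𝟙 (disjoint? p q) * g +
        ∑ (allFin m) (λ a → ∑ (allFin m) (λ b → 𝟙 (meetAt? a b p q) * h a b)) +
        𝟙 many? * w
  overlap-cases w g h w-dis w-meet = by-cases (disjoint? p q) (any? (λ a → any? (λ b → meetAt? a b p q)))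
    where
    open ≡-Reasoning
    mid : ℕ
    mid = ∑ (allFin m) (λ a → ∑ (allFin m) (λ b → 𝟙 (meetAt? a b p q) * h a b))
    none : (∀ a b → ¬ MeetAt a b p q) → mid ≡ 0
    none no-meet = ∑-≡0 (allFin m) λ a → ∑-≡0 (allFin m) λ b →
      cong (_* h a b) (𝟙-no (meetAt? a b p q) (no-meet a b))
    by-cases : Dec (Disjoint p q) → Dec (∃₂ λ a b → MeetAt a b p q) →
               w ≡ 𝟙 (disjoint? p q) * g + mid + 𝟙 many? * w
    by-cases (yes p#q) _ = sym (begin
      𝟙 (disjoint? p q) * g + mid + 𝟙 many? * w
        ≡⟨ cong₂ (λ x y → x * g + mid + y * w) (𝟙-yes (disjoint? p q) p#q)
             (𝟙-no many? λ ¬few → ¬few (inj₁ p#q)) ⟩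
      1 * g + mid + 0
        ≡⟨ cong (λ x → 1 * g + x + 0) (none λ a b (eq , _) → p#q a b eq) ⟩
      1 * g + 0 + 0
        ≡⟨ trans (+-identityʳ _) (trans (+-identityʳ _) (*-identityˡ g)) ⟩
      g
        ≡⟨ w-dis p#q ⟨
      w ∎)
    by-cases (no ¬p#q) (yes (a , b , meet@(p≡q , only))) = sym (begin
      𝟙 (disjoint? p q) * g + mid + 𝟙 many? * w
        ≡⟨ cong₂ (λ x y → x * g + mid + y * w) (𝟙-no (disjoint? p q) ¬p#q)
             (𝟙-no many? λ ¬few → ¬few (inj₂ (a , b , meet))) ⟩
      mid + 0
        ≡⟨ +-identityʳ mid ⟩
      mid
        ≡⟨ ∑-cong (allFin m) (λ a′ → trans
             (∑-cong (allFin m) λ b′ → trans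
               (cong (_* h a′ b′) (sym (𝟙-×-cong (a′ Fin.≟ a) (b′ Fin.≟ b) (meetAt? a′ b′ p q)
                 (λ { refl refl → meet }) (λ (p≡q′ , _) → only a′ b′ p≡q′))))
               (*-assoc (𝟙 (a′ Fin.≟ a)) _ _))
             (∑-*ˡ (allFin m) (𝟙 (a′ Fin.≟ a)) _)) ⟩
      ∑ (allFin m) (λ a′ → 𝟙 (a′ Fin.≟ a) * ∑ (allFin m) (λ b′ → 𝟙 (b′ Fin.≟ b) * h a′ b′))
        ≡⟨ allFin-sifting m a _ ⟩
      ∑ (allFin m) (λ b′ → 𝟙 (b′ Fin.≟ b) * h a b′)
        ≡⟨ allFin-sifting m b (h a) ⟩
      h a b
        ≡⟨ w-meet a b meet ⟨
      w ∎)
    by-cases (no ¬p#q) (no ¬meet) = sym (begin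
      𝟙 (disjoint? p q) * g + mid + 𝟙 many? * w
        ≡⟨ cong₂ (λ x y → x * g + mid + y * w) (𝟙-no (disjoint? p q) ¬p#q)
             (𝟙-yes many? λ { (inj₁ p#q) → ¬p#q p#q ; (inj₂ meet) → ¬meet meet }) ⟩
      mid + 1 * w
        ≡⟨ cong₂ _+_ (none λ a b meet → ¬meet (a , b , meet)) (*-identityˡ w) ⟩
      w ∎)

-- General in `W` because two weights occur: the constant 1, for the square of the mean, and the
-- number of permutations with occurrences at both `p` and `q`, for the second moment.
∑∑-overlap : ∀ n m (W : Vec (Fin n) m → Vec (Fin n) m → ℕ) g (h : Fin m → Fin m → ℕ) →
  (∀ p q → Increasing p → Increasing q → Disjoint p q → W p q ≡ g) →
  (∀ p q → Increasing p → Increasing q → ∀ a b → MeetAt a b p q → W p q ≡ h a b) →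
  ∑∑ n m m W ≡
    ∑∑ n m m (λ p q → 𝟙 (disjoint? p q)) * g +
    Σ[ m ] (λ a → Σ[ m ] (λ b → ∑∑ n m m (λ p q → 𝟙 (meetAt? a b p q)) * h a b)) +
    ∑∑ n m m (λ p q → 𝟙 (many? p q) * W p q)
∑∑-overlap n m W g h W-dis W-meet = begin
  ∑∑ n m m W
    ≡⟨ ∑-cong-All (subs-increasing n m) (λ {p} p-inc →
         ∑-cong-All (subs-increasing n m) λ {q} q-inc →
           overlap-cases p q (W p q) g h (W-dis p q p-inc q-inc) (W-meet p q p-inc q-inc)) ⟩
  ∑∑ n m m (λ p q → dis p q + mid p q + rest p q)
    ≡⟨ ∑∑-+ n m m _ rest ⟩
  ∑∑ n m m (λ p q → dis p q + mid p q) + ∑∑ n m m rest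
    ≡⟨ cong (_+ ∑∑ n m m rest) (trans (∑∑-+ n m m dis mid) (cong₂ _+_
         (∑∑-*ʳ n m m (λ p q → 𝟙 (disjoint? p q)) g) ∑∑-mid)) ⟩
  ∑∑ n m m (λ p q → 𝟙 (disjoint? p q)) * g +
  Σ[ m ] (λ a → Σ[ m ] (λ b → ∑∑ n m m (λ p q → 𝟙 (meetAt? a b p q)) * h a b)) +
  ∑∑ n m m rest ∎
  where
  open ≡-Reasoning
  dis mid rest : Vec (Fin n) m → Vec (Fin n) m → ℕ
  dis p q = 𝟙 (disjoint? p q) * g
  mid p q = ∑ (allFin m) (λ a → ∑ (allFin m) (λ b → 𝟙 (meetAt? a b p q) * h a b))
  rest p q = 𝟙 (many? p q) * W p q
  ∑∑-mid : ∑∑ n m m mid ≡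
           ∑ (allFin m) (λ a → ∑ (allFin m) (λ b → ∑∑ n m m (λ p q → 𝟙 (meetAt? a b p q)) * h a b))
  ∑∑-mid = begin
    ∑∑ n m m mid
      ≡⟨ ∑-cong (subs n m) (λ p → ∑-swap (subs n m) (allFin m) _) ⟩
    ∑ (subs n m) (λ p → ∑ (allFin m) (λ a → ∑ (subs n m) (λ q →
      ∑ (allFin m) (λ b → 𝟙 (meetAt? a b p q) * h a b))))
      ≡⟨ ∑-swap (subs n m) (allFin m) _ ⟩
    ∑ (allFin m) (λ a → ∑∑ n m m (λ p q → ∑ (allFin m) (λ b → 𝟙 (meetAt? a b p q) * h a b)))
      ≡⟨ ∑-cong (allFin m) (λ a → trans
           (∑-cong (subs n m) λ p → ∑-swap (subs n m) (allFin m) _)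
           (∑-swap (subs n m) (allFin m) _)) ⟩
    ∑ (allFin m) (λ a → ∑ (allFin m) (λ b → ∑∑ n m m (λ p q → 𝟙 (meetAt? a b p q) * h a b)))
      ≡⟨ ∑-cong (allFin m) (λ a → ∑-cong (allFin m) λ b → ∑∑-*ʳ n m m _ (h a b)) ⟩
    ∑ (allFin m) (λ a → ∑ (allFin m) (λ b → ∑∑ n m m (λ p q → 𝟙 (meetAt? a b p q)) * h a b)) ∎

∑∑-1 : ∀ n m → ∑∑ n m m (λ _ _ → 1) ≡ (n C m) * (n C m)
∑∑-1 n m = trans (∑-∑-const (subs n m) (subs n m) 1)
  (cong₂ _*_ (∑-subs-1 n m) (trans (*-identityʳ _) (∑-subs-1 n m)))

-- The number r of the overview, which is bounded rather than computed.
crowded : ℕ → ℕ → ℕ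
crowded n m = ∑∑ n m m (λ p q → 𝟙 (many? p q))

count-pairs : ∀ n M → (n C suc M) * (n C suc M) ≡
  (n C (suc M + suc M)) * shuffles (suc M) (suc M) +
  (n C suc (M + M)) * Σ[ suc M ] (λ a → Σ[ suc M ] (λ b → ⟦ a , b ⟧)) +
  crowded n (suc M)
count-pairs n M = begin
  (n C m) * (n C m)
    ≡⟨ ∑∑-1 n m ⟨
  ∑∑ n m m (λ _ _ → 1)
    ≡⟨ ∑∑-overlap n m (λ _ _ → 1) 1 (λ _ _ → 1) (λ _ _ _ _ _ → refl) (λ _ _ _ _ _ _ _ → refl) ⟩
  ∑∑ n m m (λ p q → 𝟙 (disjoint? p q)) * 1 +
  Σ[ m ] (λ a → Σ[ m ] (λ b → ∑∑ n m m (λ p q → 𝟙 (meetAt? a b p q)) * 1)) +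
  ∑∑ n m m (λ p q → 𝟙 (many? p q) * 1)
    ≡⟨ cong₂ _+_ (cong₂ _+_
         (trans (*-identityʳ _) (count-disjoint n m m))
         (trans (∑-cong (allFin m) λ a → trans
                  (∑-cong (allFin m) λ b → trans (*-identityʳ _) (count-meetAt n M M a b))
                  (∑-*ˡ (allFin m) (n C suc (M + M)) _))
                (∑-*ˡ (allFin m) (n C suc (M + M)) _)))
         (∑∑-cong n m m λ p q → *-identityʳ _) ⟩
  (n C (m + m)) * shuffles m m +
  (n C suc (M + M)) * Σ[ m ] (λ a → Σ[ m ] (λ b → ⟦ a , b ⟧)) +
  crowded n m ∎
  where
  open ≡-Reasoning
  m = suc M

-- Only a bound on `R` matters: a permutation has at most one occurrence at given positions, so a
-- crowded pair contributes at most `n !`.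
second-moment : ∀ {M} (π : Permutation′ (suc M)) n d → (suc M + suc M) + d ≡ n →
  ∃ λ R → R ≤ crowded n (suc M) * n ! ×
  ∑ (S n) (λ τ → X π τ * X π τ) ≡
  ((n C (suc M + suc M)) * shuffles (suc M) (suc M)) *
    (((n C (suc M + suc M)) * shuffles (suc M) (suc M)) * d !) +
  ((n C suc (M + M)) * ((n C suc (M + M)) * suc d !)) *
    Σ[ suc M ] (λ a → Σ[ suc M ] (λ b → ⟦ a , b ⟧ * ⟦ π ⟨$⟩ʳ a , π ⟨$⟩ʳ b ⟧)) +
  R
second-moment {M} π n d eq = R , R≤ , (begin
  ∑ (S n) (λ τ → X π τ * X π τ)
    ≡⟨ ∑-cong (S n) (λ τ → trans (cong₂ _*_ (X≡∑occ π τ) (X≡∑occ π τ))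
         (∑-product (subs n m) (subs n m) _ _)) ⟩
  ∑ (S n) (λ τ → ∑∑ n m m (λ p q → occ π p τ * occ π q τ))
    ≡⟨ ∑-swap (S n) (subs n m) _ ⟩
  ∑ (subs n m) (λ p → ∑ (S n) (λ τ → ∑ (subs n m) (λ q → occ π p τ * occ π q τ)))
    ≡⟨ ∑-cong (subs n m) (λ p → ∑-swap (S n) (subs n m) _) ⟩
  ∑∑ n m m W
    ≡⟨ ∑∑-overlap n m W _ _ W-disjoint W-meet ⟩
  ∑∑ n m m (λ p q → 𝟙 (disjoint? p q)) * (D * d !) +
  Σ[ m ] (λ a → Σ[ m ] (λ b → ∑∑ n m m (λ p q → 𝟙 (meetAt? a b p q)) * h a b)) + R
    ≡⟨ cong (_+ R) (cong₂ _+_ (cong (_* (D * d !)) (count-disjoint n m m))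
         (trans (∑-cong (allFin m) λ a → trans
                  (∑-cong (allFin m) λ b → trans
                    (cong (_* h a b) (count-meetAt n M M a b))
                    (solve 4 (λ c x y f → (c :* x) :* ((c :* y) :* f) :=
                                          (c :* (c :* f)) :* (x :* y)) refl
                       c₁ ⟦ a , b ⟧ ⟦ π ⟨$⟩ʳ a , π ⟨$⟩ʳ b ⟧ (suc d !)))
                  (∑-*ˡ (allFin m) (c₁ * (c₁ * suc d !)) _))
                (∑-*ˡ (allFin m) (c₁ * (c₁ * suc d !)) _))) ⟩
  D * (D * d !) +
  (c₁ * (c₁ * suc d !)) *
    Σ[ m ] (λ a → Σ[ m ] (λ b → ⟦ a , b ⟧ * ⟦ π ⟨$⟩ʳ a , π ⟨$⟩ʳ b ⟧)) + R ∎)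
  where
  open ≡-Reasoning
  open +-*-Solver using (solve; _:=_; _:+_; _:*_; con)
  m = suc M
  c₁ = n C suc (M + M)
  D = (n C (m + m)) * shuffles m m
  h : Fin m → Fin m → ℕ
  h a b = (c₁ * ⟦ π ⟨$⟩ʳ a , π ⟨$⟩ʳ b ⟧) * suc d !
  W : Vec (Fin n) m → Vec (Fin n) m → ℕ
  W p q = ∑ (S n) (λ τ → occ π p τ * occ π q τ)
  W-joint : ∀ p q → W p q ≡ ∑∑ n m m (joint π p q)
  W-joint p q = trans (∑-cong (S n) λ τ → ∑-product (subs n m) (subs n m) _ _)
    (trans (∑-swap (S n) (subs n m) _) (∑-cong (subs n m) λ v → ∑-swap (S n) (subs n m) _))
  W-disjoint : ∀ p q → Increasing p → Increasing q → Disjoint p q → W p q ≡ D * d !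
  W-disjoint p q p-inc q-inc p#q = begin
    W p q
      ≡⟨ W-joint p q ⟩
    ∑∑ n m m (joint π p q)
      ≡⟨ ∑-cong-All (subs-increasing n m) (λ {v} v-inc →
           ∑-cong-All (subs-increasing n m) λ {w} w-inc →
             joint-disjoint π d eq {p} {q} {v} {w} p-inc q-inc v-inc w-inc p#q) ⟩
    ∑∑ n m m (λ v w → 𝟙 (disjoint? v w) * d !)
      ≡⟨ ∑∑-*ʳ n m m _ (d !) ⟩
    ∑∑ n m m (λ v w → 𝟙 (disjoint? v w)) * d !
      ≡⟨ cong (_* d !) (count-disjoint n m m) ⟩
    D * d ! ∎
  eq′ : (suc M + M) + suc d ≡ n
  eq′ = trans (solve 2 (λ M d → con 1 :+ M :+ M :+ (con 1 :+ d) := con 1 :+ M :+ (con 1 :+ M) :+ d)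
                 refl M d) eq
  W-meet : ∀ p q → Increasing p → Increasing q → ∀ a b → MeetAt a b p q → W p q ≡ h a b
  W-meet p q p-inc q-inc a b meet = begin
    W p q
      ≡⟨ W-joint p q ⟩
    ∑∑ n m m (joint π p q)
      ≡⟨ ∑-cong-All (subs-increasing n m) (λ {v} v-inc →
           ∑-cong-All (subs-increasing n m) λ {w} w-inc →
             joint-meet π (suc d) eq′ {p} {q} {v} {w} p-inc q-inc v-inc w-inc meet) ⟩
    ∑∑ n m m (λ v w → 𝟙 (meetAt? (π ⟨$⟩ʳ a) (π ⟨$⟩ʳ b) v w) * suc d !)
      ≡⟨ ∑∑-*ʳ n m m _ (suc d !) ⟩
    ∑∑ n m m (λ v w → 𝟙 (meetAt? (π ⟨$⟩ʳ a) (π ⟨$⟩ʳ b) v w)) * suc d !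
      ≡⟨ cong (_* suc d !) (count-meetAt n M M (π ⟨$⟩ʳ a) (π ⟨$⟩ʳ b)) ⟩
    h a b ∎
  R : ℕ
  R = ∑∑ n m m (λ p q → 𝟙 (many? p q) * W p q)
  occ≤1 : ∀ p τ → occ π p τ ≤ 1
  occ≤1 p τ = subst (_≤ 1) (sym (occ≡𝟙 π p τ)) (𝟙≤1 (orderIso? π τ p))
  W≤n! : ∀ p q → W p q ≤ n !
  W≤n! p q = subst (W p q ≤_) (∑-S-1 n) (∑-mono (S n) λ τ → *-mono-≤ (occ≤1 p τ) (occ≤1 q τ))
  R≤ : R ≤ crowded n m * n !
  R≤ = subst (R ≤_) (∑∑-*ʳ n m m _ (n !))
    (∑-mono (subs n m) λ p → ∑-mono (subs n m) λ q → *-monoʳ-≤ (𝟙 (many? p q)) (W≤n! p q))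

-- The trace and its lower bound

shuffles-comm : ∀ a b → shuffles a b ≡ shuffles b a
shuffles-comm a b = begin
  (a + b) C a              ≡⟨ nCk≡nC[n∸k] (m≤m+n a b) ⟩
  (a + b) C (a + b ∸ a)    ≡⟨ cong₂ _C_ (+-comm a b) (m+n∸m≡n a b) ⟩
  (b + a) C b              ∎
  where open ≡-Reasoning

⟦⟧-comm : ∀ {m} (i j : Fin m) → ⟦ i , j ⟧ ≡ ⟦ j , i ⟧
⟦⟧-comm {m} i j = cong₂ _*_ (shuffles-comm (toℕ i) (toℕ j))
  (shuffles-comm (m ∸ 1 ∸ toℕ i) (m ∸ 1 ∸ toℕ j))

∑-δ : ∀ {m} (i : Fin m) (f : Fin m → ℕ) → Σ[ m ] (λ j → δ i j * f j) ≡ f i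
∑-δ {m} i f = trans (∑-cong (allFin m) λ j → cong (_* f j) (δ≡𝟙 j)) (allFin-sifting m i f)
  where
  δ≡𝟙 : ∀ j → δ i j ≡ 𝟙 (j Fin.≟ i)
  δ≡𝟙 j with i Fin.≟ j
  ... | yes i≡j = sym (𝟙-yes (j Fin.≟ i) (sym i≡j))
  ... | no  i≢j = sym (𝟙-no (j Fin.≟ i) (i≢j ∘ sym))

∑-⊗P : ∀ {m} (B : Matrix m) (ρ : Permutation′ m) i (f : Fin m → ℕ) →
       Σ[ m ] (λ j → (B ⊗ P ρ) i j * f j) ≡ Σ[ m ] (λ k → B i k * f (ρ ⟨$⟩ʳ k))
∑-⊗P {m} B ρ i f = begin
  Σ[ m ] (λ j → Σ[ m ] (λ k → B i k * P ρ k j) * f j)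
    ≡⟨ ∑-cong (allFin m) (λ j → trans (sym (∑-*ʳ (allFin m) (f j) _))
         (∑-cong (allFin m) λ k → *-assoc (B i k) _ _)) ⟩
  Σ[ m ] (λ j → Σ[ m ] (λ k → B i k * (P ρ k j * f j)))
    ≡⟨ ∑-swap (allFin m) (allFin m) _ ⟩
  Σ[ m ] (λ k → Σ[ m ] (λ j → B i k * (P ρ k j * f j)))
    ≡⟨ ∑-cong (allFin m) (λ k → trans (∑-*ˡ (allFin m) (B i k) _)
         (cong (B i k *_) (∑-δ (ρ ⟨$⟩ʳ k) f))) ⟩
  Σ[ m ] (λ k → B i k * f (ρ ⟨$⟩ʳ k)) ∎
  where open ≡-Reasoning

⊗P : ∀ {m} (B : Matrix m) (ρ : Permutation′ m) i j → (B ⊗ P ρ) i j ≡ B i (ρ ⟨$⟩ˡ j)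
⊗P {m} B ρ i j = begin
  Σ[ m ] (λ k → B i k * P ρ k j)
    ≡⟨ ∑-cong (allFin m) (λ k → trans (*-comm (B i k) _) (cong (_* B i k) (δ-flip k))) ⟩
  Σ[ m ] (λ k → δ (ρ ⟨$⟩ˡ j) k * B i k)
    ≡⟨ ∑-δ (ρ ⟨$⟩ˡ j) (B i) ⟩
  B i (ρ ⟨$⟩ˡ j) ∎
  where
  open ≡-Reasoning
  δ-flip : ∀ k → δ (ρ ⟨$⟩ʳ k) j ≡ δ (ρ ⟨$⟩ˡ j) k
  δ-flip k with (ρ ⟨$⟩ʳ k) Fin.≟ j | (ρ ⟨$⟩ˡ j) Fin.≟ k
  ... | yes _ | yes _ = refl
  ... | no _  | no _  = refl
  ... | yes refl | no ne = contradiction (inverseˡ ρ) ne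
  ... | no ne | yes refl = contradiction (inverseʳ ρ) ne

energy : ∀ {m} → Permutation′ m → ℕ
energy {m} π = Σ[ m ] (λ i → Σ[ m ] (λ j → ⟦ i , j ⟧ * ⟦ π ⟨$⟩ʳ i , π ⟨$⟩ʳ j ⟧))

-- Multiplying by the permutation matrices relabels indices by `π`, which leaves `⟦ π j , π i ⟧` as
-- the second factor; symmetry of `A` restores the order of its arguments.
trace≡energy : ∀ {m} (π : Permutation′ m) → trace π ≡ energy π
trace≡energy {m} π = ∑-cong (allFin m) λ i → begin
  (((A m ⊗ P π) ⊗ A m) ⊗ P (flip π)) i i
    ≡⟨ ⊗P ((A m ⊗ P π) ⊗ A m) (flip π) i i ⟩
  Σ[ m ] (λ k → (A m ⊗ P π) i k * ⟦ k , π ⟨$⟩ʳ i ⟧)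
    ≡⟨ ∑-⊗P (A m) π i (λ k → ⟦ k , π ⟨$⟩ʳ i ⟧) ⟩
  Σ[ m ] (λ j → ⟦ i , j ⟧ * ⟦ π ⟨$⟩ʳ j , π ⟨$⟩ʳ i ⟧)
    ≡⟨ ∑-cong (allFin m) (λ j → cong (⟦ i , j ⟧ *_) (⟦⟧-comm (π ⟨$⟩ʳ j) (π ⟨$⟩ʳ i))) ⟩
  Σ[ m ] (λ j → ⟦ i , j ⟧ * ⟦ π ⟨$⟩ʳ i , π ⟨$⟩ʳ j ⟧) ∎
  where open ≡-Reasoning

-- In a shuffle of `suc (a + c)` points with `b` others, let `j` be the number of others before the
-- point that has `a` of the first kind ahead of it. The shuffles before and after that point are
-- independent.
∑-shuffles : ∀ a c b →
  Σ[ suc b ] (λ j → shuffles a (toℕ j) * shuffles c (b ∸ toℕ j)) ≡ shuffles (suc (a + c)) b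
∑-shuffles zero c zero = trans (+-identityʳ _) (trans (+-identityʳ _)
  (trans (shuffles-zeroʳ c) (sym (shuffles-zeroʳ (suc c)))))
∑-shuffles zero c (suc b) = begin
  Σ[ suc (suc b) ] (λ j → 1 * shuffles c (suc b ∸ toℕ j))
    ≡⟨ ∑-allFin-suc (suc b) (λ j → 1 * shuffles c (suc b ∸ toℕ j)) ⟩
  1 * shuffles c (suc b) + Σ[ suc b ] (λ j → 1 * shuffles c (b ∸ toℕ j))
    ≡⟨ cong₂ _+_ (*-identityˡ _) (∑-shuffles zero c b) ⟩
  shuffles c (suc b) + shuffles (suc c) b
    ≡⟨ shuffles-suc c b ⟨
  shuffles (suc c) (suc b) ∎
  where open ≡-Reasoning
∑-shuffles (suc a) c zero = trans (+-identityʳ _)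
  (trans (cong₂ _*_ (shuffles-zeroʳ (suc a)) (shuffles-zeroʳ c))
         (sym (shuffles-zeroʳ (suc (suc a + c)))))
∑-shuffles (suc a) c (suc b) = begin
  Σ[ suc (suc b) ] (λ j → shuffles (suc a) (toℕ j) * shuffles c (suc b ∸ toℕ j))
    ≡⟨ ∑-allFin-suc (suc b) (λ j → shuffles (suc a) (toℕ j) * shuffles c (suc b ∸ toℕ j)) ⟩
  shuffles (suc a) 0 * shuffles c (suc b) +
  Σ[ suc b ] (λ j → shuffles (suc a) (suc (toℕ j)) * shuffles c (b ∸ toℕ j))
    ≡⟨ cong₂ (λ x y → x * shuffles c (suc b) + y)
         (trans (shuffles-zeroʳ (suc a)) (sym (shuffles-zeroʳ a)))
         (trans (∑-cong (allFin (suc b)) λ j → trans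
                  (cong (_* shuffles c (b ∸ toℕ j)) (shuffles-suc a (toℕ j)))
                  (*-distribʳ-+ (shuffles c (b ∸ toℕ j)) (shuffles a (suc (toℕ j))) _))
                (∑-+ (allFin (suc b)) (λ j → shuffles a (suc (toℕ j)) * shuffles c (b ∸ toℕ j))
                                      (λ j → shuffles (suc a) (toℕ j) * shuffles c (b ∸ toℕ j)))) ⟩
  shuffles a 0 * shuffles c (suc b) +
  (Σ[ suc b ] (λ j → shuffles a (suc (toℕ j)) * shuffles c (b ∸ toℕ j)) +
   Σ[ suc b ] (λ j → shuffles (suc a) (toℕ j) * shuffles c (b ∸ toℕ j)))
    ≡⟨ +-assoc (shuffles a 0 * shuffles c (suc b)) _ _ ⟨
  shuffles a 0 * shuffles c (suc b) +
  Σ[ suc b ] (λ j → shuffles a (suc (toℕ j)) * shuffles c (b ∸ toℕ j)) +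
  Σ[ suc b ] (λ j → shuffles (suc a) (toℕ j) * shuffles c (b ∸ toℕ j))
    ≡⟨ cong₂ _+_
         (trans (sym (∑-allFin-suc (suc b) λ j → shuffles a (toℕ j) * shuffles c (suc b ∸ toℕ j)))
                (∑-shuffles a c (suc b)))
         (∑-shuffles (suc a) c b) ⟩
  shuffles (suc (a + c)) (suc b) + shuffles (suc (suc a + c)) b
    ≡⟨ shuffles-suc (suc (a + c)) b ⟨
  shuffles (suc (suc a + c)) (suc b) ∎
  where open ≡-Reasoning

-- The case `a = i`, `c = M - i` of `∑-shuffles`. Only `a + c = M` survives, so the sum does not
-- depend on the row and equals C(2m-1,m-1).
row-sum : ∀ M (i : Fin (suc M)) → Σ[ suc M ] (λ j → ⟦ i , j ⟧) ≡ shuffles M (suc M)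
row-sum M i = begin
  Σ[ suc M ] (λ j → shuffles (toℕ i) (toℕ j) * shuffles (M ∸ toℕ i) (M ∸ toℕ j))
    ≡⟨ ∑-shuffles (toℕ i) (M ∸ toℕ i) M ⟩
  shuffles (suc (toℕ i + (M ∸ toℕ i))) M
    ≡⟨ cong (λ x → shuffles (suc x) M) (m+[n∸m]≡n (≤-pred (Fin.toℕ<n i))) ⟩
  shuffles (suc M) M
    ≡⟨ shuffles-comm (suc M) M ⟩
  shuffles M (suc M) ∎
  where open ≡-Reasoning

-- Gram decomposition of the matrix `A`

-- The shift `s` is for the induction on `i`: Pascal's rule sends half of the terms to the shift
-- `suc s`. Any range `K` beyond `i` gives the same sum, since the terms with `k > i` vanish; this
-- lets all rows share one range.
vandermonde : ∀ i j s K → i < K →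
  Σ[ K ] (λ k → (i C toℕ k) * (j C (toℕ k + s))) ≡ (i + j) C (i + s)
vandermonde zero j s (suc K) _ = begin
  Σ[ suc K ] (λ k → (0 C toℕ k) * (j C (toℕ k + s)))
    ≡⟨ ∑-allFin-suc K (λ k → (0 C toℕ k) * (j C (toℕ k + s))) ⟩
  1 * (j C s) + Σ[ K ] (λ k → 0)
    ≡⟨ cong₂ _+_ (*-identityˡ (j C s)) (∑-zero (allFin K)) ⟩
  (j C s) + 0
    ≡⟨ +-identityʳ _ ⟩
  j C s ∎
  where open ≡-Reasoning
vandermonde (suc i) j s (suc K) (s≤s i<K) = begin
  Σ[ suc K ] (λ k → (suc i C toℕ k) * (j C (toℕ k + s)))
    ≡⟨ ∑-allFin-suc K (λ k → (suc i C toℕ k) * (j C (toℕ k + s))) ⟩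
  1 * (j C s) + Σ[ K ] (λ k → (suc i C suc (toℕ k)) * (j C suc (toℕ k + s)))
    ≡⟨ cong (1 * (j C s) +_) (trans (∑-cong (allFin K) λ k → trans
         (cong (_* (j C suc (toℕ k + s))) (sym (nCk+nC[k+1]≡[n+1]C[k+1] i (toℕ k))))
         (*-distribʳ-+ (j C suc (toℕ k + s)) (i C toℕ k) _))
         (∑-+ (allFin K) _ _)) ⟩
  1 * (j C s) + (Σ[ K ] (λ k → (i C toℕ k) * (j C suc (toℕ k + s))) +
                 Σ[ K ] (λ k → (i C suc (toℕ k)) * (j C suc (toℕ k + s))))
    -- The term at `k = 0` joins the second sum and completes it to the sum for `i` over the range
    -- `suc K`.
    ≡⟨ x∙yz≈y∙xz (1 * (j C s)) (Σ[ K ] (λ k → (i C toℕ k) * (j C suc (toℕ k + s)))) _ ⟩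
  Σ[ K ] (λ k → (i C toℕ k) * (j C suc (toℕ k + s))) +
  (1 * (j C s) + Σ[ K ] (λ k → (i C suc (toℕ k)) * (j C suc (toℕ k + s))))
    ≡⟨ cong₂ _+_
         (trans (∑-cong (allFin K) λ k → cong (λ t → (i C toℕ k) * (j C t)) (sym (+-suc (toℕ k) s)))
                (vandermonde i j (suc s) K i<K))
         (trans (sym (∑-allFin-suc K λ k → (i C toℕ k) * (j C (toℕ k + s))))
                (vandermonde i j s (suc K) (m≤n⇒m≤1+n i<K))) ⟩
  (i + j) C (i + suc s) + (i + j) C (i + s)
    ≡⟨ trans (+-comm ((i + j) C (i + suc s)) _)
             (cong (λ t → (i + j) C (i + s) + (i + j) C t) (+-suc i s)) ⟩
  (i + j) C (i + s) + (i + j) C suc (i + s)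
    ≡⟨ nCk+nC[k+1]≡[n+1]C[k+1] (i + j) (i + s) ⟩
  suc (i + j) C suc (i + s) ∎
  where
  open ≡-Reasoning
  open import Algebra.Properties.CommutativeSemigroup +-commutativeSemigroup using (x∙yz≈y∙xz)

shuffles-gram : ∀ i j K → i < K → shuffles i j ≡ Σ[ K ] (λ k → (i C toℕ k) * (j C toℕ k))
shuffles-gram i j K i<K = begin
  (i + j) C i
    ≡⟨ cong ((i + j) C_) (+-identityʳ i) ⟨
  (i + j) C (i + 0)
    ≡⟨ vandermonde i j 0 K i<K ⟨
  Σ[ K ] (λ k → (i C toℕ k) * (j C (toℕ k + 0)))
    ≡⟨ ∑-cong (allFin K) (λ k → cong (λ t → (i C toℕ k) * (j C t)) (+-identityʳ (toℕ k))) ⟩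
  Σ[ K ] (λ k → (i C toℕ k) * (j C toℕ k)) ∎
  where open ≡-Reasoning

∑-cartesianProduct : ∀ {I K : Set} (xs : List I) (ys : List K) (f : I × K → ℕ) →
  ∑ (cartesianProduct xs ys) f ≡ ∑ xs (λ x → ∑ ys (λ y → f (x , y)))
∑-cartesianProduct []       ys f = refl
∑-cartesianProduct (x ∷ xs) ys f = trans (∑-++ (map (x ,_) ys) _ f)
  (cong₂ _+_ (∑-map (x ,_) ys f) (∑-cartesianProduct xs ys f))

∑-allFin-≥ : ∀ n (x : Fin n) (f : Fin n → ℕ) → f x ≤ ∑ (allFin n) f
∑-allFin-≥ (suc n) zero    f = m≤m+n (f zero) _
∑-allFin-≥ (suc n) (suc x) f = subst (f (suc x) ≤_) (sym (∑-allFin-suc n f))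
  (≤-trans (∑-allFin-≥ n x (f ∘ suc)) (m≤n+m _ (f zero)))

gramIndices : ∀ m → List (Fin m × Fin m)
gramIndices m = cartesianProduct (allFin m) (allFin m)

gramVec : ∀ M → Fin (suc M) × Fin (suc M) → Fin (suc M) → ℕ
gramVec M (k , l) i = (toℕ i C toℕ k) * ((M ∸ toℕ i) C toℕ l)

-- Both `i` and `M - i` lie below `suc M`, so one range serves both factors, and a product of two
-- Gram sums is a Gram sum over pairs of indices.
⟦⟧-gram : ∀ M (i j : Fin (suc M)) →
          ⟦ i , j ⟧ ≡ ∑ (gramIndices (suc M)) (λ α → gramVec M α i * gramVec M α j)
⟦⟧-gram M i j = begin
  shuffles (toℕ i) (toℕ j) * shuffles (M ∸ toℕ i) (M ∸ toℕ j)
    ≡⟨ cong₂ _*_ (shuffles-gram (toℕ i) (toℕ j) (suc M) (Fin.toℕ<n i))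
         (shuffles-gram (M ∸ toℕ i) (M ∸ toℕ j) (suc M) (s≤s (m∸n≤m M (toℕ i)))) ⟩
  Σ[ suc M ] f * Σ[ suc M ] g
    ≡⟨ ∑-product (allFin (suc M)) (allFin (suc M)) f g ⟩
  Σ[ suc M ] (λ k → Σ[ suc M ] (λ l → f k * g l))
    ≡⟨ ∑-cong (allFin (suc M)) (λ k → ∑-cong (allFin (suc M)) λ l →
         solve 4 (λ a b c d → (a :* b) :* (c :* d) := (a :* c) :* (b :* d)) refl
           (toℕ i C toℕ k) (toℕ j C toℕ k) ((M ∸ toℕ i) C toℕ l) ((M ∸ toℕ j) C toℕ l)) ⟩
  Σ[ suc M ] (λ k → Σ[ suc M ] (λ l → gramVec M (k , l) i * gramVec M (k , l) j))
    ≡⟨ ∑-cartesianProduct (allFin (suc M)) (allFin (suc M)) (λ α → gramVec M α i * gramVec M α j) ⟨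
  ∑ (gramIndices (suc M)) (λ α → gramVec M α i * gramVec M α j) ∎
  where
  open ≡-Reasoning
  open +-*-Solver using (solve; _:=_; _:+_; _:*_; con)
  f g : Fin (suc M) → ℕ
  f k = (toℕ i C toℕ k) * (toℕ j C toℕ k)
  g l = ((M ∸ toℕ i) C toℕ l) * ((M ∸ toℕ j) C toℕ l)

-- This is (x-y)² ≥ 0, with the indicator recording that a nonzero integer has square at least 1.
2xy≤x²+y² : ∀ x y → 2 * (x * y) + 𝟙 (¬? (x ≟ y)) ≤ x * x + y * y
2xy≤x²+y² x y with x ≟ y
... | yes refl = ≤-reflexive
  (solve 1 (λ x → con 2 :* (x :* x) :+ con 0 := x :* x :+ x :* x) refl x)
  where open +-*-Solver using (solve; _:=_; _:+_; _:*_; con)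
... | no x≢y with ≤-total x y
...   | inj₁ x≤y with d , refl ← m≤n⇒∃[o]m+o≡n x≤y = strict x d λ { refl → x≢y (sym (+-identityʳ x)) }
  where
  open +-*-Solver using (solve; _:=_; _:+_; _:*_; con)
  strict : ∀ x d → d ≢ 0 → 2 * (x * (x + d)) + 1 ≤ x * x + (x + d) * (x + d)
  strict x zero    d≢0 = contradiction refl d≢0
  -- The slack `d * d + 2 * d` is the square of `suc d` less 1.
  strict x (suc d) _   = subst (2 * (x * (x + suc d)) + 1 ≤_)
    (solve 2 (λ x d → con 2 :* (x :* (x :+ (con 1 :+ d))) :+ con 1 :+ (d :* d :+ con 2 :* d) :=
       x :* x :+ (x :+ (con 1 :+ d)) :* (x :+ (con 1 :+ d))) refl x d)
    (m≤m+n _ (d * d + 2 * d))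
...   | inj₂ y≤x with d , refl ← m≤n⇒∃[o]m+o≡n y≤x = strict y d λ { refl → x≢y (+-identityʳ y) }
  where
  open +-*-Solver using (solve; _:=_; _:+_; _:*_; con)
  strict : ∀ x d → d ≢ 0 → 2 * ((x + d) * x) + 1 ≤ (x + d) * (x + d) + x * x
  strict x zero    d≢0 = contradiction refl d≢0
  strict x (suc d) _   = subst (2 * ((x + suc d) * x) + 1 ≤_)
    (solve 2 (λ x d → con 2 :* ((x :+ (con 1 :+ d)) :* x) :+ con 1 :+ (d :* d :+ con 2 :* d) :=
       (x :+ (con 1 :+ d)) :* (x :+ (con 1 :+ d)) :+ x :* x) refl x d)
    (m≤m+n _ (d * d + 2 * d))

-- Cauchy–Schwarz for the matrix T against mass ⊗ mass; gap marks the entries at which m T and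
-- mass ⊗ mass differ, and each of them makes the inequality strict.
module CauchySchwarz {I : Set} {m : ℕ} (L : List I) (u : I → Fin m → ℕ) (B : Matrix m) (c₀ : ℕ)
  (gram : ∀ i j → B i j ≡ ∑ L (λ α → u α i * u α j))
  (rows : ∀ i → Σ[ m ] (B i) ≡ c₀) (π : Fin m → Fin m) where

  private
    F = allFin m

  mass : I → ℕ
  mass α = Σ[ m ] (u α)

  T : I → I → ℕ
  T α β = Σ[ m ] (λ i → u α i * u β (π i))

  form : ℕ
  form = Σ[ m ] (λ i → Σ[ m ] (λ j → B i j * B (π i) (π j)))

  open +-*-Solver using (solve; _:=_; _:+_; _:*_; con)
  open ≡-Reasoning

  -- Expanding `mass` and summing over `α` first gives, by the Gram form, the row sum of `B` at `i`.
  ∑-mass : ∀ i → ∑ L (λ α → mass α * u α i) ≡ c₀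
  ∑-mass i = begin
    ∑ L (λ α → mass α * u α i)
      ≡⟨ ∑-cong L (λ α → trans (*-comm (mass α) _) (sym (∑-*ˡ F (u α i) (u α)))) ⟩
    ∑ L (λ α → Σ[ m ] (λ j → u α i * u α j))
      ≡⟨ ∑-swap L F _ ⟩
    Σ[ m ] (λ j → ∑ L (λ α → u α i * u α j))
      ≡⟨ ∑-cong F (λ j → gram i j) ⟨
    Σ[ m ] (λ j → B i j)
      ≡⟨ rows i ⟩
    c₀ ∎

  ∑-mass² : ∑ L (λ α → mass α * mass α) ≡ m * c₀
  ∑-mass² = begin
    ∑ L (λ α → mass α * mass α)
      ≡⟨ ∑-cong L (λ α → sym (∑-*ˡ F (mass α) (u α))) ⟩
    ∑ L (λ α → Σ[ m ] (λ i → mass α * u α i))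
      ≡⟨ ∑-swap L F _ ⟩
    Σ[ m ] (λ i → ∑ L (λ α → mass α * u α i))
      ≡⟨ ∑-cong F ∑-mass ⟩
    Σ[ m ] (λ i → c₀)
      ≡⟨ ∑-allFin-const m c₀ ⟩
    m * c₀ ∎

  ∑∑L : (I → I → ℕ) → ℕ
  ∑∑L f = ∑ L (λ α → ∑ L (f α))

  ∑∑L-mass⁴ : ∑∑L (λ α β → (mass α * mass β) * (mass α * mass β)) ≡ (m * c₀) * (m * c₀)
  ∑∑L-mass⁴ = begin
    ∑∑L (λ α β → (mass α * mass β) * (mass α * mass β))
      ≡⟨ ∑-cong L (λ α → ∑-cong L λ β →
           solve 2 (λ a b → (a :* b) :* (a :* b) := (a :* a) :* (b :* b)) refl (mass α) (mass β)) ⟩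
    ∑∑L (λ α β → (mass α * mass α) * (mass β * mass β))
      ≡⟨ ∑-product L L _ _ ⟨
    ∑ L (λ α → mass α * mass α) * ∑ L (λ α → mass α * mass α)
      ≡⟨ cong₂ _*_ ∑-mass² ∑-mass² ⟩
    (m * c₀) * (m * c₀) ∎

  ∑∑L-swap : (f : Fin m → I → I → ℕ) →
            ∑∑L (λ α β → Σ[ m ] (λ i → f i α β)) ≡ Σ[ m ] (λ i → ∑∑L (f i))
  ∑∑L-swap f = trans (∑-cong L λ α → ∑-swap L F _) (∑-swap L F _)

  ∑∑L-mass-T : ∑∑L (λ α β → T α β * (mass α * mass β)) ≡ m * (c₀ * c₀)
  ∑∑L-mass-T = begin
    ∑∑L (λ α β → T α β * (mass α * mass β))
      ≡⟨ ∑-cong L (λ α → ∑-cong L λ β → trans (sym (∑-*ʳ F (mass α * mass β) _))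
           (∑-cong F λ i → solve 4 (λ a b c d → (a :* b) :* (c :* d) := (c :* a) :* (d :* b)) refl
             (u α i) (u β (π i)) (mass α) (mass β))) ⟩
    ∑∑L (λ α β → Σ[ m ] (λ i → (mass α * u α i) * (mass β * u β (π i))))
      ≡⟨ ∑∑L-swap _ ⟩
    Σ[ m ] (λ i → ∑∑L (λ α β → (mass α * u α i) * (mass β * u β (π i))))
      ≡⟨ ∑-cong F (λ i → trans (sym (∑-product L L _ _)) (cong₂ _*_ (∑-mass i) (∑-mass (π i)))) ⟩
    Σ[ m ] (λ i → c₀ * c₀)
      ≡⟨ ∑-allFin-const m (c₀ * c₀) ⟩
    m * (c₀ * c₀) ∎

  ∑∑L-T² : ∑∑L (λ α β → T α β * T α β) ≡ form
  ∑∑L-T² = begin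
    ∑∑L (λ α β → T α β * T α β)
      ≡⟨ ∑-cong L (λ α → ∑-cong L λ β → ∑-product F F _ _) ⟩
    ∑∑L (λ α β → Σ[ m ] (λ i → Σ[ m ] (λ j →
      (u α i * u β (π i)) * (u α j * u β (π j)))))
      ≡⟨ trans (∑∑L-swap _) (∑-cong F λ i → ∑∑L-swap _) ⟩
    Σ[ m ] (λ i → Σ[ m ] (λ j → ∑∑L (λ α β →
      (u α i * u β (π i)) * (u α j * u β (π j)))))
      ≡⟨ ∑-cong F (λ i → ∑-cong F λ j → ∑-cong L λ α → ∑-cong L λ β →
           solve 4 (λ a b c d → (a :* b) :* (c :* d) := (a :* c) :* (b :* d)) refl
             (u α i) (u β (π i)) (u α j) (u β (π j))) ⟩
    Σ[ m ] (λ i → Σ[ m ] (λ j → ∑∑L (λ α β →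
      (u α i * u α j) * (u β (π i) * u β (π j)))))
      ≡⟨ ∑-cong F (λ i → ∑-cong F λ j → trans (sym (∑-product L L _ _))
           (sym (cong₂ _*_ (gram i j) (gram (π i) (π j))))) ⟩
    form ∎

  gap : I → I → ℕ
  gap α β = 𝟙 (¬? (m * T α β ≟ mass α * mass β))

  ∑∑L-+ : ∀ f f′ → ∑∑L (λ α β → f α β + f′ α β) ≡ ∑∑L f + ∑∑L f′
  ∑∑L-+ f f′ = trans (∑-cong L λ α → ∑-+ L (f α) (f′ α)) (∑-+ L _ _)

  ∑∑L-*ˡ : ∀ c f → ∑∑L (λ α β → c * f α β) ≡ c * ∑∑L f
  ∑∑L-*ˡ c f = trans (∑-cong L λ α → ∑-*ˡ L c (f α)) (∑-*ˡ L c _)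

  -- The factor `m` makes the projection onto `mass ⊗ mass` have coefficient 1: the inner product of
  -- `m T` with `mass ⊗ mass` and the square norm of the latter are both `(m c₀)²`. Summing 2xy ≤ x²
  -- + y² over all entries, one copy of this number cancels.
  cauchy-schwarz : (m * m) * (c₀ * c₀) + ∑∑L gap ≤ (m * m) * form
  cauchy-schwarz = +-cancelʳ-≤ ((m * c₀) * (m * c₀)) _ _ (subst₂ _≤_ lhs rhs
    (∑-mono L λ α → ∑-mono L λ β → 2xy≤x²+y² (m * T α β) (mass α * mass β)))
    where
    lhs : ∑∑L (λ α β → 2 * (m * T α β * (mass α * mass β)) + gap α β) ≡
          (m * m) * (c₀ * c₀) + ∑∑L gap + (m * c₀) * (m * c₀)
    lhs = begin
      ∑∑L (λ α β → 2 * (m * T α β * (mass α * mass β)) + gap α β)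
        ≡⟨ ∑∑L-+ _ gap ⟩
      ∑∑L (λ α β → 2 * (m * T α β * (mass α * mass β))) + ∑∑L gap
        ≡⟨ cong (_+ ∑∑L gap) (trans
             (∑-cong L λ α → ∑-cong L λ β → solve 4
               (λ m t a b → con 2 :* (m :* t :* (a :* b)) := (con 2 :* m) :* (t :* (a :* b))) refl
               m (T α β) (mass α) (mass β))
             (∑∑L-*ˡ (2 * m) _)) ⟩
      2 * m * ∑∑L (λ α β → T α β * (mass α * mass β)) + ∑∑L gap
        ≡⟨ cong (λ x → 2 * m * x + ∑∑L gap) ∑∑L-mass-T ⟩
      2 * m * (m * (c₀ * c₀)) + ∑∑L gap
        ≡⟨ solve 3 (λ m c g → con 2 :* m :* (m :* (c :* c)) :+ g :=
                              (m :* m) :* (c :* c) :+ g :+ (m :* c) :* (m :* c)) refl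
             m c₀ (∑∑L gap) ⟩
      (m * m) * (c₀ * c₀) + ∑∑L gap + (m * c₀) * (m * c₀) ∎
    rhs : ∑∑L (λ α β → m * T α β * (m * T α β) + (mass α * mass β) * (mass α * mass β)) ≡
          (m * m) * form + (m * c₀) * (m * c₀)
    rhs = begin
      ∑∑L (λ α β → m * T α β * (m * T α β) + (mass α * mass β) * (mass α * mass β))
        ≡⟨ ∑∑L-+ _ _ ⟩
      ∑∑L (λ α β → m * T α β * (m * T α β)) + ∑∑L (λ α β → (mass α * mass β) * (mass α * mass β))
        ≡⟨ cong₂ _+_ (trans
             (∑-cong L λ α → ∑-cong L λ β →
               solve 2 (λ m t → m :* t :* (m :* t) := (m :* m) :* (t :* t)) refl m (T α β))
             (trans (∑∑L-*ˡ (m * m) _) (cong ((m * m) *_) ∑∑L-T²))) ∑∑L-mass⁴ ⟩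
      (m * m) * form + (m * c₀) * (m * c₀) ∎

-- A single entry with gap 1 gives strictness, and the common factor `m * m` is then cancelled.
energy-lower-bound : ∀ M (π : Permutation′ (suc (suc M))) →
  shuffles (suc M) (suc (suc M)) * shuffles (suc M) (suc (suc M)) < energy π
energy-lower-bound M π = *-cancelˡ-< (m * m) _ _ (≤-trans
  (subst (_≤ (m * m) * (c₀ * c₀) + ∑∑L gap) (+-comm _ 1)
    (+-monoʳ-≤ ((m * m) * (c₀ * c₀)) gap≥1))
  cauchy-schwarz)
  where
  m = suc (suc M)
  c₀ = shuffles (suc M) (suc (suc M))
  open CauchySchwarz (gramIndices m) (gramVec (suc M)) (A m) c₀ (⟦⟧-gram (suc M)) (row-sum (suc M))
    (π ⟨$⟩ʳ_)
  -- gramVec α₀ is the indicator of the index 0, so mass α₀ = 1, whereas m T α₀ α₀ is a multiple of m.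
  α₀ : Fin m × Fin m
  α₀ = zero , fromℕ (suc M)
  mass≡1 : mass α₀ ≡ 1
  mass≡1 = trans (∑-allFin-suc (suc M) (gramVec (suc M) α₀)) (cong₂ _+_
    (trans (*-identityˡ _) (trans (cong (suc M C_) (Fin.toℕ-fromℕ (suc M))) (nCn≡1 (suc M))))
    (∑-≡0 (allFin (suc M)) λ i → trans (*-identityˡ _)
      (k>n⇒nCk≡0 (subst (M ∸ toℕ i <_) (sym (Fin.toℕ-fromℕ (suc M))) (s≤s (m∸n≤m M (toℕ i)))))))
  gap₀ : gap α₀ α₀ ≡ 1
  gap₀ = 𝟙-yes (¬? (m * T α₀ α₀ ≟ mass α₀ * mass α₀)) λ eq →
    contradiction (m*n≡1⇒m≡1 m (T α₀ α₀) (trans eq (cong₂ _*_ mass≡1 mass≡1))) λ ()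
  ∑-gramIndices-≥ : ∀ (f : Fin m × Fin m → ℕ) → f α₀ ≤ ∑ (gramIndices m) f
  ∑-gramIndices-≥ f = subst (f α₀ ≤_) (sym (∑-cartesianProduct (allFin m) (allFin m) f))
    (≤-trans (∑-allFin-≥ m (proj₂ α₀) (λ l → f (zero , l)))
             (∑-allFin-≥ m zero (λ k → ∑ (allFin m) (λ l → f (k , l)))))
  gap≥1 : 1 ≤ ∑∑L gap
  gap≥1 = ≤-trans (≤-reflexive (sym gap₀)) (≤-trans (∑-gramIndices-≥ (gap α₀))
    (∑-gramIndices-≥ (λ α → ∑ (gramIndices m) (gap α))))

-- Falling factorials

-- `n P′ k` is the falling factorial n(n-1)...(n-k+1). Each step of the induction moves its last
-- factor `suc d` into the factorial.
P′-! : ∀ k d → ((k + d) P′ k) * d ! ≡ (k + d) !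
P′-! zero    d = *-identityˡ (d !)
P′-! (suc k) d = begin
  ((suc k + d ∸ k) * ((suc k + d) P′ k)) * d !
    ≡⟨ cong (λ n → ((n ∸ k) * (n P′ k)) * d !) (+-suc k d) ⟨
  ((k + suc d ∸ k) * ((k + suc d) P′ k)) * d !
    ≡⟨ cong (λ x → (x * ((k + suc d) P′ k)) * d !) (m+n∸m≡n k (suc d)) ⟩
  (suc d * ((k + suc d) P′ k)) * d !
    ≡⟨ solve 3 (λ x y z → (x :* y) :* z := y :* (x :* z)) refl (suc d) ((k + suc d) P′ k) (d !) ⟩
  ((k + suc d) P′ k) * suc d !
    ≡⟨ P′-! k (suc d) ⟩
  (k + suc d) !
    ≡⟨ cong _! (+-suc k d) ⟩
  (suc k + d) ! ∎
  where
  open ≡-Reasoning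
  open +-*-Solver using (solve; _:=_; _:*_)

shuffles-! : ∀ k d → shuffles k d * (k ! * d !) ≡ (k + d) !
shuffles-! k d = begin
  ((k + d) C k) * (k ! * d !)
    ≡⟨ cong (λ x → ((k + d) C k) * (k ! * x !)) (m+n∸m≡n k d) ⟨
  ((k + d) C k) * (k ! * (k + d ∸ k) !)
    ≡⟨ cong (_* (k ! * (k + d ∸ k) !)) (nCk≡n!/k![n-k]! (m≤m+n k d)) ⟩
  (_/_ ((k + d) !) (k ! * (k + d ∸ k) !) {{k !* (k + d ∸ k) !≢0}}) * (k ! * (k + d ∸ k) !)
    ≡⟨ m/n*n≡m {{k !* (k + d ∸ k) !≢0}} (k![n∸k]!∣n! (m≤m+n k d)) ⟩
  (k + d) ! ∎
  where open ≡-Reasoning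

P′-complement : ∀ k d {n} → k + d ≡ n → (n P′ k) * d ! ≡ n !
P′-complement k d refl = P′-! k d

C-! : ∀ k d {n} → k + d ≡ n → (n C k) * k ! ≡ n P′ k
C-! k d refl = *-cancelʳ-≡ _ _ (d !) {{d !≢0}} (trans (*-assoc ((k + d) C k) _ _)
  (trans (shuffles-! k d) (sym (P′-! k d))))

P′≤^ : ∀ n k → n P′ k ≤ n ^ k
P′≤^ n zero    = ≤-refl
P′≤^ n (suc k) = *-mono-≤ (m∸n≤m n k) (P′≤^ n k)

-- Bounding one factor `n` by `suc k + (n ∸ suc k)` extends the falling factorial at the cost of
-- `suc k` times a lower power; the constant is 1 + ... + k.
^≤P′ : ∀ k → ∃ λ K → ∀ n → n ^ suc k ≤ n P′ suc k + K * n ^ k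
^≤P′ zero = 0 , λ n → ≤-reflexive (sym (+-identityʳ _))
^≤P′ (suc k) with K , bound ← ^≤P′ k = suc k + K , λ n → begin
  n * n ^ suc k
    ≤⟨ *-monoʳ-≤ n (bound n) ⟩
  n * (n P′ suc k + K * n ^ k)
    ≡⟨ *-distribˡ-+ n (n P′ suc k) _ ⟩
  n * (n P′ suc k) + n * (K * n ^ k)
    ≤⟨ +-monoˡ-≤ _ (*-monoˡ-≤ (n P′ suc k) (m≤n+m∸n n (suc k))) ⟩
  (suc k + (n ∸ suc k)) * (n P′ suc k) + n * (K * n ^ k)
    ≡⟨ solve 6 (λ k x p n c y → (k :+ x) :* p :+ n :* (c :* y) := x :* p :+ (k :* p :+ c :* (n :* y)))
         refl (suc k) (n ∸ suc k) (n P′ suc k) n K (n ^ k) ⟩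
  n P′ suc (suc k) + (suc k * (n P′ suc k) + K * n ^ suc k)
    ≤⟨ +-monoʳ-≤ (n P′ suc (suc k)) (+-monoˡ-≤ _ (*-monoʳ-≤ (suc k) (P′≤^ n (suc k)))) ⟩
  n P′ suc (suc k) + (suc k * n ^ suc k + K * n ^ suc k)
    ≡⟨ cong (n P′ suc (suc k) +_) (*-distribʳ-+ (n ^ suc k) (suc k) K) ⟨
  n P′ suc (suc k) + (suc k + K) * n ^ suc k ∎
  where
  open ≤-Reasoning
  open +-*-Solver using (solve; _:=_; _:*_; _:+_)

-- With m = a + 2, these are the first two terms of the expansion of f(m) f(b) in falling
-- factorials, the remaining ones being absorbed into a power of `n`. The coefficient m b has to be
-- exact: for b = m it must match the m² f(2m-1) of the pair count.
P′-product : ∀ a b → ∃ λ K → ∀ n → (n P′ suc (suc a)) * (n P′ b) ≤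
  n P′ (b + suc (suc a)) + suc (suc a) * b * (n P′ (b + suc a)) + K * n ^ (b + a)
P′-product a zero = 0 , λ n → ≤-reflexive
  (solve 3 (λ p x q → p :* con 1 := p :+ x :* con 0 :* q :+ con 0) refl
    (n P′ suc (suc a)) (suc (suc a)) (n P′ suc a))
  where open +-*-Solver using (solve; _:=_; _:*_; _:+_; con)
P′-product a (suc b) with K , bound ← P′-product a b = A₂ * b * suc a + K , λ n →
  let p₂ = n P′ (b + A₂)
      p₁ = n P′ (b + suc a)
      -- Multiplied by `n P′ (b + x)`, this gives the next falling factorial plus `x` times the
      -- present one.
      split : ∀ x → n ∸ b ≤ x + (n ∸ (b + x))
      split x = subst (λ y → n ∸ b ≤ x + y) (∸-+-assoc n b x) (m≤n+m∸n (n ∸ b) x)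
  in begin
  (n P′ A₂) * ((n ∸ b) * (n P′ b))
    ≡⟨ solve 3 (λ x y z → x :* (y :* z) := y :* (x :* z)) refl (n P′ A₂) (n ∸ b) (n P′ b) ⟩
  (n ∸ b) * ((n P′ A₂) * (n P′ b))
    ≤⟨ *-monoʳ-≤ (n ∸ b) (bound n) ⟩
  (n ∸ b) * (p₂ + A₂ * b * p₁ + K * n ^ (b + a))
    ≡⟨ solve 4 (λ x p q r → x :* (p :+ q :+ r) := x :* p :+ x :* q :+ x :* r) refl
         (n ∸ b) p₂ (A₂ * b * p₁) (K * n ^ (b + a)) ⟩
  (n ∸ b) * p₂ + (n ∸ b) * (A₂ * b * p₁) + (n ∸ b) * (K * n ^ (b + a))
    ≤⟨ +-mono-≤ (+-mono-≤ (*-monoˡ-≤ p₂ (split A₂)) (*-monoˡ-≤ (A₂ * b * p₁) (split (suc a))))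
                (*-monoˡ-≤ (K * n ^ (b + a)) (m∸n≤m n b)) ⟩
  (A₂ + (n ∸ (b + A₂))) * p₂ + (suc a + (n ∸ (b + suc a))) * (A₂ * b * p₁) +
  n * (K * n ^ (b + a))
    ≡⟨ solve 10 (λ A x p s y c q n K z →
         (A :+ x) :* p :+ (s :+ y) :* (c :* q) :+ n :* (K :* z) :=
         x :* p :+ (A :* p :+ c :* (y :* q)) :+ (c :* s :* q :+ K :* (n :* z))) refl
         A₂ (n ∸ (b + A₂)) p₂ (suc a) (n ∸ (b + suc a)) (A₂ * b) p₁ n K (n ^ (b + a)) ⟩
  n P′ suc (b + A₂) + (A₂ * p₂ + A₂ * b * (n P′ suc (b + suc a))) +
  (A₂ * b * suc a * p₁ + K * n ^ suc (b + a))
    ≤⟨ +-monoʳ-≤ (n P′ suc (b + A₂) + (A₂ * p₂ + A₂ * b * (n P′ suc (b + suc a))))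
         (+-monoˡ-≤ (K * n ^ suc (b + a)) (*-monoʳ-≤ (A₂ * b * suc a) (P′≤^ n (b + suc a)))) ⟩
  n P′ suc (b + A₂) + (A₂ * p₂ + A₂ * b * (n P′ suc (b + suc a))) +
  (A₂ * b * suc a * n ^ (b + suc a) + K * n ^ suc (b + a))
    ≡⟨ cong₂ (λ x y → n P′ suc (b + A₂) + (A₂ * (n P′ x) + A₂ * b * (n P′ suc (b + suc a))) +
                      (A₂ * b * suc a * n ^ y + K * n ^ suc (b + a)))
             (+-suc b (suc a)) (+-suc b a) ⟩
  n P′ suc (b + A₂) + (A₂ * (n P′ suc (b + suc a)) + A₂ * b * (n P′ suc (b + suc a))) +
  (A₂ * b * suc a * n ^ suc (b + a) + K * n ^ suc (b + a))
    ≡⟨ solve 7 (λ P A q b t y K → P :+ (A :* q :+ A :* b :* q) :+ (t :* y :+ K :* y) :=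
                                  P :+ A :* (con 1 :+ b) :* q :+ (t :+ K) :* y) refl
         (n P′ suc (b + A₂)) A₂ (n P′ suc (b + suc a)) b (A₂ * b * suc a) (n ^ suc (b + a)) K ⟩
  n P′ suc (b + A₂) + A₂ * suc b * (n P′ suc (b + suc a)) + (A₂ * b * suc a + K) * n ^ suc (b + a) ∎
  where
  A₂ = suc (suc a)
  open ≤-Reasoning
  open +-*-Solver using (solve; _:=_; _:*_; _:+_; con)

-- Pair counts in terms of falling factorials

module _ {D k m c r v q p₁ p₂ : ℕ} where

  open +-*-Solver using (solve; _:=_; _:*_; _:+_)
  open ≡-Reasoning

  -- `D`, `k * (m * c)` and `r` stand for the three classes of pairs, and `v` for m!². The relation
  -- `c * v ≡ m * q` turns the middle class into m² f(2m-1).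
  overlap-expansion : D * v ≡ p₂ → c * v ≡ m * q → k * q ≡ p₁ →
                      (D + k * (m * c) + r) * v ≡ p₂ + m * m * p₁ + v * r
  overlap-expansion Dv cv kq = begin
    (D + k * (m * c) + r) * v
      ≡⟨ solve 6 (λ D k m c r v → (D :+ k :* (m :* c) :+ r) :* v :=
                                  D :* v :+ (k :* m) :* (c :* v) :+ v :* r) refl D k m c r v ⟩
    D * v + (k * m) * (c * v) + v * r
      ≡⟨ cong₂ (λ x y → x + (k * m) * y + v * r) Dv cv ⟩
    p₂ + (k * m) * (m * q) + v * r
      ≡⟨ cong (λ x → p₂ + x + v * r)
           (solve 3 (λ k m q → (k :* m) :* (m :* q) := m :* m :* (k :* q)) refl k m q) ⟩
    p₂ + m * m * (k * q) + v * r
      ≡⟨ cong (λ x → p₂ + m * m * x + v * r) kq ⟩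
    p₂ + m * m * p₁ + v * r ∎

-- `D * (D * f)` is position pairs times value pairs times extensions; one factor `p = D v` absorbs
-- `f` into `F = n!`, and the other remains as the falling factorial.
square-term : ∀ {D f v p F} → D * v ≡ p → p * f ≡ F → (D * (D * f)) * (v * v) ≡ p * F
square-term {D} {f} {v} {p} {F} Dv pf = begin
  (D * (D * f)) * (v * v)
    ≡⟨ solve 3 (λ D f v → (D :* (D :* f)) :* (v :* v) := (D :* v) :* ((D :* v) :* f)) refl D f v ⟩
  (D * v) * ((D * v) * f)
    ≡⟨ cong (λ x → x * (x * f)) Dv ⟩
  p * (p * f)
    ≡⟨ cong (p *_) pf ⟩
  p * F ∎
  where
  open ≡-Reasoning
  open +-*-Solver using (solve; _:=_; _:*_)

module Counts (M d n : ℕ) (2m+d≡n : (suc M + suc M) + d ≡ n) where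

  -- Since `M + m` is 2m-1, `q` is (2m-1)!.
  m v q : ℕ
  m = suc M
  v = m ! * m !
  q = (M + m) !

  open ≡-Reasoning

  disjoints meets central : ℕ
  disjoints = (n C (m + m)) * shuffles m m
  meets = n C suc (M + M)
  central = shuffles M m

  [M+m]+1+d≡n : (M + m) + suc d ≡ n
  [M+m]+1+d≡n = trans (+-suc (M + m) d) 2m+d≡n

  m+[m+d]≡n : m + (m + d) ≡ n
  m+[m+d]≡n = trans (sym (+-assoc m m d)) 2m+d≡n

  disjoints-v : disjoints * v ≡ n P′ (m + m)
  disjoints-v = begin
    (n C (m + m)) * shuffles m m * v
      ≡⟨ *-assoc (n C (m + m)) _ _ ⟩
    (n C (m + m)) * (shuffles m m * v)
      ≡⟨ cong ((n C (m + m)) *_) (shuffles-! m m) ⟩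
    (n C (m + m)) * (m + m) !
      ≡⟨ C-! (m + m) d 2m+d≡n ⟩
    n P′ (m + m) ∎

  meets-q : meets * q ≡ n P′ (M + m)
  meets-q = begin
    (n C suc (M + M)) * (M + m) !
      ≡⟨ cong (λ x → (n C x) * (M + m) !) (+-suc M M) ⟨
    (n C (M + m)) * (M + m) !
      ≡⟨ C-! (M + m) (suc d) [M+m]+1+d≡n ⟩
    n P′ (M + m) ∎

  central-v : central * v ≡ m * q
  central-v = begin
    central * ((m * M !) * m !)
      ≡⟨ cong (central *_) (*-assoc m (M !) (m !)) ⟩
    central * (m * (M ! * m !))
      ≡⟨ x∙yz≈y∙xz central m (M ! * m !) ⟩
    m * (central * (M ! * m !))
      ≡⟨ cong (m *_) (shuffles-! M m) ⟩
    m * q ∎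
    where open import Algebra.Properties.CommutativeSemigroup *-commutativeSemigroup using (x∙yz≈y∙xz)

  C-m! : (n C m) * m ! ≡ n P′ m
  C-m! = C-! m (m + d) m+[m+d]≡n

  ∑⟦⟧ : Σ[ m ] (λ a → Σ[ m ] (λ b → ⟦ a , b ⟧)) ≡ m * central
  ∑⟦⟧ = trans (∑-cong (allFin m) (row-sum M)) (∑-allFin-const m central)

  P′²-crowded : (n P′ m) * (n P′ m) ≡
                n P′ (m + m) + m * m * (n P′ (M + m)) + v * crowded n m
  P′²-crowded = begin
    (n P′ m) * (n P′ m)
      ≡⟨ cong₂ _*_ C-m! C-m! ⟨
    ((n C m) * m !) * ((n C m) * m !)
      ≡⟨ [m*n]*[o*p]≡[m*o]*[n*p] (n C m) (m !) (n C m) (m !) ⟩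
    ((n C m) * (n C m)) * v
      ≡⟨ cong (_* v) (count-pairs n M) ⟩
    (disjoints + meets * Σ[ m ] (λ a → Σ[ m ] (λ b → ⟦ a , b ⟧)) + crowded n m) * v
      ≡⟨ cong (λ x → (disjoints + meets * x + crowded n m) * v) ∑⟦⟧ ⟩
    (disjoints + meets * (m * central) + crowded n m) * v
      ≡⟨ overlap-expansion {disjoints} {meets} {m} {central} {crowded n m} {v} {q}
           disjoints-v central-v meets-q ⟩
    n P′ (m + m) + m * m * (n P′ (M + m)) + v * crowded n m ∎

  disjoint-term : (disjoints * (disjoints * d !)) * (v * v) ≡ (n P′ (m + m)) * n !
  disjoint-term = square-term {disjoints} {d !} {v} disjoints-v (P′-complement (m + m) d 2m+d≡n)

  meet-term : (meets * (meets * suc d !)) * (q * q) ≡ (n P′ (M + m)) * n !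
  meet-term = square-term {meets} {suc d !} {q} meets-q (P′-complement (M + m) (suc d) [M+m]+1+d≡n)

  first-term : ((n C m) * ((n C m) * (m + d) !)) * v ≡ (n P′ m) * n !
  first-term = square-term {n C m} {(m + d) !} {m !} C-m! (P′-complement m (m + d) m+[m+d]≡n)

excess-bound : ∀ {x a b r} v .{{_ : NonZero v}} → x ≡ a + v * r → x ≤ a + b → r ≤ b
excess-bound {x} {a} {b} {r} v eq le = +-cancelˡ-≤ a r b
  (≤-trans (+-monoʳ-≤ a (m≤n*m r v)) (≤-trans (≤-reflexive (sym eq)) le))

-- The exact expansion of f(m)² and the upper bound from `P′-product` share their first two terms,
-- so what is left of the former, m!² r, is at most what is left of the latter. Here `M + m` is
-- 2m-2.
crowded-bound : ∀ M → ∃ λ K → ∀ d n → let m = suc (suc M) in (m + m) + d ≡ n →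
                crowded n m ≤ K * n ^ (M + m)
crowded-bound M = proj₁ (P′-product M m) , λ d n eq →
  excess-bound (m ! * m !) {{m !* m !≢0}} (Counts.P′²-crowded (suc M) d n eq)
    (subst₂ (λ x y → (n P′ m) * (n P′ m) ≤
                     n P′ (m + m) + m * m * (n P′ x) + proj₁ (P′-product M m) * n ^ y)
            (+-comm m (suc M)) (+-comm m M) (proj₂ (P′-product M m) n))
  where
  m = suc (suc M)

-- Passage to rational numbers

ι : ℕ → ℚ
ι n = ℤ.+ n ℚ./ 1

-- `ℚ._/_` reduces to lowest terms, so identities are checked on unnormalised fractions, where they
-- are cross-multiplications.
toℚᵘ-/ : ∀ i n .{{_ : NonZero n}} → ℚ.toℚᵘ (i ℚ./ n) ≃ (i ℚᵘ./ n)
toℚᵘ-/ i (suc n) = toℚᵘ-fromℚᵘ (mkℚᵘ i n)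

ι-+ : ∀ a b → ι (a + b) ≡ ι a ℚ.+ ι b
ι-+ a b = toℚᵘ-injective (begin
  ℚ.toℚᵘ (ι (a + b)) ≈⟨ toℚᵘ-/ (ℤ.+ (a + b)) 1 ⟩
  mkℚᵘ (ℤ.+ (a + b)) 0 ≈⟨ *≡* (cong (ℤ._* ℤ.+ 1)
    (cong₂ ℤ._+_ (sym (ℤ.*-identityʳ (ℤ.+ a))) (sym (ℤ.*-identityʳ (ℤ.+ b))))) ⟩
  mkℚᵘ (ℤ.+ a) 0 ℚᵘ.+ mkℚᵘ (ℤ.+ b) 0 ≈⟨ ℚᵘ.+-cong (toℚᵘ-/ (ℤ.+ a) 1) (toℚᵘ-/ (ℤ.+ b) 1) ⟨
  ℚ.toℚᵘ (ι a) ℚᵘ.+ ℚ.toℚᵘ (ι b) ≈⟨ toℚᵘ-homo-+ (ι a) (ι b) ⟨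
  ℚ.toℚᵘ (ι a ℚ.+ ι b) ∎)
  where open ℚᵘ.≃-Reasoning

/-*-ι : ∀ a b .{{_ : NonZero b}} → (ℤ.+ a ℚ./ b) ℚ.* ι b ≡ ι a
/-*-ι a b@(suc b-1) = toℚᵘ-injective (begin
  ℚ.toℚᵘ ((ℤ.+ a ℚ./ b) ℚ.* ι b) ≈⟨ toℚᵘ-homo-* (ℤ.+ a ℚ./ b) (ι b) ⟩
  ℚ.toℚᵘ (ℤ.+ a ℚ./ b) ℚᵘ.* ℚ.toℚᵘ (ι b) ≈⟨ ℚᵘ.*-cong (toℚᵘ-/ (ℤ.+ a) b) (toℚᵘ-/ (ℤ.+ b) 1) ⟩
  mkℚᵘ (ℤ.+ a) b-1 ℚᵘ.* mkℚᵘ (ℤ.+ b) 0 ≈⟨ *≡* (trans (ℤ.*-identityʳ _)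
    (cong (ℤ.+ a ℤ.*_) (cong ℤ.+_ (sym (*-identityʳ b))))) ⟩
  mkℚᵘ (ℤ.+ a) 0 ≈⟨ toℚᵘ-/ (ℤ.+ a) 1 ⟨
  ℚ.toℚᵘ (ι a) ∎)
  where open ℚᵘ.≃-Reasoning

ι-* : ∀ a b → ι (a * b) ≡ ι a ℚ.* ι b
ι-* a b = toℚᵘ-injective (begin
  ℚ.toℚᵘ (ι (a * b)) ≈⟨ toℚᵘ-/ (ℤ.+ (a * b)) 1 ⟩
  mkℚᵘ (ℤ.+ (a * b)) 0 ≈⟨ *≡* (cong (ℤ._* ℤ.+ 1) (ℤ.pos-* a b)) ⟩
  mkℚᵘ (ℤ.+ a) 0 ℚᵘ.* mkℚᵘ (ℤ.+ b) 0 ≈⟨ ℚᵘ.*-cong (toℚᵘ-/ (ℤ.+ a) 1) (toℚᵘ-/ (ℤ.+ b) 1) ⟨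
  ℚ.toℚᵘ (ι a) ℚᵘ.* ℚ.toℚᵘ (ι b) ≈⟨ toℚᵘ-homo-* (ι a) (ι b) ⟨
  ℚ.toℚᵘ (ι a ℚ.* ι b) ∎)
  where open ℚᵘ.≃-Reasoning

ι-nonNeg : ∀ n → ℚ.NonNegative (ι n)
ι-nonNeg n = normalize-nonNeg n 1

0≤ι : ∀ n → ℚ.0ℚ ℚ.≤ ι n
0≤ι n = nonNegative⁻¹ (ι n) {{ι-nonNeg n}}

ι-mono-≤ : ∀ {a b} → a ≤ b → ι a ℚ.≤ ι b
ι-mono-≤ {a} a≤b with c , refl ← m≤n⇒∃[o]m+o≡n a≤b = subst (ι a ℚ.≤_) (sym (ι-+ a c))
  (subst (ℚ._≤ ι a ℚ.+ ι c) (ℚ.+-identityʳ (ι a)) (ℚ.+-monoʳ-≤ (ι a) (0≤ι c)))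

recip : ∀ n .{{_ : NonZero n}} → ℚ
recip n = ℤ.+ 1 ℚ./ n

recip-nonNeg : ∀ n .{{_ : NonZero n}} → ℚ.NonNegative (recip n)
recip-nonNeg n = normalize-nonNeg 1 n

ι-recip : ∀ n .{{_ : NonZero n}} → ι n ℚ.* recip n ≡ ℚ.1ℚ
ι-recip n = trans (ℚ.*-comm (ι n) (recip n)) (/-*-ι 1 n)

mean-length : ∀ xs → mean xs ℚ.* ι (length xs) ≡ ι (sum xs)
mean-length []       = refl
mean-length (x ∷ xs) = /-*-ι (sum (x ∷ xs)) (suc (length xs))

mean-S : ∀ n (f : _ → ℕ) → mean (map f (S n)) ℚ.* ι (n !) ≡ ι (∑ (S n) f)
mean-S n f = trans
  (cong (λ k → mean (map f (S n)) ℚ.* ι k) (sym (trans (length-map f (S n)) (length-S n))))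
  (mean-length (map f (S n)))

divide : ∀ x y y⁻¹ z → x ℚ.* y ≡ z → y ℚ.* y⁻¹ ≡ ℚ.1ℚ → x ≡ z ℚ.* y⁻¹
divide x y y⁻¹ z xy≡z yy⁻¹≡1 = begin
  x ≡⟨ ℚ.*-identityʳ x ⟨
  x ℚ.* ℚ.1ℚ ≡⟨ cong (x ℚ.*_) yy⁻¹≡1 ⟨
  x ℚ.* (y ℚ.* y⁻¹) ≡⟨ ℚ.*-assoc x y y⁻¹ ⟨
  x ℚ.* y ℚ.* y⁻¹ ≡⟨ cong (ℚ._* y⁻¹) xy≡z ⟩
  z ℚ.* y⁻¹ ∎
  where open ≡-Reasoning

*-one : ∀ x {y} → y ≡ ℚ.1ℚ → x ℚ.* y ≡ x
*-one x y≡1 = trans (cong (x ℚ.*_) y≡1) (ℚ.*-identityʳ x)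

module _ {F F⁻¹ v v⁻¹ q q⁻² : ℚ} (FF⁻¹ : F ℚ.* F⁻¹ ≡ ℚ.1ℚ) (vv⁻¹ : v ℚ.* v⁻¹ ≡ ℚ.1ℚ)
         (qqq⁻² : (q ℚ.* q) ℚ.* q⁻² ≡ ℚ.1ℚ) where

  open ≡-Reasoning
  open ℚ-Solver using (solve; _:=_; _:*_; _:+_; _:-_; con)

  -- `g` and `e` are the means of X² and X, `a` is the trace, `t` its excess over `c₀²`, and `p₂`,
  -- `p₁`, `pₘ` are f(2m), f(2m-1), f(m). Reciprocals enter as variables with hypotheses such as
  -- `F F⁻¹ = 1`, so that the ring solver can treat them.
  variance-identity : ∀ {g T₂ U₁ U₂ a R p₁ p₂ e T₁ pₘ m r c₀ t c} →
    g ℚ.* F ≡ T₂ → T₂ ≡ U₁ ℚ.+ U₂ ℚ.* a ℚ.+ R → U₁ ℚ.* (v ℚ.* v) ≡ p₂ ℚ.* F → U₂ ℚ.* (q ℚ.* q) ≡ p₁ ℚ.* F →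
    e ℚ.* F ≡ T₁ → T₁ ℚ.* v ≡ pₘ ℚ.* F → pₘ ℚ.* pₘ ≡ p₂ ℚ.+ m ℚ.* m ℚ.* p₁ ℚ.+ v ℚ.* r →
    c₀ ℚ.* v ≡ m ℚ.* q → a ≡ c₀ ℚ.* c₀ ℚ.+ t → c ℚ.* (q ℚ.* q) ≡ t →
    g ℚ.- e ℚ.* e ≡ c ℚ.* p₁ ℚ.+ (R ℚ.* F⁻¹ ℚ.- r ℚ.* v⁻¹)
  variance-identity {g} {T₂} {U₁} {U₂} {a} {R} {p₁} {p₂} {e} {T₁} {pₘ} {m} {r} {c₀} {t} {c}
    gF T₂≡ U₁≡ U₂≡ eF T₁v pₘ² c₀v a≡ cqq = begin
    g ℚ.- e ℚ.* e
      ≡⟨ cong₂ ℚ._-_ g≡ e²≡ ⟩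
    (p₂ ℚ.* (v⁻¹ ℚ.* v⁻¹) ℚ.+ (m ℚ.* m ℚ.* p₁ ℚ.* (v⁻¹ ℚ.* v⁻¹) ℚ.+ c ℚ.* p₁) ℚ.+ R ℚ.* F⁻¹) ℚ.-
    (p₂ ℚ.* (v⁻¹ ℚ.* v⁻¹) ℚ.+ m ℚ.* m ℚ.* p₁ ℚ.* (v⁻¹ ℚ.* v⁻¹) ℚ.+ r ℚ.* v⁻¹)
      ≡⟨ solve 5 (λ x y z w s → (x :+ (y :+ z) :+ w) :- (x :+ y :+ s) := z :+ (w :- s)) refl
           (p₂ ℚ.* (v⁻¹ ℚ.* v⁻¹)) (m ℚ.* m ℚ.* p₁ ℚ.* (v⁻¹ ℚ.* v⁻¹)) (c ℚ.* p₁) (R ℚ.* F⁻¹) (r ℚ.* v⁻¹) ⟩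
    c ℚ.* p₁ ℚ.+ (R ℚ.* F⁻¹ ℚ.- r ℚ.* v⁻¹) ∎
    where
    vvvv : (v ℚ.* v) ℚ.* (v⁻¹ ℚ.* v⁻¹) ≡ ℚ.1ℚ
    vvvv = trans (solve 2 (λ v w → (v :* v) :* (w :* w) := (v :* w) :* (v :* w)) refl v v⁻¹)
                 (cong₂ ℚ._*_ vv⁻¹ vv⁻¹)
    e≡ : e ≡ pₘ ℚ.* v⁻¹
    e≡ = begin
      e ≡⟨ divide e F F⁻¹ T₁ eF FF⁻¹ ⟩
      T₁ ℚ.* F⁻¹ ≡⟨ cong (ℚ._* F⁻¹) (divide T₁ v v⁻¹ (pₘ ℚ.* F) T₁v vv⁻¹) ⟩
      (pₘ ℚ.* F) ℚ.* v⁻¹ ℚ.* F⁻¹ ≡⟨ solve 4 (λ p F w G → (p :* F) :* w :* G := (p :* w) :* (F :* G))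
                                   refl pₘ F v⁻¹ F⁻¹ ⟩
      (pₘ ℚ.* v⁻¹) ℚ.* (F ℚ.* F⁻¹) ≡⟨ *-one (pₘ ℚ.* v⁻¹) FF⁻¹ ⟩
      pₘ ℚ.* v⁻¹ ∎
    e²≡ : e ℚ.* e ≡ p₂ ℚ.* (v⁻¹ ℚ.* v⁻¹) ℚ.+ m ℚ.* m ℚ.* p₁ ℚ.* (v⁻¹ ℚ.* v⁻¹) ℚ.+ r ℚ.* v⁻¹
    e²≡ = begin
      e ℚ.* e
        ≡⟨ cong₂ ℚ._*_ e≡ e≡ ⟩
      (pₘ ℚ.* v⁻¹) ℚ.* (pₘ ℚ.* v⁻¹)
        ≡⟨ solve 2 (λ p w → (p :* w) :* (p :* w) := (p :* p) :* (w :* w)) refl pₘ v⁻¹ ⟩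
      (pₘ ℚ.* pₘ) ℚ.* (v⁻¹ ℚ.* v⁻¹)
        ≡⟨ cong (ℚ._* (v⁻¹ ℚ.* v⁻¹)) pₘ² ⟩
      (p₂ ℚ.+ m ℚ.* m ℚ.* p₁ ℚ.+ v ℚ.* r) ℚ.* (v⁻¹ ℚ.* v⁻¹)
        ≡⟨ solve 5 (λ x y v r w → (x :+ y :+ v :* r) :* (w :* w) :=
                                  x :* (w :* w) :+ y :* (w :* w) :+ r :* w :* (v :* w)) refl
             p₂ (m ℚ.* m ℚ.* p₁) v r v⁻¹ ⟩
      p₂ ℚ.* (v⁻¹ ℚ.* v⁻¹) ℚ.+ m ℚ.* m ℚ.* p₁ ℚ.* (v⁻¹ ℚ.* v⁻¹) ℚ.+ r ℚ.* v⁻¹ ℚ.* (v ℚ.* v⁻¹)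
        ≡⟨ cong (λ x → p₂ ℚ.* (v⁻¹ ℚ.* v⁻¹) ℚ.+ m ℚ.* m ℚ.* p₁ ℚ.* (v⁻¹ ℚ.* v⁻¹) ℚ.+ x)
             (*-one (r ℚ.* v⁻¹) vv⁻¹) ⟩
      p₂ ℚ.* (v⁻¹ ℚ.* v⁻¹) ℚ.+ m ℚ.* m ℚ.* p₁ ℚ.* (v⁻¹ ℚ.* v⁻¹) ℚ.+ r ℚ.* v⁻¹ ∎
    U₂a≡ : p₁ ℚ.* q⁻² ℚ.* a ≡ m ℚ.* m ℚ.* p₁ ℚ.* (v⁻¹ ℚ.* v⁻¹) ℚ.+ c ℚ.* p₁
    U₂a≡ = begin
      p₁ ℚ.* q⁻² ℚ.* a
        ≡⟨ cong (p₁ ℚ.* q⁻² ℚ.*_) a≡ ⟩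
      p₁ ℚ.* q⁻² ℚ.* (c₀ ℚ.* c₀ ℚ.+ t)
        -- With `c₀ = m q / v`, the part `c₀²` of the trace becomes the term that E[X]² cancels, and
        -- the part `t` becomes `c`.
        ≡⟨ cong (λ x → p₁ ℚ.* q⁻² ℚ.* (x ℚ.* x ℚ.+ t)) (divide c₀ v v⁻¹ (m ℚ.* q) c₀v vv⁻¹) ⟩
      p₁ ℚ.* q⁻² ℚ.* ((m ℚ.* q) ℚ.* v⁻¹ ℚ.* ((m ℚ.* q) ℚ.* v⁻¹) ℚ.+ t)
        ≡⟨ solve 6 (λ p s m q w t → p :* s :* ((m :* q) :* w :* ((m :* q) :* w) :+ t) :=
                                    m :* m :* p :* (w :* w) :* ((q :* q) :* s) :+ t :* s :* p) refl
             p₁ q⁻² m q v⁻¹ t ⟩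
      m ℚ.* m ℚ.* p₁ ℚ.* (v⁻¹ ℚ.* v⁻¹) ℚ.* ((q ℚ.* q) ℚ.* q⁻²) ℚ.+ t ℚ.* q⁻² ℚ.* p₁
        ≡⟨ cong₂ (λ x y → x ℚ.+ y ℚ.* p₁) (*-one (m ℚ.* m ℚ.* p₁ ℚ.* (v⁻¹ ℚ.* v⁻¹)) qqq⁻²)
             (sym (divide c (q ℚ.* q) q⁻² t cqq qqq⁻²)) ⟩
      m ℚ.* m ℚ.* p₁ ℚ.* (v⁻¹ ℚ.* v⁻¹) ℚ.+ c ℚ.* p₁ ∎
    g≡ : g ≡ p₂ ℚ.* (v⁻¹ ℚ.* v⁻¹) ℚ.+ (m ℚ.* m ℚ.* p₁ ℚ.* (v⁻¹ ℚ.* v⁻¹) ℚ.+ c ℚ.* p₁) ℚ.+ R ℚ.* F⁻¹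
    g≡ = begin
      g
        ≡⟨ divide g F F⁻¹ T₂ gF FF⁻¹ ⟩
      T₂ ℚ.* F⁻¹
        ≡⟨ cong (ℚ._* F⁻¹) T₂≡ ⟩
      (U₁ ℚ.+ U₂ ℚ.* a ℚ.+ R) ℚ.* F⁻¹
        ≡⟨ cong₂ (λ x y → (x ℚ.+ y ℚ.* a ℚ.+ R) ℚ.* F⁻¹) (divide U₁ (v ℚ.* v) (v⁻¹ ℚ.* v⁻¹) (p₂ ℚ.* F) U₁≡ vvvv) (divide U₂ (q ℚ.* q) q⁻² (p₁ ℚ.* F) U₂≡ qqq⁻²) ⟩
      ((p₂ ℚ.* F) ℚ.* (v⁻¹ ℚ.* v⁻¹) ℚ.+ (p₁ ℚ.* F) ℚ.* q⁻² ℚ.* a ℚ.+ R) ℚ.* F⁻¹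
        ≡⟨ solve 8 (λ x F w p s a R G → ((x :* F) :* w :+ (p :* F) :* s :* a :+ R) :* G :=
                                        (x :* w :+ p :* s :* a) :* (F :* G) :+ R :* G) refl
             p₂ F (v⁻¹ ℚ.* v⁻¹) p₁ q⁻² a R F⁻¹ ⟩
      (p₂ ℚ.* (v⁻¹ ℚ.* v⁻¹) ℚ.+ p₁ ℚ.* q⁻² ℚ.* a) ℚ.* (F ℚ.* F⁻¹) ℚ.+ R ℚ.* F⁻¹
        ≡⟨ cong (ℚ._+ R ℚ.* F⁻¹) (*-one (p₂ ℚ.* (v⁻¹ ℚ.* v⁻¹) ℚ.+ p₁ ℚ.* q⁻² ℚ.* a) FF⁻¹) ⟩
      p₂ ℚ.* (v⁻¹ ℚ.* v⁻¹) ℚ.+ p₁ ℚ.* q⁻² ℚ.* a ℚ.+ R ℚ.* F⁻¹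
        ≡⟨ cong (λ x → p₂ ℚ.* (v⁻¹ ℚ.* v⁻¹) ℚ.+ x ℚ.+ R ℚ.* F⁻¹) U₂a≡ ⟩
      p₂ ℚ.* (v⁻¹ ℚ.* v⁻¹) ℚ.+ (m ℚ.* m ℚ.* p₁ ℚ.* (v⁻¹ ℚ.* v⁻¹) ℚ.+ c ℚ.* p₁) ℚ.+ R ℚ.* F⁻¹ ∎

-- The difference is `ρ - (σ + c δ)`, where `ρ` and `σ` are the remainders R/n! and r/m!², both at
-- most `B = r`, and `δ` is the defect of the falling factorial against the power.
error-bound : ∀ {V c p N δ ρ σ B K₁ K₂ y} → ℚ.0ℚ ℚ.≤ c → ℚ.0ℚ ℚ.≤ δ → ℚ.0ℚ ℚ.≤ ρ → ℚ.0ℚ ℚ.≤ σ →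
  V ≡ c ℚ.* p ℚ.+ (ρ ℚ.- σ) → N ≡ p ℚ.+ δ → ρ ℚ.≤ B → σ ℚ.≤ B → B ℚ.≤ K₂ ℚ.* y → δ ℚ.≤ K₁ ℚ.* y →
  ℚ.∣ V ℚ.- c ℚ.* N ∣ ℚ.≤ (K₂ ℚ.+ K₂ ℚ.+ c ℚ.* K₁) ℚ.* y
error-bound {V} {c} {p} {N} {δ} {ρ} {σ} {B} {K₁} {K₂} {y} 0≤c 0≤δ 0≤ρ 0≤σ V≡ N≡ ρ≤ σ≤ B≤ δ≤ = begin
  ℚ.∣ V ℚ.- c ℚ.* N ∣
    ≡⟨ cong ℚ.∣_∣ (trans (cong₂ (λ x z → x ℚ.- c ℚ.* z) V≡ N≡)
         (solve 5 (λ c p ρ σ δ → c :* p :+ (ρ :- σ) :- c :* (p :+ δ) := ρ :- (σ :+ c :* δ)) refl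
            c p ρ σ δ)) ⟩
  ℚ.∣ ρ ℚ.- (σ ℚ.+ c ℚ.* δ) ∣
    ≤⟨ ∣p-q∣≤∣p∣+∣q∣ ρ (σ ℚ.+ c ℚ.* δ) ⟩
  ℚ.∣ ρ ∣ ℚ.+ ℚ.∣ σ ℚ.+ c ℚ.* δ ∣
    ≤⟨ ℚ.+-monoʳ-≤ ℚ.∣ ρ ∣ (∣p+q∣≤∣p∣+∣q∣ σ (c ℚ.* δ)) ⟩
  ℚ.∣ ρ ∣ ℚ.+ (ℚ.∣ σ ∣ ℚ.+ ℚ.∣ c ℚ.* δ ∣)
    ≡⟨ cong₂ ℚ._+_ (0≤p⇒∣p∣≡p 0≤ρ) (cong₂ ℚ._+_ (0≤p⇒∣p∣≡p 0≤σ) (trans (∣p*q∣≡∣p∣*∣q∣ c δ)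
         (cong₂ ℚ._*_ (0≤p⇒∣p∣≡p 0≤c) (0≤p⇒∣p∣≡p 0≤δ)))) ⟩
  ρ ℚ.+ (σ ℚ.+ c ℚ.* δ)
    ≤⟨ ℚ.+-mono-≤ (ℚ.≤-trans ρ≤ B≤) (ℚ.+-mono-≤ (ℚ.≤-trans σ≤ B≤) (*-monoˡ-≤-nonNeg c {{ℚ.nonNegative 0≤c}} δ≤)) ⟩
  K₂ ℚ.* y ℚ.+ (K₂ ℚ.* y ℚ.+ c ℚ.* (K₁ ℚ.* y))
    ≡⟨ solve 4 (λ k c l y → k :* y :+ (k :* y :+ c :* (l :* y)) := (k :+ k :+ c :* l) :* y) refl
         K₂ c K₁ y ⟩
  (K₂ ℚ.+ K₂ ℚ.+ c ℚ.* K₁) ℚ.* y ∎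
  where
  open ℚ.≤-Reasoning
  open ℚ-Solver using (solve; _:=_; _:*_; _:+_; _:-_)

0≤*recip : ∀ a b .{{_ : NonZero b}} → ℚ.0ℚ ℚ.≤ ι a ℚ.* recip b
0≤*recip a b = nonNegative⁻¹ _
  {{nonNeg*nonNeg⇒nonNeg (ι a) {{ι-nonNeg a}} (recip b) {{recip-nonNeg b}}}}

*recip-≤ : ∀ {a c} b .{{_ : NonZero b}} → a ≤ c * b → ι a ℚ.* recip b ℚ.≤ ι c
*recip-≤ {a} {c} b a≤cb = begin
  ι a ℚ.* recip b           ≤⟨ *-monoʳ-≤-nonNeg (recip b) {{recip-nonNeg b}} (ι-mono-≤ a≤cb) ⟩
  ι (c * b) ℚ.* recip b ≡⟨ cong (ℚ._* recip b) (ι-* c b) ⟩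
  ι c ℚ.* ι b ℚ.* recip b ≡⟨ trans (ℚ.*-assoc (ι c) (ι b) _) (cong (ι c ℚ.*_) (ι-recip b)) ⟩
  ι c ℚ.* ℚ.1ℚ ≡⟨ ℚ.*-identityʳ (ι c) ⟩
  ι c ∎
  where open ℚ.≤-Reasoning

ι-≡* : ∀ {a b c d} → a * b ≡ c * d → ι a ℚ.* ι b ≡ ι c ℚ.* ι d
ι-≡* {a} {b} {c} {d} eq = trans (sym (ι-* a b)) (trans (cong ι eq) (ι-* c d))

[m+n]-m≡n : ∀ a b → ℤ.+ (a + b) ℤ.- ℤ.+ a ≡ ℤ.+ b
[m+n]-m≡n a b = trans (ℤ.m-n≡m⊖n (a + b) a)
  (trans (ℤ.⊖-≥ (m≤m+n a b)) (cong ℤ.+_ (m+n∸m≡n a b)))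

-- The left side computes to `M + (suc M + 0)`, so only the trailing zero has to be removed.
2m∸1≡ : ∀ M → 2 * suc M ∸ 1 ≡ M + suc M
2m∸1≡ M = cong (M +_) (+-identityʳ (suc M))

2m∸2≡ : ∀ M → 2 * suc (suc M) ∸ 2 ≡ M + suc (suc M)
2m∸2≡ M = cong (M +_) (+-identityʳ (suc (suc M)))

-- Writing the excess of the trace as a natural number `t` removes the integer subtraction, so that
-- positivity and clearing the denominator apply directly.
c≡/ : ∀ M (π : Permutation′ (suc M)) t → shuffles M (suc M) * shuffles M (suc M) + t ≡ energy π →
      c π ≡ ℚ._/_ (ℤ.+ t) ((2 * suc M ∸ 1) ! * (2 * suc M ∸ 1) !)
                  {{(2 * suc M ∸ 1) !* (2 * suc M ∸ 1) !≢0}}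
c≡/ M π t eq = cong (λ i → ℚ._/_ i ((2 * suc M ∸ 1) ! * (2 * suc M ∸ 1) !)
                                   {{(2 * suc M ∸ 1) !* (2 * suc M ∸ 1) !≢0}}) (begin
  ℤ.+ trace π ℤ.- ℤ.+ (((2 * suc M ∸ 1) C M) ^ 2)
    ≡⟨ cong₂ (λ x y → ℤ.+ x ℤ.- ℤ.+ ((y C M) ^ 2)) (trans (trace≡energy π) (sym eq)) (2m∸1≡ M) ⟩
  ℤ.+ (s * s + t) ℤ.- ℤ.+ (s ^ 2)
    ≡⟨ cong (λ x → ℤ.+ (s * s + t) ℤ.- ℤ.+ (s * x)) (*-identityʳ s) ⟩
  ℤ.+ (s * s + t) ℤ.- ℤ.+ (s * s)
    ≡⟨ [m+n]-m≡n (s * s) t ⟩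
  ℤ.+ t ∎)
  where
  open ≡-Reasoning
  s = shuffles M (suc M)

c-q² : ∀ M (π : Permutation′ (suc M)) t → shuffles M (suc M) * shuffles M (suc M) + t ≡ energy π →
       c π ℚ.* (ι ((M + suc M) !) ℚ.* ι ((M + suc M) !)) ≡ ι t
c-q² M π t eq = begin
  c π ℚ.* (ι ((M + suc M) !) ℚ.* ι ((M + suc M) !))
    ≡⟨ cong (λ k → c π ℚ.* (ι (k !) ℚ.* ι (k !))) (2m∸1≡ M) ⟨
  c π ℚ.* (ι (k !) ℚ.* ι (k !))
    ≡⟨ cong₂ ℚ._*_ (c≡/ M π t eq) (sym (ι-* (k !) (k !))) ⟩
  ℚ._/_ (ℤ.+ t) (k ! * k !) {{k !* k !≢0}} ℚ.* ι (k ! * k !)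
    ≡⟨ /-*-ι t (k ! * k !) {{k !* k !≢0}} ⟩
  ι t ∎
  where
  open ≡-Reasoning
  k = 2 * suc M ∸ 1

-- The sign of the constant and the variance estimate

module _ (M : ℕ) (π : Permutation′ (suc (suc M))) where

  private
    m s : ℕ
    m = suc (suc M)
    s = shuffles (suc M) m
    excess : ∃ λ t → suc (s * s) + t ≡ energy π
    excess = m≤n⇒∃[o]m+o≡n (energy-lower-bound M π)
    t : ℕ
    -- The strict lower bound makes the excess a successor, whence `c π > 0`.
    t = suc (proj₁ excess)
    s²+t≡ : s * s + t ≡ energy π
    s²+t≡ = trans (+-suc (s * s) (proj₁ excess)) (proj₂ excess)

  c-positive : c π ℚ.> ℚ.0ℚ
  c-positive = subst (ℚ.0ℚ ℚ.<_) (sym (c≡/ (suc M) π t s²+t≡))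
    (ℚ.positive⁻¹ _ {{ℚ.normalize-pos t (k ! * k !) {{k !* k !≢0}}}})
    where
    k = 2 * m ∸ 1

  -- The bound on crowded pairs counts twice, once for each moment; the last term pays for replacing
  -- f(2m-1) by n^(2m-1).
  errorConstant : ℚ
  errorConstant = ι (proj₁ (crowded-bound M)) ℚ.+ ι (proj₁ (crowded-bound M)) ℚ.+
                  c π ℚ.* ι (proj₁ (^≤P′ (M + m)))

  module _ (d n : ℕ) (2m+d≡n : (m + m) + d ≡ n) where

    open Counts (suc M) d n 2m+d≡n hiding (m)

    private
      second : _
      second = second-moment π n d 2m+d≡n
      R r U₁ U₂ : ℕ
      R = proj₁ second
      U₁ = disjoints * (disjoints * d !)
      U₂ = meets * (meets * suc d !)
      r = crowded n m
      instance
        n!≢0 : NonZero (n !)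
        n!≢0 = n !≢0
        v≢0 : NonZero v
        v≢0 = m !* m !≢0
        q²≢0 : NonZero (q * q)
        q²≢0 = (suc M + m) !* (suc M + m) !≢0

    ι-second : ι (∑ (S n) (λ τ → X π τ * X π τ)) ≡
      ι U₁ ℚ.+ ι U₂ ℚ.* ι (energy π) ℚ.+ ι R
    ι-second = trans (cong ι (proj₂ (proj₂ second)))
      (trans (ι-+ (U₁ + U₂ * energy π) R) (cong (ℚ._+ ι R)
        (trans (ι-+ U₁ (U₂ * energy π))
          (cong (ι U₁ ℚ.+_) (ι-* U₂ (energy π))))))

    ι-P′² : ι (n P′ m) ℚ.* ι (n P′ m) ≡
      ι (n P′ (m + m)) ℚ.+ ι m ℚ.* ι m ℚ.* ι (n P′ (suc M + m)) ℚ.+ ι v ℚ.* ι r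
    ι-P′² = trans (sym (ι-* (n P′ m) (n P′ m))) (trans (cong ι P′²-crowded)
      (trans (ι-+ (p₂ + m * m * p₁) (v * r)) (cong₂ ℚ._+_
        (trans (ι-+ p₂ (m * m * p₁)) (cong (ι p₂ ℚ.+_)
          (trans (ι-* (m * m) p₁) (cong (ℚ._* ι p₁) (ι-* m m)))))
        (ι-* v r))))
      where
      p₁ = n P′ (suc M + m)
      p₂ = n P′ (m + m)

    variance-expansion : Var π n ≡
      c π ℚ.* ι (n P′ (suc M + m)) ℚ.+ (ι R ℚ.* recip (n !) ℚ.- ι r ℚ.* recip v)
    variance-expansion = variance-identity
      {F = ι (n !)} {recip (n !)} {ι v} {recip v} {ι q} {recip (q * q)}
      (ι-recip (n !)) (ι-recip v) (trans (cong (ℚ._* recip (q * q)) (sym (ι-* q q))) (ι-recip (q * q)))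
      {g = E² π n} {U₁ = ι U₁} {ι U₂}
      {ι (energy π)} {ι R} {ι (n P′ (suc M + m))} {ι (n P′ (m + m))} {E π n}
      {ι ((n C m) * ((n C m) * (m + d) !))} {ι (n P′ m)} {ι m} {ι r} {ι s} {ι t} {c π}
      (mean-S n _) ι-second
      (trans (cong (ι U₁ ℚ.*_) (sym (ι-* v v)))
        (ι-≡* {U₁} {v * v} {n P′ (m + m)} {n !} disjoint-term))
      (trans (cong (ι U₂ ℚ.*_) (sym (ι-* q q)))
        (ι-≡* {U₂} {q * q} {n P′ (suc M + m)} {n !} meet-term))
      (trans (mean-S n (X π)) (cong ι (first-moment π n (m + d) m+[m+d]≡n)))
      (ι-≡* {(n C m) * ((n C m) * (m + d) !)} {v} {n P′ m} {n !} first-term)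
      ι-P′²
      (ι-≡* {s} {v} {m} {q} central-v)
      (trans (cong ι (sym s²+t≡)) (trans (ι-+ (s * s) t) (cong (ℚ._+ ι t) (ι-* s s))))
      (c-q² (suc M) π t s²+t≡)

    variance-bound :
      ℚ.∣ Var π n ℚ.- c π ℚ.* ι (n ^ (suc M + m)) ∣ ℚ.≤ errorConstant ℚ.* ι (n ^ (M + m))
    variance-bound = error-bound
      {V = Var π n} {c π} {ι p} {ι (n ^ (suc M + m))} {ι (n ^ (suc M + m) ∸ p)}
      {ι R ℚ.* recip (n !)} {ι r ℚ.* recip v} {ι r}
      {ι (proj₁ (^≤P′ (M + m)))} {ι (proj₁ (crowded-bound M))} {ι (n ^ (M + m))}
      (ℚ.<⇒≤ c-positive) (0≤ι (n ^ (suc M + m) ∸ p)) (0≤*recip R (n !)) (0≤*recip r v)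
      variance-expansion
      (trans (cong ι (sym (m+[n∸m]≡n (P′≤^ n (suc M + m))))) (ι-+ p _))
      (*recip-≤ {R} {r} (n !) (proj₁ (proj₂ second)))
      (*recip-≤ {r} {r} v (m≤m*n r v))
      (subst (ι r ℚ.≤_) (ι-* (proj₁ (crowded-bound M)) (n ^ (M + m)))
        (ι-mono-≤ (proj₂ (crowded-bound M) d n 2m+d≡n)))
      (subst (ι (n ^ (suc M + m) ∸ p) ℚ.≤_) (ι-* (proj₁ (^≤P′ (M + m))) (n ^ (M + m)))
        (ι-mono-≤ (m≤n+o⇒m∸n≤o (n ^ (suc M + m)) p (proj₂ (^≤P′ (M + m)) n))))
      where
      p = n P′ (suc M + m)

theorem4p2 : ∀ (m : ℕ) → m > 1 → (π : Permutation′ m) →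
    (trace π ≡ Σ[ m ] (λ i → Σ[ m ] (λ j → ⟦ i , j ⟧ * ⟦ π ⟨$⟩ʳ i , π ⟨$⟩ʳ j ⟧)))
    × (c π ℚ.> ℚ.0ℚ)
    × (∃₂ λ (K : ℚ) (N₀ : ℕ) → ∀ (n : ℕ) → n ≥ m → n ≥ N₀ →
    ℚ.∣ Var π n ℚ.- c π ℚ.* (n ^ℚ (2 * m ∸ 1)) ∣ ℚ.≤ K ℚ.* (n ^ℚ (2 * m ∸ 2)))
theorem4p2 (suc zero)    (s≤s ()) π
theorem4p2 (suc (suc M)) _        π =
  trace≡energy π , c-positive M π ,
  -- The threshold is 2m, since the counts are stated for `n = 2m + d`.
  errorConstant M π , suc (suc M) + suc (suc M) , λ n _ n≥2m →
  subst₂ (λ k l → ℚ.∣ Var π n ℚ.- c π ℚ.* (n ^ℚ k) ∣ ℚ.≤ errorConstant M π ℚ.* (n ^ℚ l))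
    (sym (2m∸1≡ (suc M))) (sym (2m∸2≡ M))
    (variance-bound M π (n ∸ (suc (suc M) + suc (suc M))) n (m+[n∸m]≡n n≥2m))
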